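{- For every $n\ge 2$ the genus distribution of ${\cal S}_5^n$ is unimodal, and its peak $p_5(n)$ is $$p_5(n)=\begin{cases}\Big[\dfrac{n}{2}\Big], & 2\le n\le 5,\\[2mm] \Big[\dfrac{n+1}{3}\Big]+1, & 6\le n\le 16,\\[2mm] \Big[\dfrac{n+2}{3}\Big]+1, & n\ge 17.\end{cases}$$
   Context: $[x]$ denotes the largest integer not exceeding $x$. A surface is represented by a cyclic word in which every occurring letter $x$ appears exactly once as $x$ and exactly once as $x^-$; it is the closed orientable surface obtained from a polygon with boundary labelled by the word by identifying each side $x$ with the side $x^-$ (orientation reversed), and its genus is the genus of that surface. Let $a,a_1,a_2,\dots$ be distinct letters. For $n\ge 1$ and subsets $K,T\subseteq\{1,\dots,n\}$ put: $R_1^n$ = product of the letters $a_k$, $k\in K$, in decreasing order of index; $R_2^n$ = product of the $a_k$, $k\notin K$, in increasing order of index; $R_3^n$ = product of the $a_t^-$, $t\in T$, in decreasing order of index; $R_4^n$ = product of the $a_t^-$, $t\notin T$, in increasing order of index. The set of ladder surfaces considered is ${\cal S}_5^n=\{aR_1^nR_3^na^-R_2^nR_4^n\}$, where $(K,T)$ runs over all $4^n$ pairs of subsets and surfaces are counted with multiplicity (one for each pair). $g_{i_5}(n)$ is the number of surfaces of genus $i$ in ${\cal S}_5^n$, and the genus distribution of ${\cal S}_5^n$ is the sequence $(g_{i_5}(n))_i$, with $i$ running from the minimum to the maximum genus of surfaces in ${\cal S}_5^n$. A finite sequence of nonnegative numbers $\{a_i\}_{i=q}^n$ is unimodal if $a_q\le\cdots\le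 a_{l-1}<a_l=\cdots=a_m>a_{m+1}\ge\cdots\ge a_n$ for some $q\le l\le m\le n$; $l,\dots,m$ are its modes, and if $l=m$ then $m$ is called the peak (indices are genera). -}

module Defs where

open import Data.Bool.Base using (if_then_else_)
open import Data.Fin.Base as Fin using (Fin; suc; toℕ)
open import Data.Fin.Properties as Fin using (all?; any?)
open import Data.Fin.Subset using (Subset; inside; outside; ∁) renaming (_∈_ to _∈ˢ_)
open import Data.Fin.Subset.Properties using (_∈?_; x∈∁p⇒x∉p; x∉p⇒x∈∁p)
open import Data.Integer.Base as ℤ using (ℤ; +_; 1ℤ)
import Data.Integer.Properties as ℤ
open import Data.List.Base using (List; []; _∷_; [_]; _++_; map; filter; reverse; length; allFin; cartesianProduct)
open import Data.List.Membership.Propositional using (_∈_; _∉_)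
open import Data.List.Membership.Propositional.Properties
  using (∈-lookup; ∈-++⁺ˡ; ∈-++⁺ʳ; ∈-++⁻; ∈-map⁺; ∈-map⁻; ∈-filter⁺; ∈-filter⁻; ∈-allFin)
open import Data.List.Relation.Binary.Disjoint.Propositional using (Disjoint)
open import Data.List.Relation.Binary.Permutation.Propositional using (↭-sym; ↭⇒↭ₛ)
open import Data.List.Relation.Binary.Permutation.Propositional.Properties using (↭-reverse; ∈-resp-↭)
import Data.List.Relation.Binary.Permutation.Setoid.Properties as ↭ₛ
import Data.List.Relation.Unary.All as All
open import Data.List.Relation.Unary.AllPairs using ([]; _∷_)
open import Data.List.Relation.Unary.Any using (here; index)
open import Data.List.Relation.Unary.Unique.Propositional using (Unique)
import Data.List.Relation.Unary.Unique.Propositional.Properties as Unique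
open import Data.Nat.Base using (ℕ; zero; suc; _+_; _*_; _≤_; _<_; _≤ᵇ_)
open import Data.Nat.DivMod using (_/_; _mod_)
open import Data.Nat.GeneralisedArithmetic using (iterate)
open import Data.Product.Base using (∃-syntax; ∃₂; _×_; _,_; proj₂)
open import Data.Sum.Base using ([_,_]′)
open import Data.Vec.Base using ([]; _∷_)
open import Function.Base using (_∘_)
open import Relation.Binary.PropositionalEquality using (_≡_; _≢_; refl; setoid)
open import Relation.Nullary using (Dec; yes; no)
open import Relation.Nullary.Decidable using (_→-dec_)
open import Relation.Unary using (Decidable)

------------------------------------------------------------------------
-- Surfaces given by words

data Side (A : Set) : Set where
  _⁺ _⁻ : A → Side A

module _ {A : Set} where

  inv : Side A → Side A
  inv (x ⁺) = x ⁻
  inv (x ⁻) = x ⁺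

  data Positive : Side A → Set where
    pos : ∀ {x} → Positive (x ⁺)

  positive? : Decidable Positive
  positive? (x ⁺) = yes pos
  positive? (x ⁻) = no λ ()

-- Each occurring letter x appears exactly once as x ⁺ and exactly once
-- as x ⁻.  The list is read cyclically.
record Surface (A : Set) : Set where
  field
    word   : List (Side A)
    unique : Unique word
    closed : ∀ {s} → s ∈ word → inv s ∈ word

next : ∀ {N} → Fin N → Fin N
next {suc N} i = suc (toℕ i) mod suc N

module _ {A : Set} (S : Surface A) where
  open Surface S

  -- An index is used both for a side of the polygon and for the corner at
  -- which that side starts; side i ends at corner next i.
  Corner : Set
  Corner = Fin (length word)

  mate : Corner → Corner
  mate i = index (closed (∈-lookup i))

  -- Gluing side i to side mate i with reversed orientation identifies the
  -- start of side i with the end of side mate i.  (The end of side i and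
  -- the start of mate i are identified by the instance at mate i.)
  rotate : Corner → Corner
  rotate i = next (mate i)

  -- rotate is a permutation, so the identified corners are those in the
  -- same cycle, and fewer than length word iterations exhaust a cycle.
  SameVertex : Corner → Corner → Set
  SameVertex i j = ∃[ k ] iterate rotate i (toℕ {length word} k) ≡ j

  sameVertex? : ∀ i j → Dec (SameVertex i j)
  sameVertex? i j = any? λ k → iterate rotate i (toℕ k) Fin.≟ j

  -- Each vertex of the glued surface is counted through its least corner.
  LeastCorner : Corner → Set
  LeastCorner i = ∀ j → SameVertex i j → i Fin.≤ j

  leastCorner? : Decidable LeastCorner
  leastCorner? i = all? λ j → sameVertex? i j →-dec (i Fin.≤? j)

  #vertices #edges : ℕ
  #vertices = length (filter leastCorner? (allFin (length word)))
  #edges    = length (filter positive? word)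

  -- The polygon is the only face.
  χ : ℤ
  χ = + #vertices ℤ.- + #edges ℤ.+ 1ℤ

  -- A closed orientable surface of genus g has Euler characteristic 2 - 2g.
  HasGenus : ℕ → Set
  HasGenus g = χ ≡ + 2 ℤ.- + (2 * g)

  hasGenus? : Decidable HasGenus
  hasGenus? g = χ ℤ.≟ + 2 ℤ.- + (2 * g)

------------------------------------------------------------------------
-- The ladder surfaces a R₁ R₃ a⁻ R₂ R₄

-- rung k, for k : Fin n, is the letter with index suc (toℕ k).
data Letter (n : ℕ) : Set where
  a    : Letter n
  rung : Fin n → Letter n

module _ {n : ℕ} where

  increasing decreasing : Subset n → List (Fin n)
  increasing K = filter (_∈? K) (allFin n)
  decreasing K = reverse (increasing K)

  rung⁺ rung⁻ : Fin n → Side (Letter n)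
  rung⁺ k = rung k ⁺
  rung⁻ k = rung k ⁻

  R₁ R₂ R₃ R₄ : Subset n → List (Side (Letter n))
  R₁ K = map rung⁺ (decreasing K)
  R₂ K = map rung⁺ (increasing (∁ K))
  R₃ T = map rung⁻ (decreasing T)
  R₄ T = map rung⁻ (increasing (∁ T))

  ladderWord : Subset n → Subset n → List (Side (Letter n))
  ladderWord K T = [ a ⁺ ] ++ R₁ K ++ R₃ T ++ [ a ⁻ ] ++ R₂ K ++ R₄ T

  ∈-increasing⁺ : ∀ {k K} → k ∈ˢ K → k ∈ increasing K
  ∈-increasing⁺ {k} {K} = ∈-filter⁺ (_∈? K) (∈-allFin k)

  ∈-increasing⁻ : ∀ {k} K → k ∈ increasing K → k ∈ˢ K
  ∈-increasing⁻ K = proj₂ ∘ ∈-filter⁻ (_∈? K) {xs = allFin n}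

  ∈-decreasing⁺ : ∀ {k K} → k ∈ˢ K → k ∈ decreasing K
  ∈-decreasing⁺ {K = K} = ∈-resp-↭ (↭-sym (↭-reverse (increasing K))) ∘ ∈-increasing⁺

  ∈-decreasing⁻ : ∀ {k} K → k ∈ decreasing K → k ∈ˢ K
  ∈-decreasing⁻ K = ∈-increasing⁻ K ∘ ∈-resp-↭ (↭-reverse (increasing K))

  increasing-unique : ∀ K → Unique (increasing K)
  increasing-unique K = Unique.filter⁺ (_∈? K) (Unique.allFin⁺ n)

  decreasing-unique : ∀ K → Unique (decreasing K)
  decreasing-unique K = ↭ₛ.Unique-resp-↭ (setoid (Fin n))
    (↭⇒↭ₛ (↭-sym (↭-reverse (increasing K)))) (increasing-unique K)

  ladderWord-complete : ∀ K T s → s ∈ ladderWord K T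
  ladderWord-complete K T s = go s
    where
    from-R₁ : ∀ {x} → x ∈ R₁ K → x ∈ ladderWord K T
    from-R₁ = ∈-++⁺ʳ [ a ⁺ ] ∘ ∈-++⁺ˡ

    after-R₁ : ∀ {x} → x ∈ R₃ T ++ [ a ⁻ ] ++ R₂ K ++ R₄ T → x ∈ ladderWord K T
    after-R₁ = ∈-++⁺ʳ [ a ⁺ ] ∘ ∈-++⁺ʳ (R₁ K)

    after-a⁻ : ∀ {x} → x ∈ R₂ K ++ R₄ T → x ∈ ladderWord K T
    after-a⁻ = after-R₁ ∘ ∈-++⁺ʳ (R₃ T) ∘ ∈-++⁺ʳ [ a ⁻ ]

    go : ∀ s → s ∈ ladderWord K T
    go (a ⁺) = here refl
    go (a ⁻) = after-R₁ (∈-++⁺ʳ (R₃ T) (here refl))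
    go (rung k ⁺) with k ∈? K
    ... | yes k∈K = from-R₁ (∈-map⁺ rung⁺ (∈-decreasing⁺ k∈K))
    ... | no  k∉K = after-a⁻ (∈-++⁺ˡ (∈-map⁺ rung⁺ (∈-increasing⁺ (x∉p⇒x∈∁p k∉K))))
    go (rung k ⁻) with k ∈? T
    ... | yes k∈T = after-R₁ (∈-++⁺ˡ (∈-map⁺ rung⁻ (∈-decreasing⁺ k∈T)))
    ... | no  k∉T = after-a⁻ (∈-++⁺ʳ (R₂ K) (∈-map⁺ rung⁻ (∈-increasing⁺ (x∉p⇒x∈∁p k∉T))))

  ladderWord-unique : ∀ K T → Unique (ladderWord K T)
  ladderWord-unique K T =
    Unique.++⁺ singleton
      (Unique.++⁺ (Unique.map⁺ (λ { refl → refl }) (decreasing-unique K))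
        (Unique.++⁺ (Unique.map⁺ (λ { refl → refl }) (decreasing-unique T))
          (Unique.++⁺ singleton
            (Unique.++⁺ (Unique.map⁺ (λ { refl → refl }) (increasing-unique (∁ K)))
                        (Unique.map⁺ (λ { refl → refl }) (increasing-unique (∁ T)))
              (map-disjoint rung⁺ iK λ _ → ∉-map rung⁻ iT λ _ ()))
            (singleton-disjoint (∉-++ (R₂ K) (∉-map rung⁺ iK λ _ ()) (∉-map rung⁻ iT λ _ ()))))
          (map-disjoint rung⁻ (decreasing T) λ k∈ →
            ∉-++ [ a ⁻ ] (λ { (here ()) })
              (∉-++ (R₂ K) (∉-map rung⁺ iK λ _ ())
                (∉-map rung⁻ iT λ { l∈ refl → separate T k∈ l∈ }))))
        (map-disjoint rung⁺ (decreasing K) λ k∈ →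
          ∉-++ (R₃ T) (∉-map rung⁻ (decreasing T) λ _ ())
            (∉-++ [ a ⁻ ] (λ { (here ()) })
              (∉-++ (R₂ K) (∉-map rung⁺ iK λ { l∈ refl → separate K k∈ l∈ })
                (∉-map rung⁻ iT λ _ ())))))
      (singleton-disjoint
        (∉-++ (R₁ K) (∉-map rung⁺ (decreasing K) λ _ ())
          (∉-++ (R₃ T) (∉-map rung⁻ (decreasing T) λ _ ())
            (∉-++ [ a ⁻ ] (λ { (here ()) })
              (∉-++ (R₂ K) (∉-map rung⁺ iK λ _ ()) (∉-map rung⁻ iT λ _ ()))))))
    where
    iK iT : List (Fin n)
    iK = increasing (∁ K)
    iT = increasing (∁ T)

    singleton : ∀ {s : Side (Letter n)} → Unique [ s ]
    singleton = All.[] ∷ []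

    ∉-++ : ∀ {s : Side (Letter n)} xs {ys} → s ∉ xs → s ∉ ys → s ∉ xs ++ ys
    ∉-++ xs p q = [ p , q ]′ ∘ ∈-++⁻ xs

    ∉-map : ∀ {s} (f : Fin n → Side (Letter n)) ks → (∀ {l} → l ∈ ks → s ≢ f l) → s ∉ map f ks
    ∉-map f ks h s∈ with ∈-map⁻ f s∈
    ... | _ , l∈ , e = h l∈ e

    separate : ∀ {k} L → k ∈ decreasing L → k ∉ increasing (∁ L)
    separate L p q = x∈∁p⇒x∉p (∈-increasing⁻ (∁ L) q) (∈-decreasing⁻ L p)

    singleton-disjoint : ∀ {s : Side (Letter n)} {ys} → s ∉ ys → Disjoint [ s ] ys
    singleton-disjoint s∉ (here refl , q) = s∉ q

    map-disjoint : ∀ (f : Fin n → Side (Letter n)) ks {ys} →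
                   (∀ {k} → k ∈ ks → f k ∉ ys) → Disjoint (map f ks) ys
    map-disjoint f ks h (p , q) with ∈-map⁻ f p
    ... | _ , k∈ , refl = h k∈ q

  ladder : Subset n → Subset n → Surface (Letter n)
  ladder K T = record
    { word   = ladderWord K T
    ; unique = ladderWord-unique K T
    ; closed = λ {s} _ → ladderWord-complete K T (inv s)
    }

subsets : ∀ n → List (Subset n)
subsets zero    = [ [] ]
subsets (suc n) = map (outside ∷_) (subsets n) ++ map (inside ∷_) (subsets n)

-- g₅ n i is the number of pairs (K , T) whose ladder surface has genus i.
g₅ : ℕ → ℕ → ℕ
g₅ n i = length (filter (λ (K , T) → hasGenus? (ladder K T) i)
                        (cartesianProduct (subsets n) (subsets n)))

IsMinGenus IsMaxGenus : ℕ → ℕ → Set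
IsMinGenus n q = (∃₂ λ (K T : Subset n) → HasGenus (ladder K T) q) ×
                 (∀ (K T : Subset n) g → HasGenus (ladder K T) g → q ≤ g)
IsMaxGenus n r = (∃₂ λ (K T : Subset n) → HasGenus (ladder K T) r) ×
                 (∀ (K T : Subset n) g → HasGenus (ladder K T) g → g ≤ r)

------------------------------------------------------------------------
-- Unimodality

-- s q ≤ ⋯ ≤ s (l ∸ 1) < s l = ⋯ = s m > s (suc m) ≥ ⋯ ≥ s r
record HasModes (s : ℕ → ℕ) (q r l m : ℕ) : Set where
  field
    q≤l        : q ≤ l
    l≤m        : l ≤ m
    m≤r        : m ≤ r
    ascending  : ∀ i → q ≤ i → suc i < l → s i ≤ s (suc i)
    jump       : ∀ i → q ≤ i → suc i ≡ l → s i < s l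
    plateau    : ∀ i → l ≤ i → i ≤ m → s i ≡ s l
    drop       : m < r → s (suc m) < s m
    descending : ∀ i → m < i → i < r → s (suc i) ≤ s i

Unimodal : (ℕ → ℕ) → ℕ → ℕ → Set
Unimodal s q r = ∃₂ λ l m → HasModes s q r l m

IsPeak : (ℕ → ℕ) → ℕ → ℕ → ℕ → Set
IsPeak s q r p = HasModes s q r p p

p₅ : ℕ → ℕ
p₅ n = if n ≤ᵇ 5  then n / 2
       else if n ≤ᵇ 16 then (n + 1) / 3 + 1
       else (n + 2) / 3 + 1

{-# OPTIONS --safe #-}
-- Adding a rung of smallest index inserts its two sides at two of four fixed
-- places (slots) of the word.  Cut at the slots, the cycles of corners become
-- four strands, which join the slots according to a permutation, and loops.
-- An insertion changes the permutation by a transposition and closes at most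
-- one loop, so the genus is computed by an automaton on 24 permutations.  These
-- fall into 13 classes, and the recurrences for the generating polynomials
-- solve to
--
--   Σ gᵢ(n) xⁱ = 2x aₙ + (1 - x)(bₙ - 1) + wₙ,   [xᵏ] aₙ = 2ⁿ⁺ᵏ⁻¹ ℓₖ,   [xᵏ] bₙ = 8ᵏ ℓₖ,
--
-- where ℓₖ is n/(n - k) times n - k choose k and wₙ has at most two terms, of
-- degree about n/2.  Up to these, gₖ₊₁ = 2ⁿ⁺ᵏ ℓₖ + 8ᵏ⁺¹ ℓₖ₊₁ - 8ᵏ ℓₖ, which
-- increases in k roughly as long as ℓₖ₊₁/ℓₖ = d(d - 1)/((n - k - 1)(k + 1)),
-- d = n - 2k, is at least 1/2, that is, as long as 3k + 1 ≤ n.  The error terms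
-- are negligible for n ≥ 50; the smaller n are evaluated.
module Submission where

open import Defs
open import Data.Bool.Base using (Bool; true; false; not; if_then_else_)
open import Data.Fin.Base as Fin using (Fin; zero; suc; toℕ)
open import Data.Fin.Patterns using (0F; 1F; 2F; 3F)
import Data.Fin.Properties as Fin
open import Data.Fin.Subset using (Subset; ∁)
open import Data.List.Base
  using (List; []; _∷_; [_]; _++_; map; filter; length; lookup; allFin; concat; reverse; concatMap;
    foldr; cartesianProduct)
open import Data.List.Membership.Propositional using (_∈_; _∉_)
open import Data.List.Relation.Unary.All as All using (All; []; _∷_)
import Data.List.Relation.Unary.All.Properties as All
open import Data.List.Relation.Unary.AllPairs using ([]; _∷_)
open import Data.List.Relation.Unary.Any using (here; there; index)
open import Data.List.Relation.Unary.Unique.Propositional using (Unique)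
import Data.List.Relation.Unary.Unique.Propositional.Properties as Unique
open import Data.List.Relation.Binary.Permutation.Propositional as ↭
  using (_↭_; ↭-sym; ↭⇒↭ₛ; ↭-trans; ↭-refl; ↭-prep; ↭-swap; module PermutationReasoning; ↭-reflexive)
import Data.List.Relation.Binary.Permutation.Propositional.Properties as ↭
open import Data.Sum.Base as Sum using (_⊎_; inj₁; inj₂; [_,_]′)
open import Data.Vec.Base as Vec using (Vec; []; _∷_; _[_]≔_; toList)
import Data.Vec.Properties as Vec
open import Function.Base using (_∘_; id)
open import Level using (0ℓ)
open import Relation.Binary.PropositionalEquality hiding ([_]; J)
open import Relation.Nullary using (yes; no; contradiction; does; Dec; ¬_)
open import Relation.Nullary.Decidable
  using (dec-true; dec-false; from-yes; map′; _×-dec_; _→-dec_; True; toWitness)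
open import Relation.Unary using (Pred; Decidable)
open import Data.Nat.Base using (ℕ; _≤_)
open import Data.Product.Base using (∃-syntax; ∃₂; _×_; _,_; proj₁; proj₂; map₁)

-- Two obstacles shape the proof. `#vertices` is defined by a search among corners, which does not
-- follow an insertion. What follows it is the order of the sides around a vertex, so vertices are
-- exhibited as explicit cycles of sides, cut open where later sides may be inserted. A strand
-- between neighbouring slots can be empty, which has to be dealt with when the slots are erased.
-- The second obstacle is a tie. With n = d + 2k one has 2^(n + k) = 2^d 8^k, so both sequences in
-- the closed form come from one sequence `τ`, the first with the extra factor 2^d. Raising k for
-- fixed n divides this factor by 4, so to leading order the distribution increases when `τ` grows
-- by more than a factor 4, and for n = 3k + 1 it grows by exactly 4. Terms of lower order then
-- decide, downwards up to n = 16 and upwards from n = 19 on. Since [(n + 1)/3] and [(n + 2)/3]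
-- differ only for n = 3k + 1, this tie is why the peak has two formulas for n ≥ 6.

-- Vertices of a surface as cycles of sides

module CornerCycles where

  open import Data.List.Properties
    using (filter-++; filter-none; length-++; length-map; length-tabulate; ++-assoc; concat-map;
      map-tabulate; tabulate-cong; tabulate-lookup)
  open import Data.List.Membership.Propositional.Properties using (∈-lookup; ∈-++⁺ʳ; ∈-∃++)
  open import Data.List.Membership.Propositional.Properties.WithK using (unique⇒irrelevant)
  open import Data.List.Relation.Binary.Permutation.Propositional.Properties
    using (∈-resp-↭; filter-↭; ↭-length; ++-comm) renaming (map⁺ to ↭-map⁺)
  import Data.List.Relation.Binary.Permutation.Setoid.Properties as ↭ₛ
  open import Data.List.Relation.Unary.Any.Properties using (lookup-index)
  open import Data.Nat.Base using (ℕ; zero; suc; _+_; _≤_; _<_; z≤n; s≤s)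
  import Data.Nat.Properties as ℕ
  open import Data.Nat.DivMod using (_%_; m<n⇒m%n≡m; n%n≡0)
  open import Data.Nat.GeneralisedArithmetic using (iterate)

  length-filter-unique : ∀ {A : Set} {P : Pred A 0ℓ} (P? : Decidable P) {xs m} → Unique xs → m ∈ xs →
                         P m → (∀ {x} → x ∈ xs → P x → x ≡ m) → length (filter P? xs) ≡ 1
  length-filter-unique {P = P} P? {x ∷ xs} (x∉ ∷ u) (here refl) Pm only with P? x
  ... | no ¬P = contradiction Pm ¬P
  ... | yes _ = cong (suc ∘ length) (filter-none P? (All.tabulate λ y∈ Py →
                  contradiction (sym (only (there y∈) Py)) (All.lookup x∉ y∈)))
  length-filter-unique P? {x ∷ xs} (x∉ ∷ u) (there m∈) Pm only with P? x
  ... | yes Px = contradiction (only (here refl) Px) (All.lookup x∉ m∈)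
  ... | no _   = length-filter-unique P? u m∈ Pm (only ∘ there)

  least : ∀ {N} (i : Fin N) is → ∃[ m ] m ∈ i ∷ is × (∀ {j} → j ∈ i ∷ is → m Fin.≤ j)
  least i [] = i , here refl , λ { (here refl) → ℕ.≤-refl }
  least i (j ∷ is) with least j is
  ... | m , m∈ , m≤ with Fin.≤-total i m
  ...   | inj₁ i≤m = i , here refl , λ { (here refl) → ℕ.≤-refl ; (there p) → ℕ.≤-trans i≤m (m≤ p) }
  ...   | inj₂ m≤i = m , there m∈ , λ { (here refl) → m≤i ; (there p) → m≤ p }

  unique-++⁻ : ∀ {A : Set} (xs : List A) {ys} → Unique (xs ++ ys) → Unique xs × Unique ys
  unique-++⁻ []       u        = [] , u
  unique-++⁻ (x ∷ xs) (x∉ ∷ u) = map₁ (All.++⁻ˡ xs x∉ ∷_) (unique-++⁻ xs u)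

  -- Chain R x ys z: the list x ∷ ys ++ [ z ] has R between consecutive entries.
  module _ {A : Set} (R : A → A → Set) where

    data Chain : A → List A → A → Set where
      end : ∀ {x y} → R x y → Chain x [] y
      _∷_ : ∀ {x y z zs} → R x y → Chain y zs z → Chain x (y ∷ zs) z

    data IsCycle : List A → Set where
      cycle : ∀ {x xs} → Chain x xs x → IsCycle (x ∷ xs)

  module _ {A : Set} {R : A → A → Set} where

    chain-split : ∀ {x z} ys {y zs} → Chain R x (ys ++ y ∷ zs) z → Chain R x ys y × Chain R y zs z
    chain-split []       (r ∷ c) = end r , c
    chain-split (_ ∷ ys) (r ∷ c) = map₁ (r ∷_) (chain-split ys c)

    chain-++ : ∀ {x y z ys zs} → Chain R x ys y → Chain R y zs z → Chain R x (ys ++ y ∷ zs) z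
    chain-++ (end r) d = r ∷ d
    chain-++ (r ∷ c) d = r ∷ chain-++ c d

    chain-map : ∀ {B : Set} {Q : B → B → Set} (g : A → B) → (∀ {x y} → R x y → Q (g x) (g y)) →
                ∀ {x ys z} → Chain R x ys z → Chain Q (g x) (map g ys) (g z)
    chain-map g h (end r) = end (h r)
    chain-map g h (r ∷ c) = h r ∷ chain-map g h c

  Graph : {A : Set} → (A → A) → A → A → Set
  Graph f x y = f x ≡ y

  module _ {A : Set} {f : A → A} where

    chain-step : ∀ {x xs z y} → Chain (Graph f) x xs z → y ∈ x ∷ xs → f y ∈ xs ⊎ f y ≡ z
    chain-step (end e) (here refl) = inj₂ e
    chain-step (e ∷ c) (here refl) = inj₁ (here e)
    chain-step (e ∷ c) (there y∈)  = Sum.map₁ there (chain-step c y∈)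

    chain-iterate : ∀ {x xs z y} → Chain (Graph f) x xs z → y ∈ x ∷ xs →
                    ∃[ k ] k < length (x ∷ xs) × iterate f x k ≡ y
    chain-iterate c          (here refl) = 0 , s≤s z≤n , refl
    chain-iterate (refl ∷ c) (there y∈) with chain-iterate c y∈
    ... | k , k< , e = suc k , s≤s k< , e

    cycle-step : ∀ {xs y} → IsCycle (Graph f) xs → y ∈ xs → f y ∈ xs
    cycle-step (cycle c) y∈ with chain-step c y∈
    ... | inj₁ p = there p
    ... | inj₂ p = here p

    iterate-∈ : ∀ {xs y} → IsCycle (Graph f) xs → y ∈ xs → ∀ k → iterate f y k ∈ xs
    iterate-∈ c y∈ zero    = y∈
    iterate-∈ c y∈ (suc k) = iterate-∈ c (cycle-step c y∈) k

    -- A cycle can be read from any of its elements: starting at `x` swaps two pieces of the list,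
    -- after which `chain-iterate` applies.
    cycle-iterate : ∀ {xs x y} → IsCycle (Graph f) xs → x ∈ xs → y ∈ xs → ∃[ k ] k < length xs × iterate f x k ≡ y
    cycle-iterate (cycle {x} {xs} c) (here refl) y∈ = chain-iterate c y∈
    cycle-iterate (cycle {x} {xs} c) (there x∈) y∈ with ∈-∃++ x∈
    ... | ys , zs , refl with chain-split ys c
    ...   | c₁ , c₂ with ++-comm (x ∷ ys) (_ ∷ zs)
    ...     | rotation with chain-iterate (chain-++ c₂ c₁) (∈-resp-↭ rotation y∈)
    ...       | k , k< , e = k , subst (k <_) (sym (↭-length rotation)) k< , e

  module _ {A : Set} (S : Surface A) where
    open Surface S

    private
      N = length word

    -- `SameVertex` admits only exponents below `N`, hence the bound on the length of the cycle.
    sameVertex⁺ : ∀ {is i j} → IsCycle (Graph (rotate S)) is → length is ≤ N → i ∈ is → j ∈ is → SameVertex S i j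
    sameVertex⁺ {i = i} {j} c len i∈ j∈ with cycle-iterate c i∈ j∈
    ... | k , k< , e = Fin.fromℕ< (ℕ.<-≤-trans k< len) ,
                       subst (λ k → iterate (rotate S) i k ≡ j) (sym (Fin.toℕ-fromℕ< (ℕ.<-≤-trans k< len))) e

    sameVertex⁻ : ∀ {is i j} → IsCycle (Graph (rotate S)) is → i ∈ is → SameVertex S i j → j ∈ is
    sameVertex⁻ c i∈ (k , refl) = iterate-∈ c i∈ (toℕ k)

    #least-cycle : ∀ {is} → IsCycle (Graph (rotate S)) is → length is ≤ N → Unique is →
                   length (filter (leastCorner? S) is) ≡ 1
    #least-cycle {i ∷ is} c len u with least i is
    ... | m , m∈ , m≤ = length-filter-unique (leastCorner? S) u m∈
            (λ j → m≤ ∘ sameVertex⁻ c m∈)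
            (λ {j} j∈ least-j → Fin.≤-antisym (least-j m (sameVertex⁺ c len j∈ m∈)) (m≤ j∈))

    #least-cycles : ∀ cs → All (IsCycle (Graph (rotate S))) cs → length (concat cs) ≤ N → Unique (concat cs) →
                    length (filter (leastCorner? S) (concat cs)) ≡ length cs
    #least-cycles []       []       len u = refl
    #least-cycles (c ∷ cs) (p ∷ ps) len u = begin
      length (filter L? (c ++ concat cs))                       ≡⟨ cong length (filter-++ L? c (concat cs)) ⟩
      length (filter L? c ++ filter L? (concat cs))             ≡⟨ length-++ (filter L? c) ⟩
      length (filter L? c) + length (filter L? (concat cs))
        ≡⟨ cong₂ _+_ (#least-cycle p (ℕ.≤-trans (ℕ.m≤m+n _ _) len′) (proj₁ u′))
                     (#least-cycles cs ps (ℕ.≤-trans (ℕ.m≤n+m _ (length c)) len′) (proj₂ u′)) ⟩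
      suc (length cs) ∎
      where
      open ≡-Reasoning
      L? = leastCorner? S
      len′ = subst (_≤ N) (length-++ c) len
      u′ = unique-++⁻ c u

    -- Each cycle contains exactly one least corner, so a list of cycles that partitions the corners
    -- counts the vertices.
    #vertices-cycles : ∀ {cs} → All (IsCycle (Graph (rotate S))) cs → concat cs ↭ allFin N →
                       #vertices S ≡ length cs
    #vertices-cycles {cs} ps p = trans (↭-length (filter-↭ (leastCorner? S) (↭-sym p)))
      (#least-cycles cs ps (ℕ.≤-reflexive (trans (↭-length p) (length-tabulate {n = N} id)))
         (↭ₛ.Unique-resp-↭ (setoid _) (↭⇒↭ₛ (↭-sym p)) (Unique.allFin⁺ N)))

  data Adjacent {A : Set} (x y : A) : List A → Set where
    here  : ∀ {zs} → Adjacent x y (x ∷ y ∷ zs)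
    there : ∀ {z zs} → Adjacent x y zs → Adjacent x y (z ∷ zs)

  module _ {A : Set} where

    adjacent-split : ∀ {x y : A} {l} → Adjacent x y l → ∃₂ λ xs ys → l ≡ xs ++ x ∷ y ∷ ys
    adjacent-split here      = [] , _ , refl
    adjacent-split (there p) with adjacent-split p
    ... | xs , ys , refl = _ ∷ xs , ys , refl

    -- A cyclic word is represented by repeating its first side at the end; the second alternative
    -- is the step from the last side back to the first.
    adjacent-∷ʳ : ∀ {x y z : A} l → Adjacent x y (l ++ [ z ]) → Adjacent x y l ⊎ (∃[ xs ] l ≡ xs ++ [ x ]) × y ≡ z
    adjacent-∷ʳ []           (there ())
    adjacent-∷ʳ (x ∷ [])     here      = inj₂ (([] , refl) , refl)
    adjacent-∷ʳ (x ∷ _ ∷ _)  here      = inj₁ here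
    adjacent-∷ʳ (w ∷ l)      (there p) with adjacent-∷ʳ l p
    ... | inj₁ q                = inj₁ (there q)
    ... | inj₂ ((xs , refl) , e) = inj₂ ((w ∷ xs , refl) , e)

    index-∈-lookup : ∀ (l : List A) i → index (∈-lookup {xs = l} i) ≡ i
    index-∈-lookup (x ∷ l) zero    = refl
    index-∈-lookup (x ∷ l) (suc i) = cong suc (index-∈-lookup l i)

    toℕ-index-++ : ∀ xs {y : A} {ys} → toℕ (index (∈-++⁺ʳ xs {ys = y ∷ ys} (here refl))) ≡ length xs
    toℕ-index-++ []       = refl
    toℕ-index-++ (x ∷ xs) = cong suc (toℕ-index-++ xs)

  toℕ-next : ∀ {N} (i : Fin N) → suc (toℕ i) < N → toℕ (next i) ≡ suc (toℕ i)
  toℕ-next {suc N} i i< = trans (Fin.toℕ-fromℕ< _) (m<n⇒m%n≡m i<)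

  toℕ-next-last : ∀ {N} (i : Fin N) → suc (toℕ i) ≡ N → toℕ (next i) ≡ 0
  toℕ-next-last {suc N} i e = trans (Fin.toℕ-fromℕ< _) (trans (cong (_% suc N) e) (n%n≡0 (suc N)))

  module _ {A : Set} {l : List A} (u : Unique l) where

    -- `mate` takes the index of one particular membership proof. In a list without repetitions all
    -- such proofs are equal, so any decomposition of the list gives the position.
    toℕ-index : ∀ {x} xs {ys} → l ≡ xs ++ x ∷ ys → (p : x ∈ l) → toℕ (index p) ≡ length xs
    toℕ-index xs refl p = trans (cong (toℕ ∘ index) (unique⇒irrelevant u p (∈-++⁺ʳ xs (here refl)))) (toℕ-index-++ xs)

    next-index : ∀ {x y} → Adjacent x y l → (p : x ∈ l) (q : y ∈ l) → next (index p) ≡ index q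
    next-index {x} {y} adj p q with adjacent-split adj
    ... | xs , ys , e = Fin.toℕ-injective (begin
      toℕ (next (index p))  ≡⟨ toℕ-next (index p) (subst (_< length l)
          (trans eq (cong suc (sym (toℕ-index xs e p)))) (Fin.toℕ<n (index q))) ⟩
      suc (toℕ (index p))   ≡⟨ cong suc (toℕ-index xs e p) ⟩
      suc (length xs)       ≡⟨ eq ⟨
      toℕ (index q)         ∎)
      where
      open ≡-Reasoning
      eq : toℕ (index q) ≡ suc (length xs)
      eq = trans (toℕ-index (xs ++ [ x ]) (trans e (sym (++-assoc xs [ x ] (y ∷ ys)))) q)
                 (trans (length-++ xs) (ℕ.+-comm (length xs) 1))

    next-index-last : ∀ {x h t} xs → l ≡ xs ++ [ x ] → l ≡ h ∷ t → (p : x ∈ l) (q : h ∈ l) → next (index p) ≡ index q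
    next-index-last xs e e′ p q = Fin.toℕ-injective (trans
      (toℕ-next-last (index p) (trans (cong suc (toℕ-index xs e p))
        (sym (trans (cong length e) (trans (length-++ xs) (ℕ.+-comm (length xs) 1))))))
      (sym (toℕ-index [] e′ q)))

  module _ {A : Set} (h : Side A) (t : List (Side A)) (u : Unique (h ∷ t)) (total : ∀ s → s ∈ h ∷ t) where

    -- Every side occurs, so corners can be named by the sides that start there. The record has the
    -- form of `ladder K T`, which is an instance by definition.
    totalSurface : Surface A
    totalSurface = record { word = h ∷ t ; unique = u ; closed = λ {s} _ → total (inv s) }

    -- The corner at which side s starts is followed, around its vertex, by
    -- the corner at which the side after inv s starts.
    Rotates : Side A → Side A → Set
    Rotates s s′ = Adjacent (inv s) s′ (h ∷ t ++ [ h ])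

    private
      corner : Side A → Corner totalSurface
      corner s = index (total s)

      corner-lookup : ∀ i → corner (lookup (h ∷ t) i) ≡ i
      corner-lookup i = trans (cong index (unique⇒irrelevant u (total _) (∈-lookup i))) (index-∈-lookup (h ∷ t) i)

      next-corner : ∀ {s s′} → Adjacent s s′ (h ∷ t ++ [ h ]) → next (corner s) ≡ corner s′
      next-corner adj with adjacent-∷ʳ (h ∷ t) adj
      ... | inj₁ p                = next-index u p (total _) (total _)
      ... | inj₂ ((xs , e) , refl) = next-index-last u xs e refl (total _) (total _)

      rotate-corner : ∀ {s s′} → Rotates s s′ → rotate totalSurface (corner s) ≡ corner s′
      rotate-corner {s} adj = trans (cong (λ r → next (corner (inv r))) (sym (lookup-index (total s))))
          (next-corner adj)

      corner-cycle : ∀ {c} → IsCycle Rotates c → IsCycle (Graph (rotate totalSurface)) (map corner c)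
      corner-cycle (cycle c) = cycle (chain-map corner rotate-corner c)

    #vertices-sideCycles : ∀ {cs} → All (IsCycle Rotates) cs → concat cs ↭ h ∷ t → #vertices totalSurface ≡ length cs
    #vertices-sideCycles {cs} ps p = trans
      (#vertices-cycles totalSurface (All.map⁺ (All.map corner-cycle ps))
        (subst₂ _↭_ (sym (concat-map cs)) corners (↭-map⁺ corner p)))
      (length-map (map corner) cs)
      where
      corners : map corner (h ∷ t) ≡ allFin (length (h ∷ t))
      corners = trans (cong (map corner) (sym (tabulate-lookup (h ∷ t))))
                      (trans (map-tabulate (lookup (h ∷ t)) corner) (tabulate-cong corner-lookup))

-- Ladder words with slots, and the insertion of a rung

module LadderTokens where

  open CornerCycles
  open import Data.Fin.Subset.Properties using (_∈?_)
  open import Data.List.Properties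
  open import Data.Nat.Base using (ℕ; zero; suc)

  -- Slots 0F, 1F, 2F, 3F are the places R₁|R₃, R₃|a⁻, a⁻|R₂, R₂|R₄.
  Slot : Set
  Slot = Fin 4

  Strands : Set
  Strands = Vec Slot 4

  slots : List Slot
  slots = allFin 4

  -- The strand arriving at t is continued by the one leaving s, and one of the
  -- new sides becomes the strand from s to t.
  connect : Slot → Slot → Strands → Strands
  connect s t π = Vec.map (λ r → if does (r Fin.≟ t) then Vec.lookup π s else r) π [ s ]≔ t

  exchange : Slot → Slot
  exchange 0F = 1F
  exchange 1F = 0F
  exchange r  = r

  -- `b` puts one new side before slot `0F` or after slot `2F`, and `c` puts the other before slot
  -- `1F` or after slot `3F`. Two sides before their slots exchange the arrivals there, two sides
  -- after their slots exchange the departures, and a mixed pair joins an arrival to a departure.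
  step : Bool → Bool → Strands → Strands
  step true  true  π = Vec.map exchange π
  step true  false π = connect 3F 0F π
  step false true  π = connect 2F 1F π
  step false false (t₀ ∷ t₁ ∷ t₂ ∷ t₃ ∷ []) = t₀ ∷ t₁ ∷ t₃ ∷ t₂ ∷ []

  -- In the mixed cases a strand that already runs from the departing slot to the arriving one is
  -- joined to itself.
  newLoops : Bool → Bool → Strands → ℕ
  newLoops true  false π = if does (Vec.lookup π 3F Fin.≟ 0F) then 1 else 0
  newLoops false true  π = if does (Vec.lookup π 2F Fin.≟ 1F) then 1 else 0
  newLoops _     _     _ = 0

  data Token (A : Set) : Set where
    side : Side A → Token A
    slot : Slot → Token A

  -- Going around a vertex, one jumps from a side to its mate but passes straight through a slot,
  -- which is therefore its own flip.
  flip : ∀ {A} → Token A → Token A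
  flip (side s) = side (inv s)
  flip (slot r) = slot r

  Turn : ∀ {A} → List (Token A) → Token A → Token A → Set
  Turn W t t′ = Adjacent (flip t) t′ W

  -- The final `a ⁺` repeats the first side, so that adjacency in the list covers the cyclic word.
  tokens : ∀ {n} → Subset n → Subset n → List (Token (Letter n))
  tokens K T = side (a ⁺) ∷ map side (R₁ K) ++ slot 0F ∷ map side (R₃ T) ++ slot 1F ∷ side (a ⁻) ∷
               slot 2F ∷ map side (R₂ K) ++ slot 3F ∷ map side (R₄ T) ++ [ side (a ⁺) ]

  mapSide : ∀ {A B} → (A → B) → Side A → Side B
  mapSide f (x ⁺) = f x ⁺
  mapSide f (x ⁻) = f x ⁻

  mapSide-inv : ∀ {A B} (f : A → B) s → mapSide f (inv s) ≡ inv (mapSide f s)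
  mapSide-inv f (x ⁺) = refl
  mapSide-inv f (x ⁻) = refl

  lift : ∀ {n} → Letter n → Letter (suc n)
  lift a        = a
  lift (rung k) = rung (suc k)

  liftSide : ∀ {n} → Side (Letter n) → Side (Letter (suc n))
  liftSide = mapSide lift

  x⁺ x⁻ : ∀ {n} → Side (Letter (suc n))
  x⁺ = rung zero ⁺
  x⁻ = rung zero ⁻

  -- Prepending b to K and c to T inserts the two sides of rung 0 at slots.
  insert : ∀ {n} → Bool → Bool → Token (Letter n) → List (Token (Letter (suc n)))
  insert b c (side s)  = [ side (liftSide s) ]
  insert b c (slot 0F) = if b then side x⁺ ∷ slot 0F ∷ [] else [ slot 0F ]
  insert b c (slot 1F) = if c then side x⁻ ∷ slot 1F ∷ [] else [ slot 1F ]
  insert b c (slot 2F) = if b then [ slot 2F ] else slot 2F ∷ side x⁺ ∷ []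
  insert b c (slot 3F) = if c then [ slot 3F ] else slot 3F ∷ side x⁻ ∷ []

  filter-suc : ∀ {n} b (K : Subset n) ks → filter (_∈? (b ∷ K)) (map suc ks) ≡ map suc (filter (_∈? K) ks)
  filter-suc b K []       = refl
  filter-suc b K (k ∷ ks) with does (k ∈? K)
  ... | true  = cong (suc k ∷_) (filter-suc b K ks)
  ... | false = filter-suc b K ks

  increasing-∷ : ∀ {n} b (K : Subset n) →
    increasing (b ∷ K) ≡ (if b then [ zero ] else []) ++ map suc (increasing K)
  increasing-∷ {n} b K = trans (cong (λ ks → filter (_∈? (b ∷ K)) (zero ∷ ks)) (sym (map-tabulate id suc))) (head b)
    where
    head : ∀ b → filter (_∈? (b ∷ K)) (zero ∷ map suc (allFin n)) ≡
                 (if b then [ zero ] else []) ++ map suc (increasing K)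
    head true  = cong (zero ∷_) (filter-suc true K (allFin n))
    head false = filter-suc false K (allFin n)

  module _ {n : ℕ} (f : ∀ {m} → Fin m → Side (Letter m)) (f-suc : ∀ {m} (k : Fin m) → liftSide (f k) ≡ f (suc k)) where

    map-increasing-∷ : ∀ b (K : Subset n) →
      map f (increasing (b ∷ K)) ≡ (if b then [ f zero ] else []) ++ map liftSide (map f (increasing K))
    map-increasing-∷ b K = trans (cong (map f) (increasing-∷ b K)) (head b)
      where
      tail : map f (map suc (increasing K)) ≡ map liftSide (map f (increasing K))
      tail = trans (sym (map-∘ (increasing K))) (trans (map-cong (sym ∘ f-suc) (increasing K)) (map-∘ (increasing K)))
      head : ∀ b → map f ((if b then [ zero ] else []) ++ map suc (increasing K)) ≡
                   (if b then [ f zero ] else []) ++ map liftSide (map f (increasing K))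
      head true  = cong (f zero ∷_) tail
      head false = tail

    map-decreasing-∷ : ∀ b (K : Subset n) →
      map f (decreasing (b ∷ K)) ≡ map liftSide (map f (decreasing K)) ++ (if b then [ f zero ] else [])
    map-decreasing-∷ b K = begin
      map f (reverse (increasing (b ∷ K)))  ≡⟨ reverse-map f (increasing (b ∷ K)) ⟩
      reverse (map f (increasing (b ∷ K)))  ≡⟨ cong reverse (map-increasing-∷ b K) ⟩
      reverse (new b ++ old)                ≡⟨ reverse-++ (new b) old ⟩
      reverse old ++ reverse (new b)        ≡⟨ cong₂ _++_ old-reverse (new-reverse b) ⟩
      map liftSide (map f (decreasing K)) ++ new b ∎
      where
      open ≡-Reasoning
      new : Bool → List (Side (Letter (suc n)))
      new b = if b then [ f zero ] else []
      old : List (Side (Letter (suc n)))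
      old = map liftSide (map f (increasing K))
      old-reverse : reverse old ≡ map liftSide (map f (decreasing K))
      old-reverse = trans (sym (reverse-map liftSide (map f (increasing K))))
                          (cong (map liftSide) (sym (reverse-map f (increasing K))))
      new-reverse : ∀ b → reverse (new b) ≡ new b
      new-reverse true  = refl
      new-reverse false = refl

  module _ {n : ℕ} (K T : Subset n) where

    private
      Tokens′ : Set
      Tokens′ = List (Token (Letter (suc n)))

      old : List (Side (Letter n)) → Tokens′
      old ss = map side (map liftSide ss)

      append : ∀ {xs ys} (z : List (Side (Letter (suc n)))) {l : Tokens′} → xs ≡ map liftSide ys ++ z →
               map side xs ++ l ≡ old ys ++ map side z ++ l
      append {ys = ys} z {l} refl = trans (cong (_++ l) (map-++ side (map liftSide ys) z))
          (++-assoc (old ys) (map side z) l)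

    slot-0F : ∀ b c (l : Tokens′) → map side (R₁ (b ∷ K)) ++ slot 0F ∷ l ≡ old (R₁ K) ++ insert b c (slot 0F) ++ l
    slot-0F b c l with b | map-decreasing-∷ rung⁺ (λ _ → refl) b K
    ... | true  | e = append [ x⁺ ] e
    ... | false | e = append [] e

    slot-1F : ∀ b c (l : Tokens′) → map side (R₃ (c ∷ T)) ++ slot 1F ∷ l ≡ old (R₃ T) ++ insert b c (slot 1F) ++ l
    slot-1F b c l with c | map-decreasing-∷ rung⁻ (λ _ → refl) c T
    ... | true  | e = append [ x⁻ ] e
    ... | false | e = append [] e

    slot-2F : ∀ b c (l : Tokens′) → slot 2F ∷ map side (R₂ (b ∷ K)) ++ l ≡ insert b c (slot 2F) ++ old (R₂ K) ++ l
    slot-2F b c l with b | map-increasing-∷ rung⁺ (λ _ → refl) (not b) (∁ K)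
    ... | true  | e = cong (λ r → slot 2F ∷ map side r ++ l) e
    ... | false | e = cong (λ r → slot 2F ∷ map side r ++ l) e

    slot-3F : ∀ b c (l : Tokens′) → slot 3F ∷ map side (R₄ (c ∷ T)) ++ l ≡ insert b c (slot 3F) ++ old (R₄ T) ++ l
    slot-3F b c l with c | map-increasing-∷ rung⁻ (λ _ → refl) (not c) (∁ T)
    ... | true  | e = cong (λ r → slot 3F ∷ map side r ++ l) e
    ... | false | e = cong (λ r → slot 3F ∷ map side r ++ l) e

    insert-sides : ∀ b c ss l → concatMap (insert b c) (map side ss ++ l) ≡ old ss ++ concatMap (insert b c) l
    insert-sides b c []       l = refl
    insert-sides b c (s ∷ ss) l = cong (side (liftSide s) ∷_) (insert-sides b c ss l)

    -- The new rung has the smallest index. In the decreasing products `R₁` and `R₃` it comes last,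
    -- just before slots `0F` and `1F`; in the increasing `R₂` and `R₄` it comes first, just after
    -- slots `2F` and `3F`. So the places do not depend on `K` and `T`.
    tokens-∷ : ∀ b c → tokens (b ∷ K) (c ∷ T) ≡ concatMap (insert b c) (tokens K T)
    tokens-∷ b c = cong (side (a ⁺) ∷_) (trans (slot-0F b c _) (trans
      (cong (λ l → old (R₁ K) ++ insert b c (slot 0F) ++ l) (trans (slot-1F b c _)
        (trans (cong (λ l → old (R₃ T) ++ insert b c (slot 1F) ++ side (a ⁻) ∷ l) (trans (slot-2F b c _)
          (trans (cong (λ l → insert b c (slot 2F) ++ old (R₂ K) ++ l) (trans (slot-3F b c _)
            (cong (insert b c (slot 3F) ++_) (sym (insert-sides b c (R₄ T) _)))))
          (cong (insert b c (slot 2F) ++_) (sym (insert-sides b c (R₂ K) _))))))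
        (sym (insert-sides b c (R₃ T) _)))))
      (sym (insert-sides b c (R₁ K) _))))

-- Strands and loops, and how an insertion changes them

module Tangles where

  open CornerCycles
  open LadderTokens
  open import Data.List.Properties
  open import Data.List.Membership.Propositional.Properties
  open import Data.Nat.Base using (ℕ; zero; suc)

  module _ {A : Set} where

    adjacent-++ʳ : ∀ xs {x y : A} {l} → Adjacent x y l → Adjacent x y (xs ++ l)
    adjacent-++ʳ []       p = p
    adjacent-++ʳ (_ ∷ xs) p = there (adjacent-++ʳ xs p)

  module _ {A B : Set} (f : A → List B) where

    adjacent-concatMap : ∀ {x y l zs z w ws} → f x ≡ zs ++ [ z ] → f y ≡ w ∷ ws →
                         Adjacent x y l → Adjacent z w (concatMap f l)
    adjacent-concatMap {zs = zs} {z} {w} {ws} ex ey (here {zs = l}) rewrite ex | ey | ++-assoc zs [ z ]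
        (w ∷ ws ++ concatMap f l) =
      adjacent-++ʳ zs here
    adjacent-concatMap ex ey (there {z = u} p) = adjacent-++ʳ (f u) (adjacent-concatMap ex ey p)

    adjacent-within : ∀ {x l z w} → f x ≡ z ∷ w ∷ [] → x ∈ l → Adjacent z w (concatMap f l)
    adjacent-within e (here refl) rewrite e = here
    adjacent-within e (there {x = u} p) = adjacent-++ʳ (f u) (adjacent-within e p)

  module _ {n : ℕ} (b c : Bool) where

    -- The tokens replacing `t` begin with `entry b c t` and end with `leave b c t`. A turn starts
    -- behind the flip of a token, so `exit b c t` is the token whose flip is `leave b c (flip t)`.
    entry exit leave : Token (Letter n) → Token (Letter (suc n))
    entry (side s)  = side (liftSide s)
    entry (slot 0F) = if b then side x⁺ else slot 0F
    entry (slot 1F) = if c then side x⁻ else slot 1F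
    entry (slot r)  = slot r
    leave (side s)  = side (liftSide s)
    leave (slot 2F) = if b then slot 2F else side x⁺
    leave (slot 3F) = if c then slot 3F else side x⁻
    leave (slot r)  = slot r
    exit (side s)  = side (liftSide s)
    exit (slot 2F) = if b then slot 2F else side x⁻
    exit (slot 3F) = if c then slot 3F else side x⁺
    exit (slot r)  = slot r

  insert-entry : ∀ {n} b c (t : Token (Letter n)) → ∃[ ts ] insert b c t ≡ entry b c t ∷ ts
  insert-entry b     c     (side s)  = _ , refl
  insert-entry true  c     (slot 0F) = _ , refl
  insert-entry false c     (slot 0F) = _ , refl
  insert-entry b     true  (slot 1F) = _ , refl
  insert-entry b     false (slot 1F) = _ , refl
  insert-entry true  c     (slot 2F) = _ , refl
  insert-entry false c     (slot 2F) = _ , refl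
  insert-entry b     true  (slot 3F) = _ , refl
  insert-entry b     false (slot 3F) = _ , refl

  insert-leave : ∀ {n} b c (t : Token (Letter n)) → ∃[ ts ] insert b c t ≡ ts ++ [ leave b c t ]
  insert-leave b     c     (side s)  = [] , refl
  insert-leave true  c     (slot 0F) = [ _ ] , refl
  insert-leave false c     (slot 0F) = [] , refl
  insert-leave b     true  (slot 1F) = [ _ ] , refl
  insert-leave b     false (slot 1F) = [] , refl
  insert-leave true  c     (slot 2F) = [] , refl
  insert-leave false c     (slot 2F) = [ _ ] , refl
  insert-leave b     true  (slot 3F) = [] , refl
  insert-leave b     false (slot 3F) = [ _ ] , refl

  leave-flip : ∀ {n} b c (t : Token (Letter n)) → leave b c (flip t) ≡ flip (exit b c t)
  leave-flip b     c     (side s)  = cong side (mapSide-inv lift s)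
  leave-flip b     c     (slot 0F) = refl
  leave-flip b     c     (slot 1F) = refl
  leave-flip true  c     (slot 2F) = refl
  leave-flip false c     (slot 2F) = refl
  leave-flip b     true  (slot 3F) = refl
  leave-flip b     false (slot 3F) = refl

  slot∈tokens : ∀ {n} (K T : Subset n) r → slot r ∈ tokens K T
  slot∈tokens K T 0F = there (∈-++⁺ʳ (map side (R₁ K)) (here refl))
  slot∈tokens K T 1F = there (∈-++⁺ʳ (map side (R₁ K)) (there (∈-++⁺ʳ (map side (R₃ T)) (here refl))))
  slot∈tokens K T 2F = there (∈-++⁺ʳ (map side (R₁ K)) (there (∈-++⁺ʳ (map side (R₃ T)) (there (there (here refl))))))
  slot∈tokens K T 3F = there (∈-++⁺ʳ (map side (R₁ K)) (there (∈-++⁺ʳ (map side (R₃ T))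
                         (there (there (there (∈-++⁺ʳ (map side (R₂ K)) (here refl))))))))

  module _ {n : ℕ} (K T : Subset n) (b c : Bool) where

    turn-insert : ∀ {t t′} → Turn (tokens K T) t t′ → Turn (tokens (b ∷ K) (c ∷ T)) (exit b c t) (entry b c t′)
    turn-insert {t} {t′} p = subst₂ (λ u l → Adjacent u (entry b c t′) l) (leave-flip b c t) (sym (tokens-∷ K T b c))
      (adjacent-concatMap (insert b c) (proj₂ (insert-leave b c (flip t))) (proj₂ (insert-entry b c t′)) p)

    run-insert : ∀ {t t′} ss → Chain (Turn (tokens K T)) t (map side ss) t′ →
      Chain (Turn (tokens (b ∷ K) (c ∷ T))) (exit b c t) (map side (map liftSide ss)) (entry b c t′)
    run-insert []       (end r) = end (turn-insert r)
    run-insert (s ∷ ss) (r ∷ k) = turn-insert r ∷ run-insert ss k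

    turn-new : ∀ {u v r} → insert b c (slot r) ≡ u ∷ v ∷ [] → Adjacent u v (tokens (b ∷ K) (c ∷ T))
    turn-new {u} {v} {r} e = subst (Adjacent u v) (sym (tokens-∷ K T b c))
        (adjacent-within (insert b c) e (slot∈tokens K T r))

  -- `onto` is a permutation of lists so that concatenations indexed by arrivals can be reordered by
  -- slots.
  record IsPermutation (π : Strands) : Set where
    field
      injective : ∀ r r′ → Vec.lookup π r ≡ Vec.lookup π r′ → r ≡ r′
      onto      : map (Vec.lookup π) slots ↭ slots

  module _ {A B : Set} where

    concatMap-↭ : ∀ (f : A → List B) {xs ys} → xs ↭ ys → concatMap f xs ↭ concatMap f ys
    concatMap-↭ f ↭.refl          = ↭-refl
    concatMap-↭ f (↭.prep x p)    = ↭.++⁺ˡ (f x) (concatMap-↭ f p)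
    concatMap-↭ f (↭.swap x y p)  = ↭-trans (↭.shifts (f x) (f y)) (↭.++⁺ˡ (f y) (↭.++⁺ˡ (f x) (concatMap-↭ f p)))
    concatMap-↭ f (↭.trans p q)   = ↭-trans (concatMap-↭ f p) (concatMap-↭ f q)

    concatMap-++-↭ : ∀ (f g : A → List B) xs → concatMap (λ x → f x ++ g x) xs ↭ concatMap f xs ++ concatMap g xs
    concatMap-++-↭ f g []       = ↭-refl
    concatMap-++-↭ f g (x ∷ xs) = begin
      (f x ++ g x) ++ concatMap (λ x → f x ++ g x) xs  ↭⟨ ↭.++⁺ˡ (f x ++ g x) (concatMap-++-↭ f g xs) ⟩
      (f x ++ g x) ++ F ++ G                            ≡⟨ ++-assoc (f x) (g x) (F ++ G) ⟩
      f x ++ g x ++ F ++ G                              ↭⟨ ↭.++⁺ˡ (f x) (↭.shifts (g x) F) ⟩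
      f x ++ F ++ g x ++ G                              ≡⟨ ++-assoc (f x) F (g x ++ G) ⟨
      (f x ++ F) ++ g x ++ G                            ∎
      where
      open PermutationReasoning
      F = concatMap f xs
      G = concatMap g xs

  concatMap-indicator : ∀ {A : Set} t (v : List A) → concatMap (λ r → if does (r Fin.≟ t) then v else []) slots ≡ v
  concatMap-indicator 0F v = ++-identityʳ v
  concatMap-indicator 1F v = ++-identityʳ v
  concatMap-indicator 2F v = ++-identityʳ v
  concatMap-indicator 3F v = ++-identityʳ v

  sides : ∀ n → List (Side (Letter n))
  sides zero    = a ⁺ ∷ a ⁻ ∷ []
  sides (suc n) = x⁺ ∷ x⁻ ∷ map liftSide (sides n)

  module _ {A : Set} (W : List (Token A)) where

    -- The sides met when going around vertices between the slots, starting
    -- at slot r and arriving at slot lookup π r, together with the vertices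
    -- that avoid all slots.
    record Tangle (π : Strands) (c : ℕ) (total : List (Side A)) : Set where
      field
        strand : Slot → List (Side A)
        run    : ∀ r → Chain (Turn W) (slot r) (map side (strand r)) (slot (Vec.lookup π r))
        loops  : List (List (Side A))
        closed : All (λ l → IsCycle (Turn W) (map side l)) loops
        #loops : length loops ≡ c
        all    : concatMap strand slots ++ concat loops ↭ total

    run-++ : ∀ {t t′} ss {s ss′} → Chain (Turn W) t (map side ss) (side s) → Chain (Turn W) (side s) (map side ss′) t′ →
             Chain (Turn W) t (map side (ss ++ s ∷ ss′)) t′
    run-++ ss {s} {ss′} p q = subst (λ l → Chain (Turn W) _ l _) (sym (map-++ side ss (s ∷ ss′))) (chain-++ p q)

    module _ (π : Strands) (perm : IsPermutation π)
             (strand : Slot → List (Side A)) (loops : List (List (Side A)))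
             (closed : All (λ l → IsCycle (Turn W) (map side l)) loops)
             (total : List (Side A)) (all : concatMap strand slots ++ concat loops ↭ total) where
      open IsPermutation perm

      private
        old : List (Side A)
        old = concatMap strand slots

      -- What arrived at slot `0F` now meets `y` and goes on to slot `1F`, and what arrived at slot
      -- `1F` goes through `z` to slot `0F`. Each slot is arrived at once, so each new side is used
      -- once.
      exchange-tangle : ∀ {y z} (entry : Slot → Token A) →
        entry 0F ≡ side y → entry 1F ≡ side z → entry 2F ≡ slot 2F → entry 3F ≡ slot 3F →
        (∀ r → Chain (Turn W) (slot r) (map side (strand r)) (entry (Vec.lookup π r))) →
        Turn W (side y) (slot 1F) → Turn W (side z) (slot 0F) →
        Tangle (Vec.map exchange π) (length loops) (y ∷ z ∷ total)
      exchange-tangle {y} {z} entry e₀ e₁ e₂ e₃ run y→1 z→0 = record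
        { strand = λ r → strand r ++ suffix (Vec.lookup π r)
        ; run    = λ r → subst (λ t → Chain (Turn W) (slot r) (map side (strand r ++ suffix (Vec.lookup π r))) (slot t))
                               (sym (Vec.lookup-map r exchange π)) (extend (Vec.lookup π r) (run r))
        ; loops  = loops
        ; closed = closed
        ; #loops = refl
        ; all    = begin
            concatMap (λ r → strand r ++ suffix (Vec.lookup π r)) slots ++ concat loops
              ↭⟨ ↭.++⁺ʳ (concat loops) (concatMap-++-↭ strand (suffix ∘ Vec.lookup π) slots) ⟩
            (old ++ concatMap (suffix ∘ Vec.lookup π) slots) ++ concat loops
              ↭⟨ ↭.++⁺ʳ (concat loops) (↭.++⁺ˡ old (concatMap-↭ suffix onto)) ⟩
            (old ++ y ∷ z ∷ []) ++ concat loops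
              ↭⟨ ↭.++⁺ʳ (concat loops) (↭.++-comm old (y ∷ z ∷ [])) ⟩
            y ∷ z ∷ old ++ concat loops
              ↭⟨ ↭-prep y (↭-prep z all) ⟩
            y ∷ z ∷ total ∎
        }
        where
        open PermutationReasoning
        suffix : Slot → List (Side A)
        suffix 0F = [ y ]
        suffix 1F = [ z ]
        suffix _  = []
        extend : ∀ t {u ss} → Chain (Turn W) u (map side ss) (entry t) →
                 Chain (Turn W) u (map side (ss ++ suffix t)) (slot (exchange t))
        extend 0F {ss = ss} k = run-++ ss (subst (Chain (Turn W) _ _) e₀ k) (end y→1)
        extend 1F {ss = ss} k = run-++ ss (subst (Chain (Turn W) _ _) e₁ k) (end z→0)
        extend 2F {ss = ss} k = subst₂ (Chain (Turn W) _) (cong (map side) (sym (++-identityʳ ss))) e₂ k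
        extend 3F {ss = ss} k = subst₂ (Chain (Turn W) _) (cong (map side) (sym (++-identityʳ ss))) e₃ k

      -- From slots `2F` and `3F` one now meets a new side first, and its mate leads into the old
      -- strand of the other slot.
      swap-tangle : ∀ {y z} (exit : Slot → Token A) →
        exit 0F ≡ slot 0F → exit 1F ≡ slot 1F → exit 2F ≡ side y → exit 3F ≡ side z →
        (∀ r → Chain (Turn W) (exit r) (map side (strand r)) (slot (Vec.lookup π r))) →
        Turn W (slot 2F) (side z) → Turn W (slot 3F) (side y) →
        Tangle (step false false π) (length loops) (z ∷ y ∷ total)
      swap-tangle {y} {z} exit e₀ e₁ e₂ e₃ run 2→z 3→y = record
        { strand = strand′
        ; run    = run′ π run
        ; loops  = loops
        ; closed = closed
        ; #loops = refl
        ; all    = begin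
            concatMap strand′ slots ++ concat loops
              ↭⟨ ↭.++⁺ʳ (concat loops) (concatMap-++-↭ prefix (strand ∘ swap) slots) ⟩
            z ∷ y ∷ concatMap strand (0F ∷ 1F ∷ 3F ∷ 2F ∷ []) ++ concat loops
              ↭⟨ ↭-prep z (↭-prep y (↭.++⁺ʳ (concat loops)
                   (concatMap-↭ strand (↭-prep 0F (↭-prep 1F (↭-swap 3F 2F (↭-refl {x = []}))))))) ⟩
            z ∷ y ∷ old ++ concat loops
              ↭⟨ ↭-prep z (↭-prep y all) ⟩
            z ∷ y ∷ total ∎
        }
        where
        open PermutationReasoning
        prefix : Slot → List (Side A)
        prefix 2F = [ z ]
        prefix 3F = [ y ]
        prefix _  = []
        swap : Slot → Slot
        swap 2F = 3F
        swap 3F = 2F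
        swap r  = r
        strand′ : Slot → List (Side A)
        strand′ r = prefix r ++ strand (swap r)
        run′ : ∀ π → (∀ r → Chain (Turn W) (exit r) (map side (strand r)) (slot (Vec.lookup π r))) →
               ∀ r → Chain (Turn W) (slot r) (map side (strand′ r)) (slot (Vec.lookup (step false false π) r))
        run′ (t₀ ∷ t₁ ∷ t₂ ∷ t₃ ∷ []) run 0F = subst (λ u → Chain (Turn W) u _ _) e₀ (run 0F)
        run′ (t₀ ∷ t₁ ∷ t₂ ∷ t₃ ∷ []) run 1F = subst (λ u → Chain (Turn W) u _ _) e₁ (run 1F)
        run′ (t₀ ∷ t₁ ∷ t₂ ∷ t₃ ∷ []) run 2F = 2→z ∷ subst (λ u → Chain (Turn W) u _ _) e₃ (run 3F)
        run′ (t₀ ∷ t₁ ∷ t₂ ∷ t₃ ∷ []) run 3F = 3→y ∷ subst (λ u → Chain (Turn W) u _ _) e₂ (run 2F)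

      module _ {s t : Slot} {y z : Side A} {others : List Slot} (s∷others : s ∷ others ↭ slots) (s∉others : All (_≢ s) others)
               (exit entry : Slot → Token A)
               (exit-s : exit s ≡ side y) (exit-r : ∀ {r} → r ≢ s → exit r ≡ slot r)
               (entry-t : entry t ≡ side y) (entry-r : ∀ {r} → r ≢ t → entry r ≡ slot r)
               (run : ∀ r → Chain (Turn W) (exit r) (map side (strand r)) (entry (Vec.lookup π r)))
               (s→z : Turn W (slot s) (side z)) (z→t : Turn W (side z) (slot t)) where
        open PermutationReasoning

        private
          target : Slot → Slot
          target r = if does (r Fin.≟ t) then Vec.lookup π s else r

          lookup-s : Vec.lookup (connect s t π) s ≡ t
          lookup-s = Vec.lookup∘updateAt s (Vec.map target π)

          lookup-r : ∀ {r} → r ≢ s → Vec.lookup (connect s t π) r ≡ target (Vec.lookup π r)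
          lookup-r {r} r≢s = trans (Vec.lookup∘updateAt′ r s r≢s (Vec.map target π)) (Vec.lookup-map r target π)

          target-r : ∀ {r} → r ≢ t → target r ≡ r
          target-r {r} r≢t rewrite dec-false (r Fin.≟ t) r≢t = refl

          replace : (Slot → List (Side A)) → Slot → List (Side A)
          replace f r = if does (r Fin.≟ s) then [ z ] else f r

          replace-s : ∀ f → replace f s ≡ [ z ]
          replace-s f rewrite dec-true (s Fin.≟ s) refl = refl

          replace-r : ∀ f {r} → r ≢ s → replace f r ≡ f r
          replace-r f {r} r≢s rewrite dec-false (r Fin.≟ s) r≢s = refl

          run′ : ∀ f → (∀ r → r ≢ s → Chain (Turn W) (slot r) (map side (f r)) (slot (target (Vec.lookup π r)))) →
                 ∀ r → Chain (Turn W) (slot r) (map side (replace f r)) (slot (Vec.lookup (connect s t π) r))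
          run′ f run r with r Fin.≟ s
          ... | yes refl = s→z ∷ end (subst (λ t → Turn W (side z) (slot t)) (sym lookup-s) z→t)
          ... | no r≢s   = subst (λ t → Chain (Turn W) (slot r) (map side (f r)) (slot t)) (sym (lookup-r r≢s))
              (run r r≢s)

          concatMap-replace : ∀ f → concatMap (replace f) slots ↭ z ∷ concatMap f others
          concatMap-replace f = begin
            concatMap (replace f) slots                    ↭⟨ concatMap-↭ (replace f) s∷others ⟨
            replace f s ++ concatMap (replace f) others     ≡⟨ cong₂ _++_ (replace-s f) (cong concat
                                                                 (map-cong-local (All.map (λ {r} → replace-r f
                                                                     {r}) s∉others))) ⟩
            z ∷ concatMap f others                          ∎

          source : ∀ {r u} → r ≢ s → Chain (Turn W) (exit r) (map side (strand r)) u →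
                   Chain (Turn W) (slot r) (map side (strand r)) u
          source r≢s = subst (λ v → Chain (Turn W) v _ _) (exit-r r≢s)

        -- The old strand of `s` now starts and ends at the new side `y`, since `exit s` and
        -- `entry t` are both `y`; this closes a vertex without slots. By injectivity no other
        -- strand arrives at `t`.
        connect-loop : Vec.lookup π s ≡ t → Tangle (connect s t π) (suc (length loops)) (z ∷ y ∷ total)
        connect-loop πs≡t = record
          { strand = replace strand
          ; run    = run′ strand λ r r≢s → let πr≢t = λ e → r≢s (injective r s (trans e (sym πs≡t))) in
                       source r≢s (subst (Chain (Turn W) (exit r) (map side (strand r)))
                         (trans (entry-r πr≢t) (cong slot (sym (target-r πr≢t)))) (run r))
          ; loops  = (y ∷ strand s) ∷ loops
          ; closed = cycle (subst₂ (λ u v → Chain (Turn W) u (map side (strand s)) v) exit-s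
                       (trans (cong entry πs≡t) entry-t) (run s)) ∷ closed
          ; #loops = refl
          ; all    = begin
              concatMap (replace strand) slots ++ y ∷ strand s ++ concat loops
                ↭⟨ ↭.++⁺ʳ _ (concatMap-replace strand) ⟩
              z ∷ concatMap strand others ++ (y ∷ strand s) ++ concat loops
                ↭⟨ ↭-prep z (↭.shifts (concatMap strand others) (y ∷ strand s)) ⟩
              z ∷ y ∷ strand s ++ concatMap strand others ++ concat loops
                ≡⟨ cong (λ l → z ∷ y ∷ l) (++-assoc (strand s) (concatMap strand others) (concat loops)) ⟨
              z ∷ y ∷ concatMap strand (s ∷ others) ++ concat loops
                ↭⟨ ↭-prep z (↭-prep y (↭.++⁺ʳ (concat loops) (concatMap-↭ strand s∷others))) ⟩
              z ∷ y ∷ old ++ concat loops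
                ↭⟨ ↭-prep z (↭-prep y all) ⟩
              z ∷ y ∷ total ∎
          }

        -- The strand arriving at `t` is prolonged by `y` and by the old strand of `s`, while the
        -- strand of `s` becomes `z` alone.
        connect-join : Vec.lookup π s ≢ t → Tangle (connect s t π) (length loops) (z ∷ y ∷ total)
        connect-join πs≢t = record
          { strand = replace joined
          ; run    = run′ joined λ r r≢s → extend (Vec.lookup π r) (source r≢s (run r))
          ; loops  = loops
          ; closed = closed
          ; #loops = refl
          ; all    = begin
              concatMap (replace joined) slots ++ concat loops
                ↭⟨ ↭.++⁺ʳ _ (concatMap-replace joined) ⟩
              z ∷ concatMap joined others ++ concat loops
                ↭⟨ ↭-prep z (↭.++⁺ʳ _ (concatMap-++-↭ strand (suffix ∘ Vec.lookup π) others)) ⟩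
              z ∷ (concatMap strand others ++ concatMap (suffix ∘ Vec.lookup π) others) ++ concat loops
                ↭⟨ ↭-prep z (↭.++⁺ʳ _ (↭.++⁺ˡ (concatMap strand others) suffixes)) ⟩
              z ∷ (concatMap strand others ++ y ∷ strand s) ++ concat loops
                ↭⟨ ↭-prep z (↭.++⁺ʳ _ (↭.++-comm (concatMap strand others) (y ∷ strand s))) ⟩
              z ∷ y ∷ concatMap strand (s ∷ others) ++ concat loops
                ↭⟨ ↭-prep z (↭-prep y (↭.++⁺ʳ (concat loops) (concatMap-↭ strand s∷others))) ⟩
              z ∷ y ∷ old ++ concat loops
                ↭⟨ ↭-prep z (↭-prep y all) ⟩
              z ∷ y ∷ total ∎
          }
          where
          suffix : Slot → List (Side A)
          suffix r = if does (r Fin.≟ t) then y ∷ strand s else []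
          joined : Slot → List (Side A)
          joined r = strand r ++ suffix (Vec.lookup π r)
          extend : ∀ t′ {u ss} → Chain (Turn W) u (map side ss) (entry t′) →
                   Chain (Turn W) u (map side (ss ++ suffix t′)) (slot (target t′))
          extend t′ {ss = ss} k with t′ Fin.≟ t
          ... | yes refl = run-++ ss (subst (Chain (Turn W) _ _) entry-t k)
                             (subst₂ (λ u v → Chain (Turn W) u (map side (strand s)) v) exit-s (entry-r πs≢t) (run s))
          ... | no t′≢t  = subst₂ (Chain (Turn W) _) (cong (map side) (sym (++-identityʳ ss))) (entry-r t′≢t) k
          suffix-r : ∀ {r} → r ≢ t → suffix r ≡ []
          suffix-r {r} r≢t rewrite dec-false (r Fin.≟ t) r≢t = refl
          -- `π` takes the value `t` exactly once, and not at `s`, so one of the other strands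
          -- receives the suffix.
          suffixes : concatMap (suffix ∘ Vec.lookup π) others ↭ y ∷ strand s
          suffixes = begin
            concatMap (suffix ∘ Vec.lookup π) others        ≡⟨ cong (_++ concatMap (suffix ∘ Vec.lookup π) others)
                (suffix-r πs≢t) ⟨
            concatMap (suffix ∘ Vec.lookup π) (s ∷ others)  ↭⟨ concatMap-↭ (suffix ∘ Vec.lookup π) s∷others ⟩
            concatMap suffix (map (Vec.lookup π) slots)     ↭⟨ concatMap-↭ suffix onto ⟩
            concatMap suffix slots                          ≡⟨ concatMap-indicator t (y ∷ strand s) ⟩
            y ∷ strand s                                    ∎

-- The automaton on connection patterns and its Euler count

module LadderTangles where

  open CornerCycles
  open LadderTokens
  open Tangles
  import Data.Bool.Properties as Bool
  open import Data.List.Properties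
  open import Data.List.Membership.Propositional.Properties
  import Data.List.Membership.DecPropositional as DecMembership
  open import Data.Nat.Base using (ℕ; zero; suc; _+_; _*_; _∸_; ⌊_/2⌋)
  import Data.Nat.Properties as ℕ
  open import Data.Nat.Tactic.RingSolver using (solve-∀)
  open import Relation.Binary.Definitions using () renaming (Decidable to Decidable₂)
  open import Data.List.Sort.InsertionSort (Fin.≤-decTotalOrder 4) using (insertionSort)
  import Data.List.Sort.Base

  open Data.List.Sort.Base.SortingAlgorithm insertionSort using (sort; sort-↭)

  strandVectors : List Strands
  strandVectors = go 4
    where
    go : ∀ k → List (Vec Slot k)
    go zero    = [ [] ]
    go (suc k) = concatMap (λ r → map (r ∷_) (go k)) slots

  _≟ˢ_ : (rs rs′ : List Slot) → Dec (rs ≡ rs′)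
  _≟ˢ_ = ≡-dec Fin._≟_

  _≟ᵖ_ : (π π′ : Strands) → Dec (π ≡ π′)
  _≟ᵖ_ = Vec.≡-dec Fin._≟_

  open DecMembership _≟ᵖ_ using () renaming (_∈?_ to _∈ᵖ?_) public
  open DecMembership (Fin._≟_ {4}) using () renaming (_∈?_ to _∈ʳ?_) public

  -- An explicit list of 24 entries, so that facts about a single insertion are decided by
  -- evaluation on all of them.
  permutations : List Strands
  permutations = filter (λ π → sort (toList π) ≟ˢ slots) strandVectors

  ∀-Bool? : ∀ {P : Bool → Set} → Decidable P → Dec (∀ b → P b)
  ∀-Bool? P? = map′ (λ { (p , q) true → p ; (p , q) false → q }) (λ p → p true , p false) (P? true ×-dec P? false)

  isPermutation : ∀ {π} → π ∈ permutations → IsPermutation π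
  isPermutation {π} π∈ = record { injective = proj₁ facts ; onto = ↭-trans (↭-sym (sort-↭ _))
      (↭-reflexive (proj₂ facts)) }
    where
    facts : (∀ r r′ → Vec.lookup π r ≡ Vec.lookup π r′ → r ≡ r′) × sort (map (Vec.lookup π) slots) ≡ slots
    facts = All.lookup (from-yes (All.all? (λ π →
      (Fin.all? λ r → Fin.all? λ r′ → (Vec.lookup π r Fin.≟ Vec.lookup π r′) →-dec (r Fin.≟ r′))
      ×-dec (sort (map (Vec.lookup π) slots) ≟ˢ slots)) permutations)) π∈

  step∈permutations : ∀ {π} b c → π ∈ permutations → step b c π ∈ permutations
  step∈permutations b c π∈ = All.lookup (from-yes (All.all? (λ π →
    ∀-Bool? λ b → ∀-Bool? λ c → step b c π ∈ᵖ? permutations) permutations)) π∈ b c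

  -- The number is fuel; an orbit has at most four slots.
  trace : ℕ → Strands → Slot → Slot → List Slot
  trace zero    π r u = []
  trace (suc k) π r u = if does (u Fin.≟ r) then [] else u ∷ trace k π r (Vec.lookup π u)

  -- Starting with 1F and 3F, whose strands contain sides, keeps every orbit from
  -- starting at an empty strand.
  orbits : Strands → List (List Slot)
  orbits π = go [] (1F ∷ 3F ∷ 0F ∷ 2F ∷ [])
    where
    go : List (List Slot) → List Slot → List (List Slot)
    go os []       = os
    go os (r ∷ rs) = go (if does (r ∈ʳ? concat os) then os else (r ∷ trace 4 π r (Vec.lookup π r)) ∷ os) rs

  -- Only between slots 0F, 1F and 2F, 3F can there be no side.
  mayTouch : Slot → Slot → Bool
  mayTouch 0F 1F = true
  mayTouch 2F 3F = true
  mayTouch _  _  = false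

  data Orbit (π : Strands) : List Slot → Set where
    orbit : ∀ {r rs} → mayTouch r (Vec.lookup π r) ≡ false → Chain (Graph (Vec.lookup π)) r rs r → Orbit π (r ∷ rs)

  chain? : ∀ {A : Set} {R : A → A → Set} → Decidable₂ R → ∀ x ys z → Dec (Chain R x ys z)
  chain? R? x []       z = map′ end (λ { (end r) → r }) (R? x z)
  chain? R? x (y ∷ ys) z = map′ (λ { (r , c) → r ∷ c }) (λ { (r ∷ c) → r , c }) (R? x y ×-dec chain? R? y ys z)

  orbit? : ∀ π → Decidable (Orbit π)
  orbit? π []       = no λ ()
  orbit? π (r ∷ rs) = map′ (λ { (e , c) → orbit e c }) (λ { (orbit e c) → e , c })
    ((mayTouch r (Vec.lookup π r) Bool.≟ false) ×-dec chain? (λ r u → Vec.lookup π r Fin.≟ u) r rs r)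

  orbits-orbit : ∀ {π} → π ∈ permutations → All (Orbit π) (orbits π)
  orbits-orbit = All.lookup (from-yes (All.all? (λ π → All.all? (orbit? π) (orbits π)) permutations))

  concat-orbits : ∀ {π} → π ∈ permutations → concat (orbits π) ↭ slots
  concat-orbits π∈ = ↭-trans (↭-sym (sort-↭ _)) (↭-reflexive (All.lookup
    (from-yes (All.all? (λ π → sort (concat (orbits π)) ≟ˢ slots) permutations)) π∈))

  -- The change of genus caused by two new sides, by Euler characteristic.
  handles : Bool → Bool → Strands → ℕ
  handles b c π = ⌊ suc (length (orbits π)) ∸ newLoops b c π ∸ length (orbits (step b c π)) /2⌋

  -- A new edge allows one more vertex, and each handle costs two. The equation, checked on all
  -- permutations, also certifies `handles`: its subtractions are never truncated and its halving is
  -- exact.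
  euler-step : ∀ {π} b c → π ∈ permutations →
    newLoops b c π + length (orbits (step b c π)) + 2 * handles b c π ≡ suc (length (orbits π))
  euler-step b c π∈ = All.lookup (from-yes (All.all? (λ π → ∀-Bool? λ b → ∀-Bool? λ c →
    newLoops b c π + length (orbits (step b c π)) + 2 * handles b c π ℕ.≟ suc (length (orbits π))) permutations)) π∈ b c

  strands : ∀ {n} → Subset n → Subset n → Strands
  strands []      []      = 1F ∷ 0F ∷ 3F ∷ 2F ∷ []
  strands (b ∷ K) (c ∷ T) = step b c (strands K T)

  loopCount genus : ∀ {n} → Subset n → Subset n → ℕ
  loopCount []      []      = 0
  loopCount (b ∷ K) (c ∷ T) = newLoops b c (strands K T) + loopCount K T
  genus []      []      = 0
  genus (b ∷ K) (c ∷ T) = handles b c (strands K T) + genus K T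

  strands∈permutations : ∀ {n} (K T : Subset n) → strands K T ∈ permutations
  strands∈permutations []      []      = from-yes ((1F ∷ 0F ∷ 3F ∷ 2F ∷ []) ∈ᵖ? permutations)
  strands∈permutations (b ∷ K) (c ∷ T) = step∈permutations b c (strands∈permutations K T)

  euler : ∀ {n} (K T : Subset n) → loopCount K T + length (orbits (strands K T)) + 2 * genus K T ≡ 2 + n
  euler []      []      = refl
  euler (b ∷ K) (c ∷ T) = begin
    l + L + o + 2 * (h + H)      ≡⟨ rearrange l L o h H ⟩
    (l + o + 2 * h) + (L + 2 * H) ≡⟨ cong (_+ (L + 2 * H)) (euler-step b c (strands∈permutations K T)) ⟩
    suc O + (L + 2 * H)          ≡⟨ cong suc (rearrange′ O L H) ⟩
    suc (L + O + 2 * H)          ≡⟨ cong suc (euler K T) ⟩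
    _                            ∎
    where
    open ≡-Reasoning
    l = newLoops b c (strands K T)
    L = loopCount K T
    o = length (orbits (step b c (strands K T)))
    O = length (orbits (strands K T))
    h = handles b c (strands K T)
    H = genus K T
    rearrange : ∀ l L o h H → l + L + o + 2 * (h + H) ≡ (l + o + 2 * h) + (L + 2 * H)
    rearrange = solve-∀
    rearrange′ : ∀ O L H → O + (L + 2 * H) ≡ L + O + 2 * H
    rearrange′ = solve-∀

  LadderTangle : ∀ {n} → Subset n → Subset n → Set
  LadderTangle {n} K T = Tangle (tokens K T) (strands K T) (loopCount K T) (sides n)

  recount : ∀ {A} {W : List (Token A)} {π k l ss ss′} → k ≡ l → ss ↭ ss′ → Tangle W π k ss → Tangle W π l ss′
  recount refl p t = record { Tangle t using (strand; run; loops; closed; #loops) ; all = ↭-trans (Tangle.all t) p }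

  module Lifted {n : ℕ} (b c : Bool) (K T : Subset n) (tangle : LadderTangle K T) where
    open Tangle tangle
    W′ = tokens (b ∷ K) (c ∷ T)
    π  = strands K T

    strand′ : Slot → List (Side (Letter (suc n)))
    strand′ = map liftSide ∘ strand

    -- The inner sides of a strand stay consecutive after the insertion; only its ends may now lie
    -- at a new side instead of a slot. The cases of `tangle-∷` differ in how these ends are joined.
    run′ : ∀ r → Chain (Turn W′) (exit b c (slot r)) (map side (strand′ r)) (entry b c (slot (Vec.lookup π r)))
    run′ r = run-insert K T b c (strand r) (run r)

    loops′ : List (List (Side (Letter (suc n))))
    loops′ = map (map liftSide) loops

    closed′ : All (λ l → IsCycle (Turn W′) (map side l)) loops′
    closed′ = All.map⁺ (All.map (λ {l} → lift-cycle l) closed)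
      where
      lift-cycle : ∀ l → IsCycle (Turn (tokens K T)) (map side l) → IsCycle (Turn W′) (map side (map liftSide l))
      lift-cycle (s ∷ l) (cycle k) = cycle (run-insert K T b c l k)

    all′ : concatMap strand′ slots ++ concat loops′ ↭ map liftSide (sides n)
    all′ = ↭-trans (↭-reflexive (sym (trans (map-++ liftSide (concatMap strand slots) (concat loops))
      (cong₂ _++_ (map-concatMap liftSide strand slots) (sym (concat-map loops)))))) (↭.map⁺ liftSide all)

    perm : IsPermutation π
    perm = isPermutation (strands∈permutations K T)

    count : ∀ {k} → newLoops b c π ≡ k → k + length loops′ ≡ loopCount (b ∷ K) (c ∷ T)
    count refl = cong (newLoops b c π +_) (trans (length-map _ loops) #loops)

  tangle-∷ : ∀ {n} b c (K T : Subset n) → LadderTangle K T → LadderTangle (b ∷ K) (c ∷ T)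
  tangle-∷ true true K T t = recount (count refl) ↭-refl
    (exchange-tangle W′ π perm strand′ loops′ closed′ _ all′ (entry true true ∘ slot) refl refl refl refl
      (λ r → subst (λ u → Chain (Turn W′) u (map side (strand′ r)) (entry true true (slot (Vec.lookup π r))))
          (exit-slot r) (run′ r))
      (turn-new K T true true {r = 1F} refl) (turn-new K T true true {r = 0F} refl))
    where
    open Lifted true true K T t
    exit-slot : ∀ r → exit true true (slot r) ≡ slot r
    exit-slot 0F = refl
    exit-slot 1F = refl
    exit-slot 2F = refl
    exit-slot 3F = refl
  tangle-∷ false false K T t = recount (count refl) ↭-refl
    (swap-tangle W′ π perm strand′ loops′ closed′ _ all′ (exit false false ∘ slot) refl refl refl refl
      (λ r → subst (Chain (Turn W′) _ _) (entry-slot (Vec.lookup π r)) (run′ r))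
      (turn-new K T false false {r = 2F} refl) (turn-new K T false false {r = 3F} refl))
    where
    open Lifted false false K T t
    entry-slot : ∀ r → entry false false (slot r) ≡ slot r
    entry-slot 0F = refl
    entry-slot 1F = refl
    entry-slot 2F = refl
    entry-slot 3F = refl
  tangle-∷ true false K T t = by (Vec.lookup π 3F Fin.≟ 0F)
    where
    open Lifted true false K T t
    exit-slot : ∀ {r} → r ≢ 3F → exit true false (slot r) ≡ slot r
    exit-slot {0F} _ = refl
    exit-slot {1F} _ = refl
    exit-slot {2F} _ = refl
    exit-slot {3F} r = contradiction refl r
    entry-slot : ∀ {r} → r ≢ 0F → entry true false (slot r) ≡ slot r
    entry-slot {0F} r = contradiction refl r
    entry-slot {1F} _ = refl
    entry-slot {2F} _ = refl
    entry-slot {3F} _ = refl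
    others : 3F ∷ 0F ∷ 1F ∷ 2F ∷ [] ↭ slots
    others = ↭.shifts [ 3F ] (0F ∷ 1F ∷ 2F ∷ []) {[]}
    by : Dec (Vec.lookup π 3F ≡ 0F) → LadderTangle (true ∷ K) (false ∷ T)
    by (yes e) = recount (count (cong (if_then 1 else 0) (dec-true (_ Fin.≟ _) e))) (↭-swap _ _ ↭-refl)
      (connect-loop W′ π perm strand′ loops′ closed′ _ all′ others ((λ ()) ∷ (λ ()) ∷ (λ ()) ∷ [])
        (exit true false ∘ slot) (entry true false ∘ slot) refl exit-slot refl entry-slot run′
        (turn-new K T true false {r = 3F} refl) (turn-new K T true false {r = 0F} refl) e)
    by (no ¬e) = recount (count (cong (if_then 1 else 0) (dec-false (_ Fin.≟ _) ¬e))) (↭-swap _ _ ↭-refl)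
      (connect-join W′ π perm strand′ loops′ closed′ _ all′ others ((λ ()) ∷ (λ ()) ∷ (λ ()) ∷ [])
        (exit true false ∘ slot) (entry true false ∘ slot) refl exit-slot refl entry-slot run′
        (turn-new K T true false {r = 3F} refl) (turn-new K T true false {r = 0F} refl) ¬e)
  tangle-∷ false true K T t = by (Vec.lookup π 2F Fin.≟ 1F)
    where
    open Lifted false true K T t
    exit-slot : ∀ {r} → r ≢ 2F → exit false true (slot r) ≡ slot r
    exit-slot {0F} _ = refl
    exit-slot {1F} _ = refl
    exit-slot {2F} r = contradiction refl r
    exit-slot {3F} _ = refl
    entry-slot : ∀ {r} → r ≢ 1F → entry false true (slot r) ≡ slot r
    entry-slot {0F} _ = refl
    entry-slot {1F} r = contradiction refl r
    entry-slot {2F} _ = refl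
    entry-slot {3F} _ = refl
    others : 2F ∷ 0F ∷ 1F ∷ 3F ∷ [] ↭ slots
    others = ↭.shifts [ 2F ] (0F ∷ 1F ∷ []) {[ 3F ]}
    by : Dec (Vec.lookup π 2F ≡ 1F) → LadderTangle (false ∷ K) (true ∷ T)
    by (yes e) = recount (count (cong (if_then 1 else 0) (dec-true (_ Fin.≟ _) e))) ↭-refl
      (connect-loop W′ π perm strand′ loops′ closed′ _ all′ others ((λ ()) ∷ (λ ()) ∷ (λ ()) ∷ [])
        (exit false true ∘ slot) (entry false true ∘ slot) refl exit-slot refl entry-slot run′
        (turn-new K T false true {r = 2F} refl) (turn-new K T false true {r = 1F} refl) e)
    by (no ¬e) = recount (count (cong (if_then 1 else 0) (dec-false (_ Fin.≟ _) ¬e))) ↭-refl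
      (connect-join W′ π perm strand′ loops′ closed′ _ all′ others ((λ ()) ∷ (λ ()) ∷ (λ ()) ∷ [])
        (exit false true ∘ slot) (entry false true ∘ slot) refl exit-slot refl entry-slot run′
        (turn-new K T false true {r = 2F} refl) (turn-new K T false true {r = 1F} refl) ¬e)

  ladderTangle : ∀ {n} (K T : Subset n) → LadderTangle K T
  ladderTangle (b ∷ K) (c ∷ T) = tangle-∷ b c K T (ladderTangle K T)
  ladderTangle [] [] = record
    { strand = strand
    ; run    = run
    ; loops  = []
    ; closed = []
    ; #loops = refl
    ; all    = ↭-swap _ _ ↭-refl
    }
    where
    strand : Slot → List (Side (Letter 0))
    strand 1F = [ a ⁻ ]
    strand 3F = [ a ⁺ ]
    strand _  = []
    run : ∀ r → Chain (Turn (tokens [] [])) (slot r) (map side (strand r)) (slot (Vec.lookup (strands [] []) r))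
    run 0F = end (there here)
    run 1F = there (there here) ∷ end here
    run 2F = end (there (there (there (there here))))
    run 3F = there (there (there (there (there here)))) ∷ end (there (there (there here)))

-- Erasing the slots: vertices and genus of a ladder

module LadderGenus where

  open CornerCycles
  open LadderTokens
  open Tangles
  open LadderTangles
  open import Data.Integer.Base as ℤ using (+_)
  import Data.Integer.Properties as ℤ
  open import Algebra.Properties.AbelianGroup ℤ.+-0-abelianGroup using (∙-cancelˡ)
  import Data.Integer.Tactic.RingSolver as ℤ
  open import Data.List.Properties
  open import Data.List.Membership.Propositional.Properties
  open import Data.List.Membership.Propositional.Properties.WithK using (unique∧set⇒bag)
  open import Data.List.Relation.Binary.BagAndSetEquality using (∼bag⇒↭)
  open import Data.Nat.Base using (ℕ; zero; suc; _+_; _*_)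
  import Data.Nat.Properties as ℕ
  open import Data.Nat.Tactic.RingSolver using (solve-∀)
  open import Function.Bundles using (mk⇔)

  data Once {A : Set} (x : A) : List A → Set where
    here  : ∀ {zs} → x ∉ zs → Once x (x ∷ zs)
    there : ∀ {z zs} → x ≢ z → Once x zs → Once x (z ∷ zs)

  -- An entry that is not repeated has one successor, visible in any decomposition. This is applied
  -- to slots; the side `a ⁺` does occur twice among the tokens.
  once-after : ∀ {A : Set} {x y : A} xs {ys} → Once x (xs ++ x ∷ ys) → Adjacent x y (xs ++ x ∷ ys) → ∃[ zs ] ys ≡ y ∷ zs
  once-after []       (here x∉)     here      = _ , refl
  once-after []       (here x∉)     (there p) = contradiction (adjacent⇒∈ p) x∉
    where
    adjacent⇒∈ : ∀ {A : Set} {x y : A} {l} → Adjacent x y l → x ∈ l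
    adjacent⇒∈ here      = here refl
    adjacent⇒∈ (there p) = there (adjacent⇒∈ p)
  once-after []       (there x≢ _)  _         = contradiction refl x≢
  once-after (_ ∷ xs) (here x∉)     _         = contradiction (∈-++⁺ʳ xs (here refl)) x∉
  once-after (_ ∷ [])    (there x≢ _) here     = contradiction refl x≢
  once-after (_ ∷ _ ∷ _) (there x≢ _) here     = contradiction refl x≢
  once-after (_ ∷ xs) (there _ o)   (there p) = once-after xs o p

  module _ {A : Set} where

    erase : List (Token A) → List (Side A)
    erase []            = []
    erase (side s ∷ ts) = s ∷ erase ts
    erase (slot _ ∷ ts) = erase ts

    erase-sides : ∀ ss ts → erase (map side ss ++ ts) ≡ ss ++ erase ts
    erase-sides []       ts = refl
    erase-sides (s ∷ ss) ts = cong (s ∷_) (erase-sides ss ts)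

    adjacent-erase : ∀ {s z} xs ms {Y} → Adjacent s z (erase (xs ++ side s ∷ map slot ms ++ side z ∷ Y))
    adjacent-erase (side _ ∷ xs) ms       = there (adjacent-erase xs ms)
    adjacent-erase (slot _ ∷ xs) ms       = adjacent-erase xs ms
    adjacent-erase {s} {z} [] ms {Y}      = subst (Adjacent s z) (cong (s ∷_) (sym (slots-erase ms))) here
      where
      slots-erase : ∀ ms → erase (map slot ms ++ side z ∷ Y) ≡ z ∷ erase Y
      slots-erase []       = refl
      slots-erase (_ ∷ ms) = slots-erase ms

    module _ (W : List (Token A)) (once : ∀ r → Once (slot r) W) where

      SideTurn : Side A → Side A → Set
      SideTurn s z = Adjacent (inv s) z (erase W)

      -- Only slots separate inv s from the token after flip t.
      Arrives : Side A → Token A → Set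
      Arrives s t = ∀ {t′} → Turn W t t′ → ∃[ xs ] ∃₂ λ ms Y → W ≡ xs ++ side (inv s) ∷ map slot ms ++ t′ ∷ Y

      arrives-side : ∀ s → Arrives s (side s)
      arrives-side s p with adjacent-split p
      ... | xs , Y , e = xs , [] , Y , e

      arrives-slot : ∀ {s t r} → Arrives s t → Turn W t (slot r) → Arrives s (slot r)
      arrives-slot {s} {t} {r} arr p {t′} q with arr p
      ... | xs , ms , Y , e with once-after before (subst (Once (slot r)) e′ (once r))
          (subst (Adjacent (slot r) t′) e′ q)
        where
        before : List (Token A)
        before = xs ++ side (inv s) ∷ map slot ms
        e′ : W ≡ before ++ slot r ∷ Y
        e′ = trans e (sym (++-assoc xs (side (inv s) ∷ map slot ms) (slot r ∷ Y)))
      ... | Z , refl = xs , ms ++ [ r ] , Z , trans e (cong (λ l → xs ++ side (inv s) ∷ l)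
              (sym (trans (cong (_++ t′ ∷ Z) (map-++ slot ms [ r ])) (++-assoc (map slot ms) [ slot r ] (t′ ∷ Z)))))

      side-turn : ∀ {s t z} → Arrives s t → Turn W t (side z) → SideTurn s z
      side-turn {s} {z = z} arr p with arr p
      ... | xs , ms , Y , e = subst (Adjacent (inv s) z ∘ erase) (sym e) (adjacent-erase xs ms)

      -- The invariant carries the last side met through any number of slots, until the next side
      -- turns out to be its successor around the vertex.
      erase-chain : ∀ {s t z} ts → Arrives s t → Chain (Turn W) t ts (side z) → Chain SideTurn s (erase ts) z
      erase-chain []             arr (end p) = end (side-turn arr p)
      erase-chain (side s′ ∷ ts) arr (p ∷ k) = side-turn arr p ∷ erase-chain ts (arrives-side s′) k
      erase-chain (slot r ∷ ts)  arr (p ∷ k) = erase-chain ts (arrives-slot arr p) k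

      erase-cycle : ∀ {s ts} → Chain (Turn W) (side s) ts (side s) → IsCycle SideTurn (s ∷ erase ts)
      erase-cycle {s} {ts} k = cycle (erase-chain ts (arrives-side s) k)

      module _ (π : Strands) (strand : Slot → List (Side A))
               (run : ∀ r → Chain (Turn W) (slot r) (map side (strand r)) (slot (Vec.lookup π r)))
               (touch : ∀ {r t} → Adjacent (slot r) (slot t) W → mayTouch r t ≡ true) where

        path : Slot → List Slot → List (Token A)
        path r []       = map side (strand r)
        path r (u ∷ us) = map side (strand r) ++ slot u ∷ path u us

        path-chain : ∀ {r us t} → Chain (Graph (Vec.lookup π)) r us t → Chain (Turn W) (slot r) (path r us) (slot t)
        path-chain {r} (end refl)  = run r
        path-chain {r} (refl ∷ k) = chain-++ (run r) (path-chain k)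

        erase-path : ∀ r us ts → erase (path r us ++ ts) ≡ concatMap strand (r ∷ us) ++ erase ts
        erase-path r []       ts = trans (erase-sides (strand r) ts)
            (cong (_++ erase ts) (sym (++-identityʳ (strand r))))
        erase-path r (u ∷ us) ts = begin
          erase ((map side (strand r) ++ slot u ∷ path u us) ++ ts) ≡⟨ cong erase
              (++-assoc (map side (strand r)) _ ts) ⟩
          erase (map side (strand r) ++ slot u ∷ path u us ++ ts)   ≡⟨ erase-sides (strand r) _ ⟩
          strand r ++ erase (path u us ++ ts)                       ≡⟨ cong (strand r ++_) (erase-path u us ts) ⟩
          strand r ++ concatMap strand (u ∷ us) ++ erase ts         ≡⟨ ++-assoc (strand r) _ _ ⟨
          (strand r ++ concatMap strand (u ∷ us)) ++ erase ts       ∎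
          where open ≡-Reasoning

        -- The strands along an orbit concatenate to one vertex. A cycle of sides has to start at a
        -- side, which is why an orbit starts at a strand that cannot be empty.
        close-orbit : ∀ {rs} → Orbit π rs → IsCycle SideTurn (concatMap strand rs)
        close-orbit (orbit {r} {rs} apart k) =
          subst (IsCycle SideTurn) (trans (erase-path r rs [ slot r ]) (++-identityʳ _))
                (go rs (path-chain k) (starts r apart))
          where
          starts : ∀ r → mayTouch r (Vec.lookup π r) ≡ false → ∃₂ λ s ss → strand r ≡ s ∷ ss
          starts r apart with strand r | run r
          -- An empty strand would make two slots neighbours in the word where `mayTouch` excludes
          -- it.
          ... | []     | end p = contradiction (trans (sym (touch p)) apart) λ ()
          ... | s ∷ ss | _     = s , ss , refl
          shape : ∀ rs → (∃₂ λ s ss → strand r ≡ s ∷ ss) → ∃₂ λ s ts → path r rs ≡ side s ∷ ts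
          shape []      (s , ss , e) = s , map side ss , cong (map side) e
          shape (u ∷ us) (s , ss , e) = s , _ , cong (λ l → map side l ++ slot u ∷ path u us) e
          go : ∀ rs → Chain (Turn W) (slot r) (path r rs) (slot r) → (∃₂ λ s ss → strand r ≡ s ∷ ss) →
               IsCycle SideTurn (erase (path r rs ++ [ slot r ]))
          go rs k st with path r rs | shape rs st
          ... | _ | s , ts , refl with k
          -- The closed walk is restarted at its first side, so the slot `r` moves to its end and is
          -- erased there.
          ...   | p ∷ k′ = erase-cycle (chain-++ k′ (end p))

  map-side-∉ : ∀ {A} (ss : List (Side A)) {r ts} → slot r ∉ ts → slot r ∉ map side ss ++ ts
  map-side-∉ []       r∉ p         = r∉ p
  map-side-∉ (_ ∷ ss) r∉ (there p) = map-side-∉ ss r∉ p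

  map-side-once : ∀ {A} (ss : List (Side A)) {r ts} → Once (slot r) ts → Once (slot r) (map side ss ++ ts)
  map-side-once []       o = o
  map-side-once (_ ∷ ss) o = there (λ ()) (map-side-once ss o)

  map-side-adjacent : ∀ {A} (ss : List (Side A)) {r t u ts} → Adjacent (slot r) t (map side ss ++ u ∷ ts) →
      Adjacent (slot r) t (u ∷ ts)
  map-side-adjacent []            p         = p
  map-side-adjacent (_ ∷ [])      (there p) = p
  map-side-adjacent (_ ∷ _ ∷ ss)  (there p) = map-side-adjacent (_ ∷ ss) p

  module _ {n : ℕ} (K T : Subset n) where

    tokens-once : ∀ r → Once (slot r) (tokens K T)
    tokens-once r = there (λ ()) (map-side-once (R₁ K) (from-0F r))
      where
      end∉ : ∀ {r} → slot r ∉ map side (R₄ T) ++ [ side (a ⁺) ]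
      end∉ = map-side-∉ (R₄ T) λ { (here ()) ; (there ()) }
      from-3F∉ : ∀ {r} → slot r ≢ slot 3F → slot r ∉ map side (R₂ K) ++ slot 3F ∷ map side (R₄ T) ++ [ side (a ⁺) ]
      from-3F∉ r≢ = map-side-∉ (R₂ K) λ { (here e) → r≢ e ; (there p) → end∉ p }
      from-1F∉ : slot 0F ∉ map side (R₃ T) ++ slot 1F ∷ side (a ⁻) ∷ slot 2F ∷ map side (R₂ K) ++ slot 3F ∷ map
          side (R₄ T) ++ [ side (a ⁺) ]
      from-1F∉ = map-side-∉ (R₃ T) λ { (here ()) ; (there (here ())) ; (there (there (here ()))) ;
          (there (there (there p))) → from-3F∉ (λ ()) p }
      from-0F : ∀ r → Once (slot r) (slot 0F ∷ map side (R₃ T) ++ slot 1F ∷ side (a ⁻) ∷ slot 2F ∷ map side (R₂ K)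
          ++ slot 3F ∷ map side (R₄ T) ++ [ side (a ⁺) ])
      from-0F 0F = here from-1F∉
      from-0F 1F = there (λ ()) (map-side-once (R₃ T) (here λ
          { (here ()) ; (there (here ())) ; (there (there p)) → from-3F∉ (λ ()) p }))
      from-0F 2F = there (λ ()) (map-side-once (R₃ T) (there (λ ()) (there (λ ()) (here (from-3F∉ (λ ()))))))
      from-0F 3F = there (λ ()) (map-side-once (R₃ T) (there (λ ())
          (there (λ ()) (there (λ ()) (map-side-once (R₂ K) (here end∉))))))

    tokens-touch : ∀ {r t} → Adjacent (slot r) (slot t) (tokens K T) → mayTouch r t ≡ true
    tokens-touch {r} {t} p = from-0F (R₃ T) (map-side-adjacent (a ⁺ ∷ R₁ K) p)
      where
      from-3F : ∀ ss → Adjacent (slot r) (slot t) (slot 3F ∷ map side ss ++ [ side (a ⁺) ]) → mayTouch r t ≡ true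
      from-3F []       (there (there ()))
      from-3F (s ∷ ss) (there p) with map-side-adjacent (s ∷ ss) p
      ... | there ()
      from-2F : ∀ ss → Adjacent (slot r) (slot t) (slot 2F ∷ map side ss ++ slot 3F ∷ map side (R₄ T) ++ [ side
          (a ⁺) ]) →
                mayTouch r t ≡ true
      from-2F []       here      = refl
      from-2F ss       (there p) = from-3F (R₄ T) (map-side-adjacent ss p)
      from-0F : ∀ ss → Adjacent (slot r) (slot t) (slot 0F ∷ map side ss ++ slot 1F ∷ side (a ⁻) ∷ slot 2F ∷ map
          side (R₂ K) ++
                  slot 3F ∷ map side (R₄ T) ++ [ side (a ⁺) ]) → mayTouch r t ≡ true
      from-0F []       here      = refl
      from-0F ss       (there p) with map-side-adjacent ss p
      ... | there (there q) = from-2F (R₂ K) q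

    -- The remaining final `a ⁺` is the repeated first side that `Rotates` expects.
    erase-tokens : erase (tokens K T) ≡ ladderWord K T ++ [ a ⁺ ]
    erase-tokens = cong (a ⁺ ∷_) (begin
      erase (map side (R₁ K) ++ slot 0F ∷ map side (R₃ T) ++ slot 1F ∷ side (a ⁻) ∷ l) ≡⟨ erase-sides (R₁ K) _ ⟩
      R₁ K ++ erase (map side (R₃ T) ++ slot 1F ∷ side (a ⁻) ∷ l)                      ≡⟨ cong (R₁ K ++_)
          (erase-sides (R₃ T) _) ⟩
      R₁ K ++ R₃ T ++ a ⁻ ∷ erase l                                                     ≡⟨ cong
          (λ l → R₁ K ++ R₃ T ++ a ⁻ ∷ l) tail ⟩
      R₁ K ++ R₃ T ++ (a ⁻ ∷ R₂ K ++ R₄ T) ++ [ a ⁺ ]                                   ≡⟨ cong (R₁ K ++_)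
          (++-assoc (R₃ T) _ _) ⟨
      R₁ K ++ (R₃ T ++ a ⁻ ∷ R₂ K ++ R₄ T) ++ [ a ⁺ ]                                   ≡⟨ ++-assoc (R₁ K) _ _ ⟨
      (R₁ K ++ R₃ T ++ a ⁻ ∷ R₂ K ++ R₄ T) ++ [ a ⁺ ]                                   ∎)
      where
      open ≡-Reasoning
      l : List (Token (Letter n))
      l = slot 2F ∷ map side (R₂ K) ++ slot 3F ∷ map side (R₄ T) ++ [ side (a ⁺) ]
      tail : erase l ≡ (R₂ K ++ R₄ T) ++ [ a ⁺ ]
      tail = trans (erase-sides (R₂ K) _) (trans (cong (R₂ K ++_) (erase-sides (R₄ T) _)) (sym (++-assoc (R₂ K) _ _)))

  liftSide-injective : ∀ {n} {s s′ : Side (Letter n)} → liftSide s ≡ liftSide s′ → s ≡ s′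
  liftSide-injective {s = a ⁺}      {a ⁺}      _    = refl
  liftSide-injective {s = a ⁻}      {a ⁻}      _    = refl
  liftSide-injective {s = rung k ⁺} {rung l ⁺} refl = refl
  liftSide-injective {s = rung k ⁻} {rung l ⁻} refl = refl
  liftSide-injective {s = a ⁺}      {rung l ⁺} ()
  liftSide-injective {s = a ⁻}      {rung l ⁻} ()
  liftSide-injective {s = rung k ⁺} {a ⁺}      ()
  liftSide-injective {s = rung k ⁻} {a ⁻}      ()

  sides-complete : ∀ {n} (s : Side (Letter n)) → s ∈ sides n
  sides-complete {zero}  (a ⁺)            = here refl
  sides-complete {zero}  (a ⁻)            = there (here refl)
  sides-complete {suc n} (rung zero ⁺)    = here refl
  sides-complete {suc n} (rung zero ⁻)    = there (here refl)
  sides-complete {suc n} (a ⁺)            = there (there (∈-map⁺ liftSide (sides-complete (a ⁺))))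
  sides-complete {suc n} (a ⁻)            = there (there (∈-map⁺ liftSide (sides-complete (a ⁻))))
  sides-complete {suc n} (rung (suc k) ⁺) = there (there (∈-map⁺ liftSide (sides-complete (rung k ⁺))))
  sides-complete {suc n} (rung (suc k) ⁻) = there (there (∈-map⁺ liftSide (sides-complete (rung k ⁻))))

  sides-unique : ∀ n → Unique (sides n)
  sides-unique zero    = ((λ ()) ∷ []) ∷ [] ∷ []
  sides-unique (suc n) = ((λ ()) ∷ All.map⁺ (All.universal x⁺≢ _)) ∷ All.map⁺ (All.universal x⁻≢ _) ∷
                         Unique.map⁺ liftSide-injective (sides-unique n)
    where
    x⁺≢ : ∀ (s : Side (Letter n)) → x⁺ ≢ liftSide s
    x⁺≢ (a ⁺) ()
    x⁺≢ (rung _ ⁺) ()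
    x⁺≢ (_ ⁻) ()
    x⁻≢ : ∀ (s : Side (Letter n)) → x⁻ ≢ liftSide s
    x⁻≢ (a ⁻) ()
    x⁻≢ (rung _ ⁻) ()
    x⁻≢ (_ ⁺) ()

  #positive-lift : ∀ {n} (ss : List (Side (Letter n))) → length (filter positive? (map liftSide ss)) ≡ length
      (filter positive? ss)
  #positive-lift []         = refl
  #positive-lift (x ⁺ ∷ ss) = cong suc (#positive-lift ss)
  #positive-lift (x ⁻ ∷ ss) = #positive-lift ss

  #positive-sides : ∀ n → length (filter positive? (sides n)) ≡ suc n
  #positive-sides zero    = refl
  #positive-sides (suc n) = cong suc (trans (#positive-lift (sides n)) (#positive-sides n))

  module _ {n : ℕ} (K T : Subset n) where
    open Tangle (ladderTangle K T)

    private
      π = strands K T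
      W = tokens K T

    ladderWord-sides : sides n ↭ ladderWord K T
    ladderWord-sides = ∼bag⇒↭ (unique∧set⇒bag (sides-unique n) (ladderWord-unique K T)
      (mk⇔ (λ _ → ladderWord-complete K T _) (λ _ → sides-complete _)))

    -- A vertex either avoids all slots and is a loop, or it consists of the strands along one orbit
    -- of `π`.
    #vertices-ladder : #vertices (ladder K T) ≡ loopCount K T + length (orbits π)
    #vertices-ladder = trans
      (#vertices-sideCycles (a ⁺) _ (ladderWord-unique K T) (ladderWord-complete K T)
          {cs = loops ++ map (concatMap strand) (orbits π)}
        (All.++⁺ (All.map (λ {l} → closed-loop l) closed)
            (All.map⁺ (All.map (rotates ∘ close) (orbits-orbit (strands∈permutations K T)))))
        (↭-trans cover (↭-trans all ladderWord-sides)))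
      (trans (length-++ loops) (cong₂ _+_ #loops (length-map (concatMap strand) (orbits π))))
      where
      close : ∀ {rs} → Orbit π rs → IsCycle (SideTurn W (tokens-once K T)) (concatMap strand rs)
      close = close-orbit W (tokens-once K T) π strand run (tokens-touch K T)
      rotates : ∀ {c} → IsCycle (SideTurn W (tokens-once K T)) c →
                IsCycle (Rotates (a ⁺) _ (ladderWord-unique K T) (ladderWord-complete K T)) c
      rotates {c} = subst (λ w → IsCycle (λ s z → Adjacent (inv s) z w) c) (erase-tokens K T)
      closed-loop : ∀ l → IsCycle (Turn W) (map side l) →
                    IsCycle (Rotates (a ⁺) _ (ladderWord-unique K T) (ladderWord-complete K T)) l
      closed-loop (s ∷ l) (cycle k) = rotates (subst (λ l → IsCycle _ (s ∷ l))
        (trans (cong erase (sym (++-identityʳ (map side l)))) (trans (erase-sides l []) (++-identityʳ l)))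
        (erase-cycle W (tokens-once K T) k))
      cover : concat (loops ++ map (concatMap strand) (orbits π)) ↭ concatMap strand slots ++ concat loops
      cover = begin
        concat (loops ++ map (concatMap strand) (orbits π))          ≡⟨ concat-++ loops _ ⟨
        concat loops ++ concat (map (concatMap strand) (orbits π))   ↭⟨ ↭.++-comm (concat loops) _ ⟩
        concatMap (concatMap strand) (orbits π) ++ concat loops      ≡⟨ cong (_++ concat loops)
            (concatMap-concat (orbits π)) ⟩
        concatMap strand (concat (orbits π)) ++ concat loops         ↭⟨ ↭.++⁺ʳ (concat loops)
            (concatMap-↭ strand (concat-orbits (strands∈permutations K T))) ⟩
        concatMap strand slots ++ concat loops                       ∎
        where
        open PermutationReasoning
        concatMap-concat : ∀ rss → concatMap (concatMap strand) rss ≡ concatMap strand (concat rss)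
        concatMap-concat []         = refl
        concatMap-concat (rs ∷ rss) = trans (cong (concatMap strand rs ++_) (concatMap-concat rss))
            (sym (concatMap-++ strand rs (concat rss)))

    #edges-ladder : #edges (ladder K T) ≡ suc n
    #edges-ladder = trans (↭.↭-length (↭.filter-↭ positive? (↭-sym ladderWord-sides))) (#positive-sides n)

    χ-ladder : χ (ladder K T) ≡ + 2 ℤ.- + (2 * genus K T)
    χ-ladder = begin
      χ (ladder K T)                       ≡⟨ cong₂ (λ v e → + v ℤ.- + e ℤ.+ + 1) #vertices-ladder #edges-ladder ⟩
      + V ℤ.- + suc n ℤ.+ + 1              ≡⟨ rearrange (+ V) (+ n) (+ g) ⟩
      (+ V ℤ.+ + g) ℤ.- + n ℤ.- + g        ≡⟨ cong (λ m → + m ℤ.- + n ℤ.- + g) (euler K T) ⟩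
      + (2 + n) ℤ.- + n ℤ.- + g            ≡⟨ cancel (+ n) (+ g) ⟩
      + 2 ℤ.- + g                          ∎
      where
      open ≡-Reasoning
      V = loopCount K T + length (orbits π)
      g = 2 * genus K T
      rearrange : ∀ V n g → V ℤ.- (+ 1 ℤ.+ n) ℤ.+ + 1 ≡ (V ℤ.+ g) ℤ.- n ℤ.- g
      rearrange = ℤ.solve-∀
      cancel : ∀ n g → (+ 2 ℤ.+ n) ℤ.- n ℤ.- g ≡ + 2 ℤ.- g
      cancel = ℤ.solve-∀

    hasGenus-genus : HasGenus (ladder K T) (genus K T)
    hasGenus-genus = χ-ladder

    hasGenus-unique : ∀ {g} → HasGenus (ladder K T) g → g ≡ genus K T
    hasGenus-unique {g} h = ℕ.*-cancelˡ-≡ g (genus K T) 2 (ℤ.+-injective (ℤ.neg-injective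
      (∙-cancelˡ (+ 2) _ _ (trans (sym h) χ-ladder))))

-- From pairs of subsets to generating polynomials

module PairCounting where

  open LadderTokens
  open LadderTangles
  open LadderGenus
  open import Data.Integer.Base as ℤ using (ℤ; +_; _+_)
  import Data.Integer.Properties as ℤ
  open import Data.Integer.Tactic.RingSolver using (solve-∀)
  open import Data.List.Properties
  open import Data.Nat.Base as ℕ using (ℕ; zero; suc)
  import Data.Nat.Properties as ℕ

  -- Coefficients are integers because the closed forms have negative terms.
  Poly : Set
  Poly = ℕ → ℤ

  shift : Poly → Poly
  shift f zero    = + 0
  shift f (suc i) = f i

  shiftBy : ℕ → Poly → Poly
  shiftBy zero    f = f
  shiftBy (suc k) f = shift (shiftBy k f)

  shift-cong : ∀ {f g} → f ≗ g → shift f ≗ shift g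
  shift-cong f≗g zero    = refl
  shift-cong f≗g (suc i) = f≗g i

  shiftBy-cong : ∀ k {f g} → f ≗ g → shiftBy k f ≗ shiftBy k g
  shiftBy-cong zero    f≗g = f≗g
  shiftBy-cong (suc k) f≗g = shift-cong (shiftBy-cong k f≗g)

  shiftBy-+ : ∀ k f g i → shiftBy k (λ i → f i + g i) i ≡ shiftBy k f i + shiftBy k g i
  shiftBy-+ zero    f g i       = refl
  shiftBy-+ (suc k) f g zero    = refl
  shiftBy-+ (suc k) f g (suc i) = shiftBy-+ k f g i

  shiftBy-shiftBy : ∀ j k f i → shiftBy (j ℕ.+ k) f i ≡ shiftBy k (shiftBy j f) i
  shiftBy-shiftBy zero    k f i = refl
  shiftBy-shiftBy (suc j) k f i = trans (shift-cong (shiftBy-shiftBy j k f) i) (commute k i)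
    where
    commute : ∀ k → shift (shiftBy k (shiftBy j f)) ≗ shiftBy k (shift (shiftBy j f))
    commute zero    i = refl
    commute (suc k) i = shift-cong (commute k) i

  one : Poly
  one zero    = + 1
  one (suc _) = + 0

  -- The generating polynomial of the genus gained when `m` further rungs are added, in all ways, to
  -- a word with pattern `π`.
  F : ℕ → Strands → Poly
  F zero    π   = one
  F (suc m) π i = move true true + move true false + move false true + move false false
    where
    move : Bool → Bool → ℤ
    move b c = shiftBy (handles b c π) (F m (step b c π)) i

  Σₛ : ∀ n → (Subset n → ℤ) → ℤ
  Σₛ zero    f = f []
  Σₛ (suc n) f = Σₛ n (f ∘ (false ∷_)) + Σₛ n (f ∘ (true ∷_))

  Σₛ-cong : ∀ n {f g} → f ≗ g → Σₛ n f ≡ Σₛ n g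
  Σₛ-cong zero    f≗g = f≗g []
  Σₛ-cong (suc n) f≗g = cong₂ _+_ (Σₛ-cong n (f≗g ∘ _)) (Σₛ-cong n (f≗g ∘ _))

  +-interchange : ∀ a b c d → a + b + (c + d) ≡ a + c + (b + d)
  +-interchange = solve-∀

  Σₛ-+ : ∀ n f g → Σₛ n (λ K → f K + g K) ≡ Σₛ n f + Σₛ n g
  Σₛ-+ zero    f g = refl
  Σₛ-+ (suc n) f g = trans (cong₂ _+_ (Σₛ-+ n _ _) (Σₛ-+ n _ _)) (+-interchange (Σₛ n (f ∘ (false ∷_))) _ _ _)

  Σₛ₂-suc : ∀ n (f : Subset (suc n) → Subset (suc n) → ℤ) →
    Σₛ (suc n) (λ K → Σₛ (suc n) (f K)) ≡
    Σₛ n λ K → Σₛ n λ T → f (true ∷ K) (true ∷ T) + f (true ∷ K) (false ∷ T) + f (false ∷ K) (true ∷ T) + f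
        (false ∷ K) (false ∷ T)
  Σₛ₂-suc n f = sym (trans (Σₛ-cong n λ K → trans
      (Σₛ-+₄ (λ T → f (true ∷ K) (true ∷ T)) (λ T → f (true ∷ K) (false ∷ T)) (λ T → f (false ∷ K) (true ∷ T))
          (λ T → f (false ∷ K) (false ∷ T)))
      (rearrange (S true true K) (S true false K) (S false true K) (S false false K)))
    (Σₛ-+ n (λ K → S false false K + S false true K) (λ K → S true false K + S true true K)))
    where
    S : Bool → Bool → Subset n → ℤ
    S b c K = Σₛ n λ T → f (b ∷ K) (c ∷ T)
    Σₛ-+₄ : ∀ f₁ f₂ f₃ f₄ → Σₛ n (λ T → f₁ T + f₂ T + f₃ T + f₄ T) ≡ Σₛ n f₁ + Σₛ n f₂ + Σₛ n f₃ + Σₛ n f₄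
    Σₛ-+₄ f₁ f₂ f₃ f₄ = trans (Σₛ-+ n (λ T → f₁ T + f₂ T + f₃ T) f₄) (cong (_+ Σₛ n f₄)
      (trans (Σₛ-+ n (λ T → f₁ T + f₂ T) f₃) (cong (_+ Σₛ n f₃) (Σₛ-+ n f₁ f₂))))
    rearrange : ∀ a b c d → a + b + c + d ≡ d + c + (b + a)
    rearrange = solve-∀

  -- The heads of the two subsets belong to the rung inserted last. Summing over them turns `F m`
  -- into `F (suc m)` at the pattern of the other rungs, so the induction runs with arbitrary `m`.
  Σ-F : ∀ n m i → Σₛ n (λ K → Σₛ n λ T → shiftBy (genus K T) (F m (strands K T)) i) ≡ F (n ℕ.+ m) (strands [] []) i
  Σ-F zero    m i = refl
  Σ-F (suc n) m i = trans (Σₛ₂-suc n λ K T → shiftBy (genus K T) (F m (strands K T)) i) (trans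
    (Σₛ-cong n λ K → Σₛ-cong n λ T → merge K T)
    (trans (Σ-F n (suc m) i) (cong (λ k → F k (strands [] []) i) (ℕ.+-suc n m))))
    where
    merge : ∀ K T → _ ≡ shiftBy (genus K T) (F (suc m) (strands K T)) i
    merge K T = sym (trans (shiftBy-+ g _ _ i) (cong₂ _+_ (trans (shiftBy-+ g _ _ i)
      (cong₂ _+_ (trans (shiftBy-+ g _ _ i) (cong₂ _+_ (one-move true true) (one-move true false)))
          (one-move false true)))
      (one-move false false)))
      where
      g = genus K T
      one-move : ∀ b c → shiftBy g (shiftBy (handles b c (strands K T)) (F m (step b c (strands K T)))) i ≡
                     shiftBy (handles b c (strands K T) ℕ.+ g) (F m (step b c (strands K T))) i
      one-move b c = sym (shiftBy-shiftBy (handles b c (strands K T)) g (F m (step b c (strands K T))) i)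

  indicator : ∀ {P : Set} → Dec P → ℤ
  indicator P? = if does P? then + 1 else + 0

  Σᴸ : ∀ {A : Set} → (A → ℤ) → List A → ℤ
  Σᴸ f = foldr (λ x s → f x + s) (+ 0)

  Σᴸ-++ : ∀ {A : Set} (f : A → ℤ) xs ys → Σᴸ f (xs ++ ys) ≡ Σᴸ f xs + Σᴸ f ys
  Σᴸ-++ f []       ys = sym (ℤ.+-identityˡ _)
  Σᴸ-++ f (x ∷ xs) ys = trans (cong (λ s → f x + s) (Σᴸ-++ f xs ys)) (sym (ℤ.+-assoc (f x) _ _))

  Σᴸ-map : ∀ {A B : Set} (f : B → ℤ) (g : A → B) xs → Σᴸ f (map g xs) ≡ Σᴸ (f ∘ g) xs
  Σᴸ-map f g xs = foldr-map (λ x s → f x + s) g (+ 0) xs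

  Σᴸ-subsets : ∀ n (f : Subset n → ℤ) → Σᴸ f (subsets n) ≡ Σₛ n f
  Σᴸ-subsets zero    f = ℤ.+-identityʳ (f [])
  Σᴸ-subsets (suc n) f = trans (Σᴸ-++ f (map (false ∷_) (subsets n)) _) (cong₂ _+_
    (trans (Σᴸ-map f (false ∷_) (subsets n)) (Σᴸ-subsets n _))
        (trans (Σᴸ-map f (true ∷_) (subsets n)) (Σᴸ-subsets n _)))

  Σᴸ-product : ∀ {A B : Set} (f : A × B → ℤ) xs ys → Σᴸ f (cartesianProduct xs ys) ≡ Σᴸ
      (λ x → Σᴸ (λ y → f (x , y)) ys) xs
  Σᴸ-product f []       ys = refl
  Σᴸ-product f (x ∷ xs) ys = trans (Σᴸ-++ f (map (x ,_) ys) _) (cong₂ _+_ (Σᴸ-map f (x ,_) ys) (Σᴸ-product f xs ys))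

  Σᴸ-indicator : ∀ {A : Set} {P : Pred A 0ℓ} (P? : Decidable P) xs → + length (filter P? xs) ≡ Σᴸ (indicator ∘ P?) xs
  Σᴸ-indicator P? []       = refl
  Σᴸ-indicator P? (x ∷ xs) with does (P? x)
  ... | true  = cong (λ s → + 1 + s) (Σᴸ-indicator P? xs)
  ... | false = trans (Σᴸ-indicator P? xs) (sym (ℤ.+-identityˡ _))

  shiftBy-one : ∀ {k i} → k ≡ i → shiftBy k one i ≡ + 1
  shiftBy-one {zero}  refl = refl
  shiftBy-one {suc k} refl = shiftBy-one {k} refl

  shiftBy-one-≢ : ∀ {k i} → k ≢ i → shiftBy k one i ≡ + 0
  shiftBy-one-≢ {zero}  {zero}  k≢i = contradiction refl k≢i
  shiftBy-one-≢ {zero}  {suc i} k≢i = refl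
  shiftBy-one-≢ {suc k} {zero}  k≢i = refl
  shiftBy-one-≢ {suc k} {suc i} k≢i = shiftBy-one-≢ (k≢i ∘ cong suc)

  indicator-shift : ∀ {P : Set} {k i} (P? : Dec P) → (P → k ≡ i) → (k ≡ i → P) → indicator P? ≡ shiftBy k one i
  indicator-shift (yes p) to from = sym (shiftBy-one (to p))
  indicator-shift (no ¬p) to from = sym (shiftBy-one-≢ (¬p ∘ from))

  indicator-genus : ∀ {n} (K T : Subset n) i → indicator (hasGenus? (ladder K T) i) ≡ shiftBy (genus K T) one i
  indicator-genus K T i = indicator-shift (hasGenus? (ladder K T) i) (λ p → sym (hasGenus-unique K T p))
    (λ e → subst (HasGenus (ladder K T)) e (hasGenus-genus K T))

  Σₛ-indicator : ∀ n {P : Pred (Subset n × Subset n) 0ℓ} (P? : Decidable P) →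
    + length (filter P? (cartesianProduct (subsets n) (subsets n))) ≡ Σₛ n λ K → Σₛ n λ T → indicator (P? (K , T))
  Σₛ-indicator n P? = begin
    + length (filter P? (cartesianProduct (subsets n) (subsets n)))
      ≡⟨ Σᴸ-indicator P? (cartesianProduct (subsets n) (subsets n)) ⟩
    Σᴸ (indicator ∘ P?) (cartesianProduct (subsets n) (subsets n))
      ≡⟨ Σᴸ-product (indicator ∘ P?) (subsets n) (subsets n) ⟩
    Σᴸ (λ K → Σᴸ (λ T → indicator (P? (K , T))) (subsets n)) (subsets n)
      ≡⟨ Σᴸ-subsets n (λ K → Σᴸ (λ T → indicator (P? (K , T))) (subsets n)) ⟩
    Σₛ n (λ K → Σᴸ (λ T → indicator (P? (K , T))) (subsets n))
      ≡⟨ Σₛ-cong n (λ K → Σᴸ-subsets n (λ T → indicator (P? (K , T)))) ⟩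
    Σₛ n (λ K → Σₛ n λ T → indicator (P? (K , T))) ∎
    where open ≡-Reasoning

  g₅-F : ∀ n i → + g₅ n i ≡ F n (strands [] []) i
  g₅-F n i = begin
    + g₅ n i
      ≡⟨ Σₛ-indicator n (λ (K , T) → hasGenus? (ladder K T) i) ⟩
    Σₛ n (λ K → Σₛ n λ T → indicator (hasGenus? (ladder K T) i))
      ≡⟨ Σₛ-cong n (λ K → Σₛ-cong n λ T → indicator-genus K T i) ⟩
    Σₛ n (λ K → Σₛ n λ T → shiftBy (genus K T) one i)
      ≡⟨ Σ-F n 0 i ⟩
    F (n ℕ.+ 0) (strands [] []) i
      ≡⟨ cong (λ k → F k (strands [] []) i) (ℕ.+-identityʳ n) ⟩
    F n (strands [] []) i ∎
    where open ≡-Reasoning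

-- Thirteen classes of patterns and their recurrences

module ConnectionCounts where

  open LadderTokens
  open LadderTangles
  open PairCounting
  open import Data.Integer.Base using (ℤ; +_; _+_; _*_)
  open import Data.Integer.Tactic.RingSolver using (solve-∀)
  open import Data.List.Membership.Propositional.Properties using (∈-∃++)
  import Data.List.Membership.DecPropositional as DecMembership
  open import Data.Maybe.Base as Maybe using (Maybe; just; nothing; from-just; _>>=_)
  open import Data.Nat.Base as ℕ using (ℕ; zero; suc)
  import Data.Nat.Properties as ℕ
  open import Data.Product.Properties using () renaming (≡-dec to ×-≡-dec)
  open import Relation.Binary.Definitions using (DecidableEquality)

  module _ {A : Set} (_≟_ : DecidableEquality A) where
    open DecMembership _≟_ using (_∈?_)

    permutation : (xs ys : List A) → Maybe (xs ↭ ys)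
    permutation []       []      = just ↭-refl
    permutation []       (_ ∷ _) = nothing
    permutation (x ∷ xs) ys with x ∈? ys
    ... | no _   = nothing
    ... | yes x∈ with ∈-∃++ x∈
    ...   | as , bs , refl = Maybe.map (λ p → ↭-trans (↭-prep x p) (↭-sym (↭.shift x as bs)))
        (permutation xs (as ++ bs))

  allMaybe : ∀ {A : Set} {P : A → Set} → (∀ x → Maybe (P x)) → ∀ xs → Maybe (All P xs)
  allMaybe P? []       = just []
  allMaybe P? (x ∷ xs) = P? x >>= λ p → Maybe.map (p ∷_) (allMaybe P? xs)

  -- πE is the pattern of the word a a⁻ without rungs.
  πE πD πC πP πQ πR πH πJ πY πZ πU πL πM : Strands
  πE = 1F ∷ 0F ∷ 3F ∷ 2F ∷ []
  πD = 0F ∷ 1F ∷ 3F ∷ 2F ∷ []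
  πC = 0F ∷ 1F ∷ 2F ∷ 3F ∷ []
  πP = 0F ∷ 3F ∷ 1F ∷ 2F ∷ []
  πQ = 1F ∷ 3F ∷ 0F ∷ 2F ∷ []
  πR = 0F ∷ 3F ∷ 2F ∷ 1F ∷ []
  πH = 2F ∷ 3F ∷ 1F ∷ 0F ∷ []
  πJ = 2F ∷ 3F ∷ 0F ∷ 1F ∷ []
  πY = 1F ∷ 2F ∷ 3F ∷ 0F ∷ []
  πZ = 0F ∷ 2F ∷ 3F ∷ 1F ∷ []
  πU = 0F ∷ 2F ∷ 1F ∷ 3F ∷ []
  πL = 3F ∷ 2F ∷ 1F ∷ 0F ∷ []
  πM = 3F ∷ 2F ∷ 0F ∷ 1F ∷ []

  -- The 24 connection patterns fall into 13 classes that cannot be told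
  -- apart by counting; representative picks one pattern of each class.
  representative : Strands → Strands
  representative (1F ∷ 0F ∷ 2F ∷ 3F ∷ []) = πD
  representative (1F ∷ 3F ∷ 2F ∷ 0F ∷ []) = πP
  representative (2F ∷ 0F ∷ 1F ∷ 3F ∷ []) = πP
  representative (2F ∷ 1F ∷ 3F ∷ 0F ∷ []) = πP
  representative (2F ∷ 0F ∷ 3F ∷ 1F ∷ []) = πQ
  representative (2F ∷ 1F ∷ 0F ∷ 3F ∷ []) = πR
  representative (3F ∷ 0F ∷ 1F ∷ 2F ∷ []) = πY
  representative (1F ∷ 2F ∷ 0F ∷ 3F ∷ []) = πZ
  representative (3F ∷ 0F ∷ 2F ∷ 1F ∷ []) = πZ
  representative (3F ∷ 1F ∷ 0F ∷ 2F ∷ []) = πZ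
  representative (3F ∷ 1F ∷ 2F ∷ 0F ∷ []) = πU
  representative π                        = π

  moves : Strands → List (ℕ × Strands)
  moves π = map (λ (b , c) → handles b c π , representative (step b c π))
                ((true , true) ∷ (true , false) ∷ (false , true) ∷ (false , false) ∷ [])

  -- Since `moves` replaces targets by representatives, this says that the partition into classes is
  -- a bisimulation of the automaton.
  moves-representative : ∀ {π} → π ∈ permutations → moves π ↭ moves (representative π)
  moves-representative = All.lookup (from-just
    (allMaybe (λ π → permutation (×-≡-dec ℕ._≟_ _≟ᵖ_) (moves π) (moves (representative π))) permutations))

  representative∈permutations : ∀ {π} → π ∈ permutations → representative π ∈ permutations
  representative∈permutations = All.lookup (from-yes (All.all? (λ π → representative π ∈ᵖ? permutations) permutations))

  Σᴸ-↭ : ∀ {A : Set} (f : A → ℤ) {xs ys} → xs ↭ ys → Σᴸ f xs ≡ Σᴸ f ys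
  Σᴸ-↭ f ↭.refl         = refl
  Σᴸ-↭ f (↭.prep x p)   = cong (λ s → f x + s) (Σᴸ-↭ f p)
  Σᴸ-↭ f (↭.swap x y p) = trans (cong (λ s → f x + (f y + s)) (Σᴸ-↭ f p)) (left-comm (f x) (f y) _)
    where
    left-comm : ∀ a b c → a + (b + c) ≡ b + (a + c)
    left-comm = solve-∀
  Σᴸ-↭ f (↭.trans p q)  = trans (Σᴸ-↭ f p) (Σᴸ-↭ f q)

  value : ℕ → ℕ → ℕ × Strands → ℤ
  value m i (k , ρ) = shiftBy k (F m ρ) i

  F-moves : ∀ m i {π} → π ∈ permutations → F (suc m) π i ≡ Σᴸ (value m i) (moves π)
  -- By induction on `m`: patterns of one class have the same moves up to order, and the targets of
  -- moves may be replaced by representatives.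
  F-representative : ∀ m {π} → π ∈ permutations → F m π ≗ F m (representative π)

  F-moves m i {π} π∈ = trans (rearrange (term true true) (term true false) (term false true) (term false false))
    (cong₂ _+_ (move true true) (cong₂ _+_ (move true false)
        (cong₂ _+_ (move false true) (cong (λ s → s + + 0) (move false false)))))
    where
    rearrange : ∀ a b c d → a + b + c + d ≡ a + (b + (c + (d + + 0)))
    rearrange = solve-∀
    term : Bool → Bool → ℤ
    term b c = shiftBy (handles b c π) (F m (step b c π)) i
    move : ∀ b c → term b c ≡ shiftBy (handles b c π) (F m (representative (step b c π))) i
    move b c = shiftBy-cong (handles b c π) (F-representative m (step∈permutations b c π∈)) i

  F-representative zero    π∈ i = refl
  F-representative (suc m) π∈ i = trans (F-moves m i π∈) (trans (Σᴸ-↭ (value m i) (moves-representative π∈))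
    (sym (F-moves m i (representative∈permutations π∈))))

  -- Every use gives `refl` for the equation on `moves`: the recurrences below are the output of the
  -- automaton, recomputed by type checking.
  unfold : ∀ π m i {l} {π∈ : True (π ∈ᵖ? permutations)} → moves π ≡ l → F (suc m) π i ≡ Σᴸ (value m i) l
  unfold π m i {π∈ = π∈} refl = F-moves m i (toWitness π∈)

  abba : ∀ a b → a + (b + (b + (a + + 0))) ≡ + 2 * a + + 2 * b
  abba = solve-∀

  abbc : ∀ a b c → a + (b + (b + (c + + 0))) ≡ a + + 2 * b + c
  abbc = solve-∀

  abca : ∀ a b c → a + (b + (c + (a + + 0))) ≡ + 2 * a + b + c
  abca = solve-∀

  aaaa : ∀ a → a + (a + (a + (a + + 0))) ≡ + 4 * a
  aaaa = solve-∀

  aabb : ∀ a b → a + (a + (b + (b + + 0))) ≡ + 2 * a + + 2 * b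
  aabb = solve-∀

  opaque

    -- Sealed, so that later goals contain only these names and their recurrences and never unfold
    -- to the automaton.
    E D C P Q R H J Y Z U L M : ℕ → Poly
    E m = F m πE
    D m = F m πD
    C m = F m πC
    P m = F m πP
    Q m = F m πQ
    R m = F m πR
    H m = F m πH
    J m = F m πJ
    Y m = F m πY
    Z m = F m πZ
    U m = F m πU
    L m = F m πL
    M m = F m πM

    E-zero : ∀ i → E 0 i ≡ one i
    E-zero i = refl

    D-zero : ∀ i → D 0 i ≡ one i
    D-zero i = refl

    C-zero : ∀ i → C 0 i ≡ one i
    C-zero i = refl

    P-zero : ∀ i → P 0 i ≡ one i
    P-zero i = refl

    Q-zero : ∀ i → Q 0 i ≡ one i
    Q-zero i = refl

    R-zero : ∀ i → R 0 i ≡ one i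
    R-zero i = refl

    H-zero : ∀ i → H 0 i ≡ one i
    H-zero i = refl

    J-zero : ∀ i → J 0 i ≡ one i
    J-zero i = refl

    Y-zero : ∀ i → Y 0 i ≡ one i
    Y-zero i = refl

    Z-zero : ∀ i → Z 0 i ≡ one i
    Z-zero i = refl

    U-zero : ∀ i → U 0 i ≡ one i
    U-zero i = refl

    L-zero : ∀ i → L 0 i ≡ one i
    L-zero i = refl

    M-zero : ∀ i → M 0 i ≡ one i
    M-zero i = refl

    g₅-E : ∀ n i → + g₅ n i ≡ E n i
    g₅-E = g₅-F

    E-suc : ∀ m i → E (suc m) i ≡ + 2 * D m i + + 2 * shift (Y m) i
    E-suc m i = trans (unfold πE m i refl) (abba (D m i) (shift (Y m) i))

    D-suc : ∀ m i → D (suc m) i ≡ shift (E m) i + + 2 * shift (P m) i + C m i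
    D-suc m i = trans (unfold πD m i refl) (abbc (shift (E m) i) (shift (P m) i) (C m i))

    C-suc : ∀ m i → C (suc m) i ≡ + 2 * shift (D m) i + + 2 * shift (U m) i
    C-suc m i = trans (unfold πC m i refl) (abba (shift (D m) i) (shift (U m) i))

    P-suc : ∀ m i → P (suc m) i ≡ shift (Q m) i + shift (H m) i + P m i + R m i
    P-suc m i = trans (unfold πP m i refl) (abcd (shift (Q m) i) (shift (H m) i) (P m i) (R m i))
      where
      abcd : ∀ a b c d → a + (b + (c + (d + + 0))) ≡ a + b + c + d
      abcd = solve-∀

    Q-suc : ∀ m i → Q (suc m) i ≡ + 4 * P m i
    Q-suc m i = trans (unfold πQ m i refl) (aaaa (P m i))

    R-suc : ∀ m i → R (suc m) i ≡ + 4 * shift (P m) i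
    R-suc m i = trans (unfold πR m i refl) (aaaa (shift (P m) i))

    H-suc : ∀ m i → H (suc m) i ≡ + 2 * J m i + + 2 * H m i
    H-suc m i = trans (unfold πH m i refl) (abba (J m i) (H m i))

    J-suc : ∀ m i → J (suc m) i ≡ + 4 * shift (H m) i
    J-suc m i = trans (unfold πJ m i refl) (aaaa (shift (H m) i))

    Y-suc : ∀ m i → Y (suc m) i ≡ + 2 * Z m i + Y m i + L m i
    Y-suc m i = trans (unfold πY m i refl) (abca (Z m i) (Y m i) (L m i))

    Z-suc : ∀ m i → Z (suc m) i ≡ + 2 * shift (Y m) i + + 2 * U m i
    Z-suc m i = trans (unfold πZ m i refl) (aabb (shift (Y m) i) (U m i))

    U-suc : ∀ m i → U (suc m) i ≡ + 2 * shift (Z m) i + shift (L m) i + U m i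
    U-suc m i = trans (unfold πU m i refl) (abca (shift (Z m) i) (shift (L m) i) (U m i))

    L-suc : ∀ m i → L (suc m) i ≡ + 2 * shift (M m) i + + 2 * L m i
    L-suc m i = trans (unfold πL m i refl) (abba (shift (M m) i) (L m i))

    M-suc : ∀ m i → M (suc m) i ≡ + 4 * L m i
    M-suc m i = trans (unfold πM m i refl) (aaaa (L m i))

-- Solving the recurrences

module ClosedForms where

  open PairCounting
  open ConnectionCounts
  open import Data.Integer.Base as ℤ using (ℤ; +_; _+_; _*_; _-_; -_)
  import Data.Integer.Properties as ℤ
  open import Data.Integer.Tactic.RingSolver using (solve-∀)
  open import Data.Nat.Base as ℕ using (ℕ; zero; suc)

  opaque
    -- Coefficients of the power series 1/(1 - 2t - 8xt²), 1/(1 - t - 8xt²) and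
    -- (1 + t)/((1 - t)(1 - t - 8xt²)) in t.
    u v ζ : ℕ → Poly
    u 0             i = one i
    u 1             i = + 2 * one i
    u (suc (suc n)) i = + 2 * u (suc n) i + + 8 * shift (u n) i
    v 0             i = one i
    v 1             i = one i
    v (suc (suc n)) i = v (suc n) i + + 8 * shift (v n) i
    ζ 0             i = one i
    ζ (suc n)       i = ζ n i + v (suc n) i + v n i

    u-zero : ∀ i → u 0 i ≡ one i
    u-zero i = refl

    u-one : ∀ i → u 1 i ≡ + 2 * one i
    u-one i = refl

    u-rec : ∀ n i → u (suc (suc n)) i ≡ + 2 * u (suc n) i + + 8 * shift (u n) i
    u-rec n i = refl

    v-zero : ∀ i → v 0 i ≡ one i
    v-zero i = refl

    v-one : ∀ i → v 1 i ≡ one i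
    v-one i = refl

    v-rec : ∀ n i → v (suc (suc n)) i ≡ v (suc n) i + + 8 * shift (v n) i
    v-rec n i = refl

    ζ-zero : ∀ i → ζ 0 i ≡ one i
    ζ-zero i = refl

    ζ-suc : ∀ n i → ζ (suc n) i ≡ ζ n i + v (suc n) i + v n i
    ζ-suc n i = refl

  -- The solution of wₙ₊₂ = 4x wₙ, the homogeneous part of `E-rec`; its initial values are those
  -- that make `E-closed` hold for `E 1` and `E 2`.
  w : ℕ → Poly
  w 0             i = + 2 * one i
  w 1             i = + 2 * one i - + 6 * shift one i
  w (suc (suc n)) i = + 4 * shift (w n) i

  -- Linear combinations are kept as lists so that `shift-≈` can shift a whole equation term by
  -- term. Their evaluation leaves the final zeros in the ring identities.
  lin : List (ℤ × Poly) → Poly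
  lin []            i = + 0
  lin ((c , f) ∷ l) i = c * f i + lin l i

  infix 4 _≈_

  record _≈_ (f : Poly) (l : List (ℤ × Poly)) : Set where
    field at : ∀ i → f i ≡ lin l i
  open _≈_

  shifted : List (ℤ × Poly) → List (ℤ × Poly)
  shifted = map λ (c , g) → c , shift g

  shift-≈ : ∀ {f l} → f ≈ l → shift f ≈ shifted l
  shift-≈ {l = l} e .at (suc i) = trans (e .at i) (go l)
    where
    go : ∀ l → lin l i ≡ lin (shifted l) (suc i)
    go []            = refl
    go ((c , g) ∷ l) = cong (λ s → c * g i + s) (go l)
  shift-≈ {l = l} e .at zero = go l
    where
    go : ∀ l → + 0 ≡ lin (shifted l) zero
    go []            = refl
    go ((c , g) ∷ l) = trans (go l) (sym (trans (cong (_+ lin (shifted l) zero) (ℤ.*-zeroʳ c)) (ℤ.+-identityˡ _)))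

  u-lin : ∀ n → u (suc (suc n)) ≈ (+ 2 , u (suc n)) ∷ (+ 8 , shift (u n)) ∷ []
  u-lin n .at i rewrite u-rec n i =
    ring (u (suc n) i) (shift (u n) i)
    where
    ring : ∀ a b →
      + 2 * a + + 8 * b ≡
      + 2 * a + (+ 8 * b + + 0)
    ring = solve-∀

  v-lin : ∀ n → v (suc (suc n)) ≈ (+ 1 , v (suc n)) ∷ (+ 8 , shift (v n)) ∷ []
  v-lin n .at i rewrite v-rec n i =
    ring (v (suc n) i) (shift (v n) i)
    where
    ring : ∀ a b →
      a + + 8 * b ≡
      + 1 * a + (+ 8 * b + + 0)
    ring = solve-∀

  M-lin : ∀ n → M (suc n) ≈ (+ 4 , L n) ∷ []
  M-lin n .at i rewrite M-suc n i =
    ring (L n i)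
    where
    ring : ∀ a →
      + 4 * a ≡
      + 4 * a + + 0
    ring = solve-∀

  Q-lin : ∀ n → Q (suc n) ≈ (+ 4 , P n) ∷ []
  Q-lin n .at i rewrite Q-suc n i =
    ring (P n i)
    where
    ring : ∀ a →
      + 4 * a ≡
      + 4 * a + + 0
    ring = solve-∀

  E-lin : ∀ n → E (suc n) ≈ (+ 2 , D n) ∷ (+ 2 , shift (Y n)) ∷ []
  E-lin n .at i rewrite E-suc n i =
    ring (D n i) (shift (Y n) i)
    where
    ring : ∀ a b →
      + 2 * a + + 2 * b ≡
      + 2 * a + (+ 2 * b + + 0)
    ring = solve-∀

  Y-lin : ∀ n → Y (suc n) ≈ (+ 2 , Z n) ∷ (+ 1 , Y n) ∷ (+ 1 , L n) ∷ []
  Y-lin n .at i rewrite Y-suc n i =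
    ring (Z n i) (Y n i) (L n i)
    where
    ring : ∀ a b c →
      + 2 * a + b + c ≡
      + 2 * a + (+ 1 * b + (+ 1 * c + + 0))
    ring = solve-∀

  ζ-lin : ∀ n → ζ (suc n) ≈ (+ 1 , ζ n) ∷ (+ 1 , v (suc n)) ∷ (+ 1 , v n) ∷ []
  ζ-lin n .at i rewrite ζ-suc n i =
    ring (ζ n i) (v (suc n) i) (v n i)
    where
    ring : ∀ a b c →
      a + b + c ≡
      + 1 * a + (+ 1 * b + (+ 1 * c + + 0))
    ring = solve-∀

  u-one-lin : u 1 ≈ (+ 2 , one) ∷ []
  u-one-lin .at i = trans (u-one i) (sym (ℤ.+-identityʳ _))

  H-rec : ∀ n → H (suc (suc n)) ≈ (+ 2 , H (suc n)) ∷ (+ 8 , shift (H n)) ∷ []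
  H-rec n .at i rewrite H-suc (suc n) i | J-suc n i =
    ring (shift (H n) i) (H (suc n) i)
    where
    ring : ∀ a b →
      + 2 * (+ 4 * a) + + 2 * b ≡
      + 2 * b + (+ 8 * a + + 0)
    ring = solve-∀

  L-rec : ∀ n → L (suc (suc n)) ≈ (+ 2 , L (suc n)) ∷ (+ 8 , shift (L n)) ∷ []
  L-rec n .at i rewrite L-suc (suc n) i | at (shift-≈ (M-lin n)) i =
    ring (shift (L n) i) (L (suc n) i)
    where
    ring : ∀ a b →
      + 2 * (+ 4 * a + + 0) + + 2 * b ≡
      + 2 * b + (+ 8 * a + + 0)
    ring = solve-∀

  H-closed : ∀ n → H (suc n) ≈ (+ 1 , u (suc n)) ∷ (+ 2 , u n) ∷ []
  H-closed 0 .at i rewrite H-suc 0 i | J-zero i | H-zero i | u-one i | u-zero i =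
    ring (one i)
    where
    ring : ∀ a →
      + 2 * a + + 2 * a ≡
      + 1 * (+ 2 * a) + (+ 2 * a + + 0)
    ring = solve-∀
  H-closed 1 .at i rewrite at (H-rec 0) i | H-suc 0 i | J-zero i | H-zero i | shift-cong H-zero i
    | u-rec 0 i | u-one i | shift-cong u-zero i =
    ring (one i) (shift one i)
    where
    ring : ∀ a b →
      + 2 * (+ 2 * a + + 2 * a) + (+ 8 * b + + 0) ≡
      + 1 * (+ 2 * (+ 2 * a) + + 8 * b) + (+ 2 * (+ 2 * a) + + 0)
    ring = solve-∀
  H-closed (suc (suc n)) = ind (H-closed (suc n)) (H-closed n)
    where
    ind : H (suc (suc n)) ≈ (+ 1 , u (suc (suc n))) ∷ (+ 2 , u (suc n)) ∷ [] →
      H (suc n) ≈ (+ 1 , u (suc n)) ∷ (+ 2 , u n) ∷ [] →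
      H (suc (suc (suc n))) ≈ (+ 1 , u (suc (suc (suc n)))) ∷ (+ 2 , u (suc (suc n))) ∷ []
    ind ih₁ ih₂ .at i rewrite at (H-rec (suc n)) i | at ih₁ i | at (shift-≈ ih₂) i | u-rec (suc n) i
      | u-rec n i =
      ring (u (suc n) i) (shift (u n) i) (shift (u (suc n)) i)
      where
      ring : ∀ a b c →
        + 2 * (+ 1 * (+ 2 * a + + 8 * b) + (+ 2 * a + + 0)) + (+ 8 * (+ 1 * c + (+ 2 * b + + 0)) + + 0) ≡
        + 1 * (+ 2 * (+ 2 * a + + 8 * b) + + 8 * c) + (+ 2 * (+ 2 * a + + 8 * b) + + 0)
      ring = solve-∀

  L-closed : ∀ n → L (suc n) ≈ (+ 1 , u (suc n)) ∷ (+ 2 , shift (u n)) ∷ []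
  L-closed 0 .at i rewrite L-suc 0 i | shift-cong M-zero i | L-zero i | u-one i
    | shift-cong u-zero i =
    ring (shift one i) (one i)
    where
    ring : ∀ a b →
      + 2 * a + + 2 * b ≡
      + 1 * (+ 2 * b) + (+ 2 * a + + 0)
    ring = solve-∀
  L-closed 1 .at i rewrite at (L-rec 0) i | L-suc 0 i | shift-cong M-zero i | L-zero i
    | shift-cong L-zero i | u-rec 0 i | u-one i | at (shift-≈ u-one-lin) i | shift-cong u-zero i =
    ring (shift one i) (one i)
    where
    ring : ∀ a b →
      + 2 * (+ 2 * a + + 2 * b) + (+ 8 * a + + 0) ≡
      + 1 * (+ 2 * (+ 2 * b) + + 8 * a) + (+ 2 * (+ 2 * a + + 0) + + 0)
    ring = solve-∀
  L-closed (suc (suc n)) = ind (L-closed (suc n)) (L-closed n)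
    where
    ind : L (suc (suc n)) ≈ (+ 1 , u (suc (suc n))) ∷ (+ 2 , shift (u (suc n))) ∷ [] →
      L (suc n) ≈ (+ 1 , u (suc n)) ∷ (+ 2 , shift (u n)) ∷ [] →
      L (suc (suc (suc n))) ≈ (+ 1 , u (suc (suc (suc n)))) ∷ (+ 2 , shift (u (suc (suc n)))) ∷ []
    ind ih₁ ih₂ .at i rewrite at (L-rec (suc n)) i | at ih₁ i | at (shift-≈ ih₂) i | u-rec (suc n) i
      | at (shift-≈ (u-lin n)) i =
      ring (u (suc (suc n)) i) (shift (u (suc n)) i) (shift (shift (u n)) i)
      where
      ring : ∀ a b c →
        + 2 * (+ 1 * a + (+ 2 * b + + 0)) + (+ 8 * (+ 1 * b + (+ 2 * c + + 0)) + + 0) ≡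
        + 1 * (+ 2 * a + + 8 * b) + (+ 2 * (+ 2 * b + (+ 8 * c + + 0)) + + 0)
      ring = solve-∀

  P-rec : ∀ n → P (suc (suc n)) ≈
      (+ 1 , P (suc n)) ∷ (+ 8 , shift (P n)) ∷ (+ 1 , shift (H (suc n))) ∷ []
  P-rec n .at i rewrite P-suc (suc n) i | at (shift-≈ (Q-lin n)) i | R-suc n i =
    ring (shift (P n) i) (shift (H (suc n)) i) (P (suc n) i)
    where
    ring : ∀ a b c →
      + 4 * a + + 0 + b + c + + 4 * a ≡
      + 1 * c + (+ 8 * a + (+ 1 * b + + 0))
    ring = solve-∀

  -- By `H-rec`, xH solves the inhomogeneous `P-rec`. The rest obeys the recurrence of `v`, and its
  -- initial values make it (1 - x)(vₙ₊₁ + vₙ).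
  P-closed : ∀ n → P (suc n) ≈
      (+ 1 , shift (H (suc n))) ∷ (+ 1 , v (suc n)) ∷ (+ 1 , v n) ∷ (- + 1 , shift (v (suc n))) ∷
      (- + 1 , shift (v n)) ∷ []
  P-closed 0 .at i rewrite P-suc 0 i | shift-cong Q-zero i | P-zero i | R-zero i
    | at (shift-≈ (H-closed 0)) i | shift-cong H-zero i | at (shift-≈ u-one-lin) i
    | shift-cong u-zero i | v-one i | v-zero i | shift-cong v-one i | shift-cong v-zero i =
    ring (shift one i) (one i)
    where
    ring : ∀ a b →
      a + a + b + b ≡
      + 1 * (+ 1 * (+ 2 * a + + 0) + (+ 2 * a + + 0)) + (+ 1 * b + (+ 1 * b + ((- + 1) * a + ((- + 1) * a
        + + 0))))
    ring = solve-∀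
  P-closed 1 = ind (P-closed 0)
    where
    ind : P 1 ≈
          (+ 1 , shift (H 1)) ∷ (+ 1 , v 1) ∷ (+ 1 , v 0) ∷ (- + 1 , shift (v 1)) ∷
          (- + 1 , shift (v 0)) ∷ [] →
      P 2 ≈
          (+ 1 , shift (H 2)) ∷ (+ 1 , v 2) ∷ (+ 1 , v 1) ∷ (- + 1 , shift (v 2)) ∷
          (- + 1 , shift (v 1)) ∷ []
    ind ih₁ .at i rewrite at (P-rec 0) i | at ih₁ i | shift-cong P-zero i | at (shift-≈ (H-rec 0)) i
      | shift-cong (shift-cong H-zero) i | v-rec 0 i | at (shift-≈ (v-lin 0)) i | v-one i | v-zero i
      | shift-cong v-one i | shift-cong v-zero i | shift-cong (shift-cong v-zero) i =
      ring (shift (H 1) i) (one i) (shift one i) (shift (shift one) i)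
      where
      ring : ∀ a b c d →
        + 1 * (+ 1 * a + (+ 1 * b + (+ 1 * b + ((- + 1) * c + ((- + 1) * c + + 0))))) + (+ 8 * c + (+ 1 * a
          + + 0)) ≡
        + 1 * (+ 2 * a + (+ 8 * d + + 0)) + (+ 1 * (b + + 8 * c) + (+ 1 * b + ((- + 1) * (+ 1 * c + (+ 8 * d
          + + 0)) + ((- + 1) * c + + 0))))
      ring = solve-∀
  P-closed (suc (suc n)) = ind (P-closed (suc n)) (P-closed n)
    where
    ind : P (suc (suc n)) ≈
          (+ 1 , shift (H (suc (suc n)))) ∷ (+ 1 , v (suc (suc n))) ∷ (+ 1 , v (suc n)) ∷
          (- + 1 , shift (v (suc (suc n)))) ∷ (- + 1 , shift (v (suc n))) ∷ [] →
      P (suc n) ≈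
          (+ 1 , shift (H (suc n))) ∷ (+ 1 , v (suc n)) ∷ (+ 1 , v n) ∷
          (- + 1 , shift (v (suc n))) ∷ (- + 1 , shift (v n)) ∷ [] →
      P (suc (suc (suc n))) ≈
          (+ 1 , shift (H (suc (suc (suc n))))) ∷ (+ 1 , v (suc (suc (suc n)))) ∷
          (+ 1 , v (suc (suc n))) ∷ (- + 1 , shift (v (suc (suc (suc n))))) ∷
          (- + 1 , shift (v (suc (suc n)))) ∷ []
    ind ih₁ ih₂ .at i rewrite at (P-rec (suc n)) i | at ih₁ i | at (shift-≈ ih₂) i
      | at (shift-≈ (H-rec (suc n))) i | v-rec (suc n) i | v-rec n i
      | at (shift-≈ (v-lin (suc n))) i | at (shift-≈ (v-lin n)) i =
      ring (shift (H (suc (suc n))) i) (v (suc n) i) (shift (v n) i) (shift (v (suc n)) i)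
        (shift (shift (v n)) i) (shift (shift (H (suc n))) i) (shift (shift (v (suc n))) i)
      where
      ring : ∀ a b c d e f g →
        + 1 * (+ 1 * a + (+ 1 * (b + + 8 * c) + (+ 1 * b + ((- + 1) * (+ 1 * d + (+ 8 * e + + 0)) + ((-
          + 1) * d + + 0))))) + (+ 8 * (+ 1 * f + (+ 1 * d + (+ 1 * c + ((- + 1) * g + ((- + 1) * e
          + + 0))))) + (+ 1 * a + + 0)) ≡
        + 1 * (+ 2 * a + (+ 8 * f + + 0)) + (+ 1 * (b + + 8 * c + + 8 * d) + (+ 1 * (b + + 8 * c) + ((-
          + 1) * (+ 1 * (+ 1 * d + (+ 8 * e + + 0)) + (+ 8 * g + + 0)) + ((- + 1) * (+ 1 * d + (+ 8 * e
          + + 0)) + + 0))))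
      ring = solve-∀

  -- By `U-suc` and `Y-suc` the difference U - xY does not change with `n`, and it starts at 1 - x.
  U-closed : ∀ n → U n ≈ (+ 1 , shift (Y n)) ∷ (+ 1 , one) ∷ (- + 1 , shift one) ∷ []
  U-closed 0 .at i rewrite U-zero i | shift-cong Y-zero i =
    ring (one i) (shift one i)
    where
    ring : ∀ a b →
      a ≡
      + 1 * b + (+ 1 * a + ((- + 1) * b + + 0))
    ring = solve-∀
  U-closed (suc n) = ind (U-closed n)
    where
    ind : U n ≈ (+ 1 , shift (Y n)) ∷ (+ 1 , one) ∷ (- + 1 , shift one) ∷ [] →
      U (suc n) ≈ (+ 1 , shift (Y (suc n))) ∷ (+ 1 , one) ∷ (- + 1 , shift one) ∷ []
    ind ih₁ .at i rewrite U-suc n i | at ih₁ i | at (shift-≈ (Y-lin n)) i =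
      ring (shift (Z n) i) (shift (L n) i) (shift (Y n) i) (one i) (shift one i)
      where
      ring : ∀ a b c d e →
        + 2 * a + b + (+ 1 * c + (+ 1 * d + ((- + 1) * e + + 0))) ≡
        + 1 * (+ 2 * a + (+ 1 * c + (+ 1 * b + + 0))) + (+ 1 * d + ((- + 1) * e + + 0))
      ring = solve-∀

  Y-rec : ∀ n → Y (suc (suc n)) ≈
      (+ 1 , Y (suc n)) ∷ (+ 8 , shift (Y n)) ∷ (+ 4 , one) ∷ (- + 4 , shift one) ∷
      (+ 1 , L (suc n)) ∷ []
  Y-rec n .at i rewrite Y-suc (suc n) i | Z-suc n i | at (U-closed n) i =
    ring (shift (Y n) i) (one i) (shift one i) (Y (suc n) i) (L (suc n) i)
    where
    ring : ∀ a b c d e →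
      + 2 * (+ 2 * a + + 2 * (+ 1 * a + (+ 1 * b + ((- + 1) * c + + 0)))) + d + e ≡
      + 1 * d + (+ 8 * a + (+ 4 * b + ((- + 4) * c + (+ 1 * e + + 0))))
    ring = solve-∀

  -- ζₙ is vₙ plus twice the sum of the earlier vⱼ, and `v-rec` telescopes to vₙ₊₁ = 1 + 8x times
  -- that sum. The relation serves to trade `ζ` for `v`.
  v-ζ : ∀ n → v (suc n) ≈ (+ 1 , one) ∷ (+ 4 , shift (ζ n)) ∷ (- + 4 , shift (v n)) ∷ []
  v-ζ 0 .at i rewrite v-one i | shift-cong ζ-zero i | shift-cong v-zero i =
    ring (one i) (shift one i)
    where
    ring : ∀ a b →
      a ≡
      + 1 * a + (+ 4 * b + ((- + 4) * b + + 0))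
    ring = solve-∀
  v-ζ (suc n) = ind (v-ζ n)
    where
    ind : v (suc n) ≈ (+ 1 , one) ∷ (+ 4 , shift (ζ n)) ∷ (- + 4 , shift (v n)) ∷ [] →
      v (suc (suc n)) ≈ (+ 1 , one) ∷ (+ 4 , shift (ζ (suc n))) ∷ (- + 4 , shift (v (suc n))) ∷ []
    ind ih₁ .at i rewrite v-rec n i | at ih₁ i | at (shift-≈ (ζ-lin n)) i =
      ring (one i) (shift (ζ n) i) (shift (v n) i) (shift (v (suc n)) i)
      where
      ring : ∀ a b c d →
        + 1 * a + (+ 4 * b + ((- + 4) * c + + 0)) + + 8 * c ≡
        + 1 * a + (+ 4 * (+ 1 * b + (+ 1 * d + (+ 1 * c + + 0))) + ((- + 4) * d + + 0))
      ring = solve-∀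

  ζ-rec : ∀ n → ζ (suc (suc n)) ≈ (+ 1 , ζ (suc n)) ∷ (+ 8 , shift (ζ n)) ∷ (+ 2 , one) ∷ []
  ζ-rec n .at i rewrite ζ-suc (suc n) i | v-rec n i | at (v-ζ n) i =
    ring (ζ (suc n) i) (one i) (shift (ζ n) i) (shift (v n) i)
    where
    ring : ∀ a b c d →
      a + (+ 1 * b + (+ 4 * c + ((- + 4) * d + + 0)) + + 8 * d) + (+ 1 * b + (+ 4 * c + ((- + 4) * d
        + + 0))) ≡
      + 1 * a + (+ 8 * c + (+ 2 * b + + 0))
    ring = solve-∀

  ζ-one : ζ 1 ≈ (+ 3 , one) ∷ []
  ζ-one .at i rewrite ζ-suc 0 i | ζ-zero i | v-one i | v-zero i =
    ring (one i)
    where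
    ring : ∀ a →
      a + a + a ≡
      + 3 * a + + 0
    ring = solve-∀

  -- The inhomogeneous terms of `Y-rec` are met one by one: `L` produces the term L by `L-rec`, and
  -- 2(1 - x)ζ produces 4(1 - x) by `ζ-rec`.
  Y-closed : ∀ n → Y (suc n) ≈ (+ 1 , L (suc n)) ∷ (+ 2 , ζ n) ∷ (- + 2 , shift (ζ n)) ∷ []
  Y-closed 0 .at i rewrite Y-suc 0 i | Z-zero i | Y-zero i | L-suc 0 i | shift-cong M-zero i
    | L-zero i | ζ-zero i | shift-cong ζ-zero i =
    ring (one i) (shift one i)
    where
    ring : ∀ a b →
      + 2 * a + a + a ≡
      + 1 * (+ 2 * b + + 2 * a) + (+ 2 * a + ((- + 2) * b + + 0))
    ring = solve-∀
  Y-closed 1 = ind (Y-closed 0)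
    where
    ind : Y 1 ≈ (+ 1 , L 1) ∷ (+ 2 , ζ 0) ∷ (- + 2 , shift (ζ 0)) ∷ [] →
      Y 2 ≈ (+ 1 , L 2) ∷ (+ 2 , ζ 1) ∷ (- + 2 , shift (ζ 1)) ∷ []
    ind ih₁ .at i rewrite at (Y-rec 0) i | at ih₁ i | shift-cong Y-zero i | at (L-rec 0) i
      | shift-cong L-zero i | at (ζ-one) i | at (shift-≈ ζ-one) i | ζ-zero i | shift-cong ζ-zero i =
      ring (L 1 i) (one i) (shift one i)
      where
      ring : ∀ a b c →
        + 1 * (+ 1 * a + (+ 2 * b + ((- + 2) * c + + 0))) + (+ 8 * c + (+ 4 * b + ((- + 4) * c + (+ 1 * a
          + + 0)))) ≡
        + 1 * (+ 2 * a + (+ 8 * c + + 0)) + (+ 2 * (+ 3 * b + + 0) + ((- + 2) * (+ 3 * c + + 0) + + 0))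
      ring = solve-∀
  Y-closed (suc (suc n)) = ind (Y-closed (suc n)) (Y-closed n)
    where
    ind : Y (suc (suc n)) ≈ (+ 1 , L (suc (suc n))) ∷ (+ 2 , ζ (suc n)) ∷ (- + 2 , shift (ζ (suc n))) ∷ [] →
      Y (suc n) ≈ (+ 1 , L (suc n)) ∷ (+ 2 , ζ n) ∷ (- + 2 , shift (ζ n)) ∷ [] →
      Y (suc (suc (suc n))) ≈
          (+ 1 , L (suc (suc (suc n)))) ∷ (+ 2 , ζ (suc (suc n))) ∷
          (- + 2 , shift (ζ (suc (suc n)))) ∷ []
    ind ih₁ ih₂ .at i rewrite at (Y-rec (suc n)) i | at ih₁ i | at (shift-≈ ih₂) i
      | at (L-rec (suc n)) i | at (ζ-rec n) i | at (shift-≈ (ζ-rec n)) i =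
      ring (L (suc (suc n)) i) (ζ (suc n) i) (shift (ζ (suc n)) i) (shift (L (suc n)) i)
        (shift (ζ n) i) (shift (shift (ζ n)) i) (one i) (shift one i)
      where
      ring : ∀ a b c d e f g h →
        + 1 * (+ 1 * a + (+ 2 * b + ((- + 2) * c + + 0))) + (+ 8 * (+ 1 * d + (+ 2 * e + ((- + 2) * f
          + + 0))) + (+ 4 * g + ((- + 4) * h + (+ 1 * a + + 0)))) ≡
        + 1 * (+ 2 * a + (+ 8 * d + + 0)) + (+ 2 * (+ 1 * b + (+ 8 * e + (+ 2 * g + + 0))) + ((- + 2) * (+ 1 * c
          + (+ 8 * f + (+ 2 * h + + 0))) + + 0))
      ring = solve-∀

  C-closed : ∀ n → C (suc n) ≈
      (+ 1 , shift (E (suc n))) ∷ (+ 2 , shift one) ∷ (- + 2 , shift (shift one)) ∷ []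
  C-closed n .at i rewrite C-suc n i | at (shift-≈ (U-closed n)) i | at (shift-≈ (E-lin n)) i =
    ring (shift (D n) i) (shift (shift (Y n)) i) (shift one i) (shift (shift one) i)
    where
    ring : ∀ a b c d →
      + 2 * a + + 2 * (+ 1 * b + (+ 1 * c + ((- + 1) * d + + 0))) ≡
      + 1 * (+ 2 * a + (+ 2 * b + + 0)) + (+ 2 * c + ((- + 2) * d + + 0))
    ring = solve-∀

  -- D contains xE directly and, by `C-closed`, once more through C. This closes the system, as P
  -- and Y are already solved.
  E-rec : ∀ n → E (suc (suc (suc n))) ≈
      (+ 4 , shift (E (suc n))) ∷ (+ 4 , shift (P (suc n))) ∷ (+ 4 , shift one) ∷
      (- + 4 , shift (shift one)) ∷ (+ 2 , shift (Y (suc (suc n)))) ∷ []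
  E-rec n .at i rewrite E-suc (suc (suc n)) i | D-suc (suc n) i | at (C-closed n) i =
    ring (shift (E (suc n)) i) (shift (P (suc n)) i) (shift one i) (shift (shift one) i)
      (shift (Y (suc (suc n))) i)
    where
    ring : ∀ a b c d e →
      + 2 * (a + + 2 * b + (+ 1 * a + (+ 2 * c + ((- + 2) * d + + 0)))) + + 2 * e ≡
      + 4 * a + (+ 4 * b + (+ 4 * c + ((- + 4) * d + (+ 2 * e + + 0))))
    ring = solve-∀

  -- The induction has step two, like `E-rec`. The `ζ` that enters with Y is removed by `v-ζ`.
  E-closed : ∀ n → E (suc n) ≈
      (+ 2 , shift (u (suc n))) ∷ (- + 2 , shift (u n)) ∷ (+ 2 , v (suc n)) ∷ (- + 1 , v n) ∷
      (- + 1 , one) ∷ (- + 2 , shift (v (suc n))) ∷ (+ 1 , shift (v n)) ∷ (+ 1 , shift one) ∷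
      (+ 1 , w n) ∷ []
  E-closed 0 .at i rewrite E-suc 0 i | D-zero i | shift-cong Y-zero i | at (shift-≈ u-one-lin) i
    | shift-cong u-zero i | v-one i | v-zero i | shift-cong v-one i | shift-cong v-zero i =
    ring (one i) (shift one i)
    where
    ring : ∀ a b →
      + 2 * a + + 2 * b ≡
      + 2 * (+ 2 * b + + 0) + ((- + 2) * b + (+ 2 * a + ((- + 1) * a + ((- + 1) * a + ((- + 2) * b
        + (+ 1 * b + (+ 1 * b + (+ 1 * (+ 2 * a) + + 0))))))))
    ring = solve-∀
  E-closed 1 .at i rewrite E-suc 1 i | D-suc 0 i | shift-cong E-zero i | shift-cong P-zero i
    | C-zero i | at (shift-≈ (Y-lin 0)) i | shift-cong Z-zero i | shift-cong Y-zero i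
    | shift-cong L-zero i | at (shift-≈ (u-lin 0)) i | at (shift-≈ u-one-lin) i
    | shift-cong (shift-cong u-zero) i | v-rec 0 i | at (shift-≈ (v-lin 0)) i | v-one i
    | shift-cong v-one i | shift-cong v-zero i | shift-cong (shift-cong v-zero) i =
    ring (shift one i) (one i) (shift (shift one) i)
    where
    ring : ∀ a b c →
      + 2 * (a + + 2 * a + b) + + 2 * (+ 2 * a + (+ 1 * a + (+ 1 * a + + 0))) ≡
      + 2 * (+ 2 * (+ 2 * a + + 0) + (+ 8 * c + + 0)) + ((- + 2) * (+ 2 * a + + 0) + (+ 2 * (b + + 8 * a)
        + ((- + 1) * b + ((- + 1) * b + ((- + 2) * (+ 1 * a + (+ 8 * c + + 0)) + (+ 1 * a + (+ 1 * a
        + (+ 1 * (+ 2 * b - + 6 * a) + + 0))))))))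
    ring = solve-∀
  E-closed (suc (suc n)) = ind (E-closed n)
    where
    ind : E (suc n) ≈
          (+ 2 , shift (u (suc n))) ∷ (- + 2 , shift (u n)) ∷ (+ 2 , v (suc n)) ∷ (- + 1 , v n) ∷
          (- + 1 , one) ∷ (- + 2 , shift (v (suc n))) ∷ (+ 1 , shift (v n)) ∷ (+ 1 , shift one) ∷
          (+ 1 , w n) ∷ [] →
      E (suc (suc (suc n))) ≈
          (+ 2 , shift (u (suc (suc (suc n))))) ∷ (- + 2 , shift (u (suc (suc n)))) ∷
          (+ 2 , v (suc (suc (suc n)))) ∷ (- + 1 , v (suc (suc n))) ∷ (- + 1 , one) ∷
          (- + 2 , shift (v (suc (suc (suc n))))) ∷ (+ 1 , shift (v (suc (suc n)))) ∷
          (+ 1 , shift one) ∷ (+ 1 , w (suc (suc n))) ∷ []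
    ind ih₁ .at i rewrite at (E-rec n) i | at (shift-≈ ih₁) i | at (shift-≈ (P-closed n)) i
      | at (shift-≈ (shift-≈ (H-closed n))) i | at (shift-≈ (Y-closed (suc n))) i
      | at (shift-≈ (L-closed (suc n))) i | at (shift-≈ (u-lin (suc n))) i | v-rec (suc n) i
      | at (v-ζ (suc n)) i | at (shift-≈ (v-lin (suc n))) i | at (shift-≈ (v-ζ (suc n))) i =
      ring (shift (shift (u (suc n))) i) (shift (shift (u n)) i) (shift (v (suc n)) i)
        (shift (v n) i) (shift one i) (shift (shift (v (suc n))) i) (shift (shift (v n)) i)
        (shift (shift one) i) (shift (w n) i) (shift (u (suc (suc n))) i) (shift (ζ (suc n)) i)
        (shift (shift (ζ (suc n))) i) (one i)
      where
      ring : ∀ a b c d e f g h j k l m n →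
        + 4 * (+ 2 * a + ((- + 2) * b + (+ 2 * c + ((- + 1) * d + ((- + 1) * e + ((- + 2) * f + (+ 1 * g
          + (+ 1 * h + (+ 1 * j + + 0))))))))) + (+ 4 * (+ 1 * (+ 1 * a + (+ 2 * b + + 0)) + (+ 1 * c
          + (+ 1 * d + ((- + 1) * f + ((- + 1) * g + + 0))))) + (+ 4 * e + ((- + 4) * h + (+ 2 * (+ 1 * (+ 1 * k
          + (+ 2 * a + + 0)) + (+ 2 * l + ((- + 2) * m + + 0))) + + 0)))) ≡
        + 2 * (+ 2 * k + (+ 8 * a + + 0)) + ((- + 2) * k + (+ 2 * (+ 1 * n + (+ 4 * l + ((- + 4) * c
          + + 0)) + + 8 * c) + ((- + 1) * (+ 1 * n + (+ 4 * l + ((- + 4) * c + + 0))) + ((- + 1) * n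
          + ((- + 2) * (+ 1 * (+ 1 * e + (+ 4 * m + ((- + 4) * f + + 0))) + (+ 8 * f + + 0)) + (+ 1 * (+ 1 * e
          + (+ 4 * m + ((- + 4) * f + + 0))) + (+ 1 * e + (+ 1 * (+ 4 * j) + + 0))))))))
      ring = solve-∀

-- Coefficients of the solution in terms of Lucas numbers

module LucasNumbers where

  open PairCounting using (Poly; shift; one)
  open ConnectionCounts using (E; g₅-E)
  open ClosedForms
  open import Data.Integer.Base as ℤ using (ℤ; +_; _+_; _*_; _-_; -_)
  import Data.Integer.Properties as ℤ
  open import Data.Integer.Tactic.RingSolver using (solve-∀)
  open import Data.Nat.Base as ℕ using (ℕ; zero; suc; _^_)
  import Data.Nat.Properties as ℕ
  import Data.Nat.Tactic.RingSolver as ℕ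

  open _≈_

  -- The coefficients of the Lucas-type polynomials: n/(n - k) times n - k choose k.
  lucas : ℕ → ℕ → ℕ
  lucas 0             zero    = 2
  lucas 0             (suc k) = 0
  lucas 1             zero    = 1
  lucas 1             (suc k) = 0
  lucas (suc (suc n)) zero    = lucas (suc n) zero
  lucas (suc (suc n)) (suc k) = lucas (suc n) (suc k) ℕ.+ lucas n k

  -- With Lₙ the polynomial with coefficients `lucas n k`, these are the coefficients of 2ⁿ Lₙ(2x)
  -- and Lₙ(8x), the sums of n-th powers of the two characteristic roots for `u` and `v`.
  α β : ℕ → ℕ → ℕ
  α n k = 2 ^ (n ℕ.+ k) ℕ.* lucas n k
  β n k = 8 ^ k ℕ.* lucas n k

  α-rec : ∀ n k → α (suc (suc n)) (suc k) ≡ 2 ℕ.* α (suc n) (suc k) ℕ.+ 8 ℕ.* α n k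
  α-rec n k rewrite ℕ.+-suc n k = ring (2 ^ (n ℕ.+ k)) (lucas (suc n) (suc k)) (lucas n k)
    where
    ring : ∀ e x y → 2 ℕ.* (2 ℕ.* (2 ℕ.* e)) ℕ.* (x ℕ.+ y) ≡ 2 ℕ.* (2 ℕ.* (2 ℕ.* e) ℕ.* x) ℕ.+ 8 ℕ.* (e ℕ.* y)
    ring = ℕ.solve-∀

  β-rec : ∀ n k → β (suc (suc n)) (suc k) ≡ β (suc n) (suc k) ℕ.+ 8 ℕ.* β n k
  β-rec n k = ring (8 ^ k) (lucas (suc n) (suc k)) (lucas n k)
    where
    ring : ∀ e x y → 8 ℕ.* e ℕ.* (x ℕ.+ y) ≡ 8 ℕ.* e ℕ.* x ℕ.+ 8 ℕ.* (e ℕ.* y)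
    ring = ℕ.solve-∀

  α-zero : ∀ n → α (suc (suc n)) 0 ≡ 2 ℕ.* α (suc n) 0
  α-zero n = ℕ.*-assoc 2 (2 ^ (suc n ℕ.+ 0)) (lucas (suc n) 0)

  pos-lin : ∀ c x y → + (c ℕ.* x ℕ.+ 8 ℕ.* y) ≡ + c * + x + + 8 * + y
  pos-lin c x y = cong₂ _+_ (ℤ.pos-* c x) (ℤ.pos-* 8 y)

  -- Power sums of the roots have generating function (2 - 2t)/(1 - 2t - 8xt²), which is 2 - 2t
  -- times that of `u`; for `v-β` the numerator is 2 - t.
  u-α : ∀ m k → + 2 * u (suc m) k - + 2 * u m k ≡ + α (suc m) k
  u-α 0 zero    rewrite u-one zero | u-zero zero = refl
  u-α 0 (suc k) rewrite u-one (suc k) | u-zero (suc k) | ℕ.*-zeroʳ (2 ^ (1 ℕ.+ suc k)) = refl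
  u-α 1 zero rewrite u-rec 0 0 | u-one 0 = refl
  u-α 1 1    rewrite u-rec 0 1 | u-one 1 | u-zero 0 = refl
  u-α 1 (suc (suc k)) rewrite u-rec 0 (suc (suc k)) | u-one (suc (suc k)) | u-zero (suc k) | ℕ.*-zeroʳ
      (2 ^ (2 ℕ.+ suc (suc k))) = refl
  u-α (suc (suc m)) zero = begin
    + 2 * u (3 ℕ.+ m) 0 - + 2 * u (2 ℕ.+ m) 0
      ≡⟨ cong₂ (λ p q → + 2 * p - + 2 * q) (u-rec (suc m) 0) (u-rec m 0) ⟩
    + 2 * (+ 2 * u (2 ℕ.+ m) 0 + + 8 * + 0) - + 2 * (+ 2 * u (suc m) 0 + + 8 * + 0)
      ≡⟨ ring (u (2 ℕ.+ m) 0) (u (suc m) 0) ⟩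
    + 2 * (+ 2 * u (2 ℕ.+ m) 0 - + 2 * u (suc m) 0)
      ≡⟨ cong (λ s → + 2 * s) (u-α (suc m) 0) ⟩
    + 2 * + α (2 ℕ.+ m) 0
      ≡⟨ trans (cong +_ (α-zero (suc m))) (ℤ.pos-* 2 (α (2 ℕ.+ m) 0)) ⟨
    + α (3 ℕ.+ m) 0 ∎
    where
    open ≡-Reasoning
    ring : ∀ q r → + 2 * (+ 2 * q + + 8 * + 0) - + 2 * (+ 2 * r + + 8 * + 0) ≡ + 2 * (+ 2 * q - + 2 * r)
    ring = solve-∀
  u-α (suc (suc m)) (suc k) = begin
    + 2 * u (3 ℕ.+ m) (suc k) - + 2 * u (2 ℕ.+ m) (suc k)
      ≡⟨ cong₂ (λ p q → + 2 * p - + 2 * q) (u-rec (suc m) (suc k)) (u-rec m (suc k)) ⟩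
    + 2 * (+ 2 * u (2 ℕ.+ m) (suc k) + + 8 * u (suc m) k) - + 2 * (+ 2 * u (suc m) (suc k) + + 8 * u m k)
      ≡⟨ ring (u (2 ℕ.+ m) (suc k)) (u (suc m) (suc k)) (u (suc m) k) (u m k) ⟩
    + 2 * (+ 2 * u (2 ℕ.+ m) (suc k) - + 2 * u (suc m) (suc k)) + + 8 * (+ 2 * u (suc m) k - + 2 * u m k)
      ≡⟨ cong₂ (λ s t → + 2 * s + + 8 * t) (u-α (suc m) (suc k)) (u-α m k) ⟩
    + 2 * + α (2 ℕ.+ m) (suc k) + + 8 * + α (suc m) k
      ≡⟨ trans (cong +_ (α-rec (suc m) k)) (pos-lin 2 (α (2 ℕ.+ m) (suc k)) (α (suc m) k)) ⟨
    + α (3 ℕ.+ m) (suc k) ∎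
    where
    open ≡-Reasoning
    ring : ∀ q r s t → + 2 * (+ 2 * q + + 8 * s) - + 2 * (+ 2 * r + + 8 * t) ≡ + 2 * (+ 2 * q - + 2 * r) + + 8 *
        (+ 2 * s - + 2 * t)
    ring = solve-∀

  v-β : ∀ m k → + 2 * v (suc m) k - v m k ≡ + β (suc m) k
  v-β 0 zero    rewrite v-one zero | v-zero zero = refl
  v-β 0 (suc k) rewrite v-one (suc k) | v-zero (suc k) | ℕ.*-zeroʳ (8 ^ suc k) = refl
  v-β 1 zero rewrite v-rec 0 0 | v-one 0 = refl
  v-β 1 1    rewrite v-rec 0 1 | v-one 1 | v-zero 0 = refl
  v-β 1 (suc (suc k)) rewrite v-rec 0 (suc (suc k)) | v-one (suc (suc k)) | v-zero (suc k) | ℕ.*-zeroʳ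
      (8 ^ suc (suc k)) = refl
  v-β (suc (suc m)) zero = begin
    + 2 * v (3 ℕ.+ m) 0 - v (2 ℕ.+ m) 0
      ≡⟨ cong₂ (λ p q → + 2 * p - q) (v-rec (suc m) 0) (v-rec m 0) ⟩
    + 2 * (v (2 ℕ.+ m) 0 + + 8 * + 0) - (v (suc m) 0 + + 8 * + 0)
      ≡⟨ ring (v (2 ℕ.+ m) 0) (v (suc m) 0) ⟩
    + 2 * v (2 ℕ.+ m) 0 - v (suc m) 0
      ≡⟨ v-β (suc m) 0 ⟩
    + β (3 ℕ.+ m) 0 ∎
    where
    open ≡-Reasoning
    ring : ∀ q r → + 2 * (q + + 8 * + 0) - (r + + 8 * + 0) ≡ + 2 * q - r
    ring = solve-∀
  v-β (suc (suc m)) (suc k) = begin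
    + 2 * v (3 ℕ.+ m) (suc k) - v (2 ℕ.+ m) (suc k)
      ≡⟨ cong₂ (λ p q → + 2 * p - q) (v-rec (suc m) (suc k)) (v-rec m (suc k)) ⟩
    + 2 * (v (2 ℕ.+ m) (suc k) + + 8 * v (suc m) k) - (v (suc m) (suc k) + + 8 * v m k)
      ≡⟨ ring (v (2 ℕ.+ m) (suc k)) (v (suc m) (suc k)) (v (suc m) k) (v m k) ⟩
    + 1 * (+ 2 * v (2 ℕ.+ m) (suc k) - v (suc m) (suc k)) + + 8 * (+ 2 * v (suc m) k - v m k)
      ≡⟨ cong₂ (λ s t → + 1 * s + + 8 * t) (v-β (suc m) (suc k)) (v-β m k) ⟩
    + 1 * + β (2 ℕ.+ m) (suc k) + + 8 * + β (suc m) k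
      ≡⟨ pos-lin 1 (β (2 ℕ.+ m) (suc k)) (β (suc m) k) ⟨
    + (1 ℕ.* β (2 ℕ.+ m) (suc k) ℕ.+ 8 ℕ.* β (suc m) k)
      ≡⟨ cong +_ (trans (cong (ℕ._+ 8 ℕ.* β (suc m) k) (ℕ.*-identityˡ (β (2 ℕ.+ m) (suc k)))) (sym (β-rec (suc m) k))) ⟩
    + β (3 ℕ.+ m) (suc k) ∎
    where
    open ≡-Reasoning
    ring : ∀ q r s t → + 2 * (q + + 8 * s) - (r + + 8 * t) ≡ + 1 * (+ 2 * q - r) + + 8 * (+ 2 * s - t)
    ring = solve-∀

  lucas-zero : ∀ m → lucas (suc m) 0 ≡ 1
  lucas-zero zero    = refl
  lucas-zero (suc m) = lucas-zero m

  -- The constant term of `β` is 1 and cancels the - 1 of the closed form, so only `w` contributes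
  -- to genus 0.
  g₅-zero : ∀ m → + g₅ (suc m) 0 ≡ w m 0
  g₅-zero m = trans (g₅-E (suc m) 0) (trans (at (E-closed m) 0) (trans (ring (v (suc m) 0) (v m 0) (w m 0))
    (trans (cong (λ s → s - + 1 + w m 0) (trans (v-β m 0) (cong +_ (trans (ℕ.*-identityˡ _) (lucas-zero m)))))
        (ℤ.+-identityˡ (w m 0)))))
    where
    ring : ∀ p q r → + 2 * + 0 + (- + 2 * + 0 + (+ 2 * p +
        (- + 1 * q + (- + 1 * + 1 + (- + 2 * + 0 + (+ 1 * + 0 + (+ 1 * + 0 + (+ 1 * r + + 0)))))))) ≡
                     + 2 * p - q - + 1 + r
    ring = solve-∀

  g₅-suc : ∀ m k → + g₅ (suc m) (suc k) ≡ + α (suc m) k + + β (suc m) (suc k) - + β (suc m) k + one k + w m (suc k)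
  g₅-suc m k = begin
    + g₅ (suc m) (suc k)  ≡⟨ g₅-E (suc m) (suc k) ⟩
    E (suc m) (suc k)     ≡⟨ at (E-closed m) (suc k) ⟩
    _                     ≡⟨ ring (u (suc m) k) (u m k) (v (suc m) (suc k)) (v m (suc k)) (v (suc m) k) (v m k)
        (one k) (w m (suc k)) ⟩
    (+ 2 * u (suc m) k - + 2 * u m k) + (+ 2 * v (suc m) (suc k) - v m (suc k)) - (+ 2 * v (suc m) k - v m k) +
        one k + w m (suc k)
                          ≡⟨ cong (λ s → s + one k + w m (suc k))
                              (cong₂ _-_ (cong₂ _+_ (u-α m k) (v-β m (suc k))) (v-β m k)) ⟩
    + α (suc m) k + + β (suc m) (suc k) - + β (suc m) k + one k + w m (suc k) ∎
    where
    open ≡-Reasoning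
    ring : ∀ a b c d e f o r →
      + 2 * a + (- + 2 * b + (+ 2 * c + (- + 1 * d + (- + 1 * + 0 +
          (- + 2 * e + (+ 1 * f + (+ 1 * o + (+ 1 * r + + 0)))))))) ≡
      (+ 2 * a - + 2 * b) + (+ 2 * c - d) - (+ 2 * e - f) + o + r
    ring = solve-∀

-- Evaluation for n below 50

module SmallCases where

  open import Defs using (p₅)
  open PairCounting using (one)
  open ClosedForms using (w)
  open LucasNumbers using (lucas)
  open import Data.Integer.Base as ℤ using (ℤ; +_; _+_; _-_)
  import Data.Integer.Properties as ℤ
  open import Data.Nat.Base as ℕ using (ℕ; zero; suc; _^_; _*_; _≤_; _<_; _≤ᵇ_)
  open import Data.Nat.DivMod using (_/_)
  import Data.Nat.Properties as ℕ

  -- For n = 2 there are still spheres, as `w 1` has constant term 2; from n = 3 on the relevant `w`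
  -- is divisible by x.
  q₅ r₅ : ℕ → ℕ
  q₅ n = if n ≤ᵇ 2 then 0 else 1
  r₅ n = (n ℕ.+ 1) / 2

  -- The formula for `g₅` with the row of Lucas numbers as a parameter, so that a row computed by
  -- iteration can replace `lucas`.
  distribution : ℕ → (ℕ → ℕ) → ℕ → ℤ
  distribution m l zero    = w m 0
  distribution m l (suc k) = + (2 ^ (suc m ℕ.+ k) * l k) + + (8 ^ suc k * l (suc k)) - + (8 ^ k * l k) + one k + w
      m (suc k)

  distribution-cong : ∀ m {l l′} → l ≗ l′ → distribution m l ≗ distribution m l′
  distribution-cong m e zero    = refl
  distribution-cong m e (suc k) rewrite e k | e (suc k) = refl

  -- Strict unimodality with bounded quantifiers, hence decidable. Positivity at both ends makes `q`
  -- and `r` attained genera.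
  Shape : (ℕ → ℤ) → ℕ → ℕ → ℕ → Set
  Shape f q r p = (q ≤ p × p ≤ r) × (+ 0 ℤ.< f q × + 0 ℤ.< f r) ×
    (∀ {i} → i < p → q ≤ i → f i ℤ.< f (suc i)) × (∀ {i} → i < r → p ≤ i → f (suc i) ℤ.< f i)

  shape? : ∀ f q r p → Dec (Shape f q r p)
  shape? f q r p = ((q ℕ.≤? p) ×-dec (p ℕ.≤? r)) ×-dec ((+ 0 ℤ.<? f q) ×-dec (+ 0 ℤ.<? f r)) ×-dec
    ℕ.allUpTo? (λ i → (q ℕ.≤? i) →-dec (f i ℤ.<? f (suc i))) p ×-dec
    ℕ.allUpTo? (λ i → (p ℕ.≤? i) →-dec (f (suc i) ℤ.<? f i)) r

  shape-resp : ∀ {f g q r p} → f ≗ g → Shape f q r p → Shape g q r p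
  shape-resp {q = q} {r} e (b , (x , y) , up , down) =
    b , (subst (+ 0 ℤ.<_) (e q) x , subst (+ 0 ℤ.<_) (e r) y) ,
    (λ {i} h h′ → subst₂ ℤ._<_ (e i) (e (suc i)) (up h h′)) , (λ {i} h h′ → subst₂ ℤ._<_ (e (suc i)) (e i) (down h h′))

  entry : List ℕ → ℕ → ℕ
  entry []       k       = 0
  entry (x ∷ xs) zero    = x
  entry (x ∷ xs) (suc k) = entry xs k

  addRows : List ℕ → List ℕ → List ℕ
  addRows []       ys       = ys
  addRows (x ∷ xs) []       = x ∷ xs
  addRows (x ∷ xs) (y ∷ ys) = x ℕ.+ y ∷ addRows xs ys

  entry-addRows : ∀ xs ys k → entry (addRows xs ys) k ≡ entry xs k ℕ.+ entry ys k
  entry-addRows []       ys       k       = refl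
  entry-addRows (x ∷ xs) []       k       = sym (ℕ.+-identityʳ _)
  entry-addRows (x ∷ xs) (y ∷ ys) zero    = refl
  entry-addRows (x ∷ xs) (y ∷ ys) (suc k) = entry-addRows xs ys k

  -- The recursion for lucas branches too much to be evaluated directly.
  row : ℕ → List ℕ → List ℕ → List ℕ
  row zero    xs ys = xs
  row (suc n) xs ys = row n ys (addRows ys (0 ∷ xs))

  row-lucas : ∀ n j {xs ys} → entry xs ≗ lucas j → entry ys ≗ lucas (suc j) → entry (row n xs ys) ≗ lucas (n ℕ.+ j)
  row-lucas zero    j e e′ k = e k
  row-lucas (suc n) j {xs} {ys} e e′ k = trans (row-lucas n (suc j) e′ third k) (cong (λ l → lucas l k) (ℕ.+-suc n j))
    where
    third : entry (addRows ys (0 ∷ xs)) ≗ lucas (suc (suc j))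
    third zero    = trans (entry-addRows ys (0 ∷ xs) 0) (trans (ℕ.+-identityʳ _) (e′ 0))
    third (suc k) = trans (entry-addRows ys (0 ∷ xs) (suc k)) (cong₂ ℕ._+_ (e′ (suc k)) (e k))

  lucasRow : ℕ → List ℕ
  lucasRow n = row n (2 ∷ []) (1 ∷ [])

  lucasRow-lucas : ∀ n → entry (lucasRow n) ≗ lucas n
  lucasRow-lucas n k = trans (row-lucas n 0 (λ { zero → refl ; (suc _) → refl }) (λ { zero → refl ; (suc _) → refl }) k)
    (cong (λ j → lucas j k) (ℕ.+-identityʳ n))

  -- This covers 2 ≤ n ≤ 49, and with it all branches of `p₅` but the last.
  shape-small : ∀ {m} → m < 49 → 1 ≤ m → Shape (distribution m (lucas (suc m))) (q₅ (suc m)) (r₅ (suc m)) (p₅ (suc m))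
  shape-small {m} m< 1≤m = shape-resp {q = q₅ (suc m)} {r₅ (suc m)} {p₅ (suc m)}
    (distribution-cong m (lucasRow-lucas (suc m)))
    (from-yes (ℕ.allUpTo? (λ m → (1 ℕ.≤? m) →-dec
       shape? (distribution m (entry (lucasRow (suc m)))) (q₅ (suc m)) (r₅ (suc m)) (p₅ (suc m))) 49) m< 1≤m)

-- Ratios of consecutive coefficients for fixed n

module LucasRatios where

  open PairCounting using (one)
  open ClosedForms using (w)
  open LucasNumbers
  open import Data.Integer.Base as ℤ using (ℤ; +_)
  import Data.Integer.Properties as ℤ
  import Data.Integer.Tactic.RingSolver as ℤ
  open import Data.Nat.Base using (ℕ; zero; suc; _+_; _*_; _^_; _≤_; _<_; z≤n; s≤s; _!; >-nonZero)
  open import Data.Nat.Properties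
  open import Data.Nat.Tactic.RingSolver using (solve-∀)

  -- This is d + 2k, with the two successors gained at each step of `k` exposed so that `lucas`
  -- reduces.
  pad : ℕ → ℕ → ℕ
  pad d zero    = d
  pad d (suc k) = suc (suc (pad d k))

  pad-suc : ∀ d k → pad (suc d) k ≡ suc (pad d k)
  pad-suc d zero    = refl
  pad-suc d (suc k) = cong (λ m → suc (suc m)) (pad-suc d k)

  pad-+ : ∀ d k → pad d k ≡ d + (k + k)
  pad-+ d zero    = sym (+-identityʳ d)
  pad-+ d (suc k) = trans (cong (λ m → suc (suc m)) (pad-+ d k)) (ring d k)
    where
    ring : ∀ d k → suc (suc (d + (k + k))) ≡ d + (suc k + suc k)
    ring = solve-∀

  -- lucasPad d k is lucas (d + 2k) k, where the recursion becomes Pascal's.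
  lucasPad : ℕ → ℕ → ℕ
  lucasPad zero    k       = 2
  lucasPad (suc d) zero    = 1
  lucasPad (suc d) (suc k) = lucasPad d (suc k) + lucasPad (suc d) k

  lucas-above : ∀ n k → n < k + k → lucas n k ≡ 0
  lucas-above 0             (suc k) h = refl
  lucas-above 1             (suc k) h = refl
  lucas-above (suc (suc n)) (suc k) h = cong₂ _+_ (lucas-above (suc n) (suc k) (<-trans (n<1+n _) h))
    (lucas-above n k (≤-pred (≤-pred (subst (suc (suc (suc n)) ≤_) (cong suc (+-suc k k)) h))))

  lucas-pad : ∀ d k → lucas (pad d k) k ≡ lucasPad d k
  lucas-pad zero    zero    = refl
  lucas-pad (suc d) zero    = lucas-zero d
  lucas-pad zero    (suc k) = cong₂ _+_ (lucas-above (suc (pad 0 k)) (suc k)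
      (s≤s (≤-reflexive (trans (cong suc (pad-+ 0 k)) (sym (+-suc k k))))))
    (lucas-pad zero k)
  lucas-pad (suc d) (suc k) = cong₂ _+_ (trans (cong (λ m → lucas (suc m) (suc k)) (pad-suc d k))
      (lucas-pad d (suc k))) (lucas-pad (suc d) k)

  -- The coefficient is n (n - k - 1)! over k! (n - 2k)!, here with the denominator cleared. The
  -- first factorial excludes n = 0, hence two mutual versions, with `d` or with `k` positive.
  lucasPad-! : ∀ d k → lucasPad (suc d) k * (k ! * suc d !) ≡ (2 * k + suc d) * (k + d) !
  lucasPad-!′ : ∀ d k → lucasPad d (suc k) * (suc k ! * d !) ≡ (2 * suc k + d) * (k + d) !
  lucasPad-! d zero    = ring (d !) d
    where
    ring : ∀ f d → 1 * (1 * (suc d * f)) ≡ (0 + suc d) * f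
    ring = solve-∀
  lucasPad-! d (suc k) = trans (lucasPad-!′ (suc d) k) (cong (λ m → (2 * suc k + suc d) * m !) (+-suc k d))
  lucasPad-!′ zero    k = trans (ring (k !) k) (cong (λ m → (2 * suc k + 0) * m !) (sym (+-identityʳ k)))
    where
    ring : ∀ f k → 2 * (suc k * f * 1) ≡ (2 * suc k + 0) * f
    ring = solve-∀
  lucasPad-!′ (suc d) k = begin
    (lucasPad d (suc k) + lucasPad (suc d) k) * (suc k ! * suc d !)
      ≡⟨ split (lucasPad d (suc k)) (lucasPad (suc d) k) (k !) (d !) k d ⟩
    suc d * (lucasPad d (suc k) * (suc k ! * d !)) + suc k * (lucasPad (suc d) k * (k ! * suc d !))
      ≡⟨ cong₂ (λ x y → suc d * x + suc k * y) (lucasPad-!′ d k) (lucasPad-! d k) ⟩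
    suc d * ((2 * suc k + d) * (k + d) !) + suc k * ((2 * k + suc d) * (k + d) !)
      ≡⟨ merge ((k + d) !) k d ⟩
    (2 * suc k + suc d) * (suc (k + d) * (k + d) !)
      ≡⟨ cong (λ m → (2 * suc k + suc d) * m !) (+-suc k d) ⟨
    (2 * suc k + suc d) * (k + suc d) ! ∎
    where
    open ≡-Reasoning
    split : ∀ x y f g k d → (x + y) * (suc k * f * (suc d * g)) ≡ suc d * (x * (suc k * f * g)) + suc k *
        (y * (f * (suc d * g)))
    split = solve-∀
    merge : ∀ f k d → suc d * ((2 * suc k + d) * f) + suc k * ((2 * k + suc d) * f) ≡ (2 * suc k + suc d) *
        (suc (k + d) * f)
    merge = solve-∀

  lucasPad-ratio : ∀ d k → (k + suc d) * suc k * lucasPad d (suc k) ≡ suc (suc d) * suc d * lucasPad (suc (suc d)) k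
  lucasPad-ratio d k = *-cancelʳ-≡ _ _ (k ! * d !) {{k !* d !≢0}} (begin
    (k + suc d) * suc k * lucasPad d (suc k) * (k ! * d !)
      ≡⟨ regroup (k + suc d) (lucasPad d (suc k)) (k !) (d !) k ⟩
    (k + suc d) * (lucasPad d (suc k) * (suc k ! * d !))
      ≡⟨ cong₂ _*_ (+-suc k d) (lucasPad-!′ d k) ⟩
    suc (k + d) * ((2 * suc k + d) * (k + d) !)
      ≡⟨ swap ((k + d) !) k d ⟩
    (2 * k + suc (suc d)) * (suc (k + d) * (k + d) !)
      ≡⟨ cong (λ m → (2 * k + suc (suc d)) * m !) (+-suc k d) ⟨
    (2 * k + suc (suc d)) * (k + suc d) !
      ≡⟨ lucasPad-! (suc d) k ⟨
    lucasPad (suc (suc d)) k * (k ! * suc (suc d) !)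
      ≡⟨ regroup′ (lucasPad (suc (suc d)) k) (k !) (d !) d ⟩
    suc (suc d) * suc d * lucasPad (suc (suc d)) k * (k ! * d !) ∎)
    where
    open ≡-Reasoning
    regroup : ∀ m x f g k → m * suc k * x * (f * g) ≡ m * (x * (suc k * f * g))
    regroup = solve-∀
    swap : ∀ f k d → suc (k + d) * ((2 * suc k + d) * f) ≡ (2 * k + suc (suc d)) * (suc (k + d) * f)
    swap = solve-∀
    regroup′ : ∀ x f g d → x * (f * (suc (suc d) * (suc d * g))) ≡ suc (suc d) * suc d * x * (f * g)
    regroup′ = solve-∀

  -- The coefficient of x^k in the Lucas-type polynomial for 8x and n = d + 2k.
  τ : ℕ → ℕ → ℕ
  τ d k = 8 ^ k * lucasPad d k

  -- The coefficient after `τ (suc e) k` for the same n: raising `k` lowers `d` by 2, which for `e`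
  -- = 0 leaves the range.
  τ-next : ℕ → ℕ → ℕ
  τ-next zero    k = 0
  τ-next (suc e) k = τ e (suc k)

  τ-ratio : ∀ e k → (k + e) * suc k * τ-next e k ≡ 8 * (suc e * e) * τ (suc e) k
  τ-ratio zero    k = *-zeroʳ ((k + 0) * suc k)
  τ-ratio (suc e) k = begin
    (k + suc e) * suc k * (8 * 8 ^ k * lucasPad e (suc k))         ≡⟨ regroup ((k + suc e) * suc k) (8 ^ k)
        (lucasPad e (suc k)) ⟩
    8 * 8 ^ k * ((k + suc e) * suc k * lucasPad e (suc k))         ≡⟨ cong (8 * 8 ^ k *_) (lucasPad-ratio e k) ⟩
    8 * 8 ^ k * (suc (suc e) * suc e * lucasPad (suc (suc e)) k)   ≡⟨ regroup′ (8 ^ k) (suc (suc e) * suc e)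
        (lucasPad (suc (suc e)) k) ⟩
    8 * (suc (suc e) * suc e) * (8 ^ k * lucasPad (suc (suc e)) k) ∎
    where
    open ≡-Reasoning
    regroup : ∀ m p x → m * (8 * p * x) ≡ 8 * p * (m * x)
    regroup = solve-∀
    regroup′ : ∀ p m x → 8 * p * (m * x) ≡ 8 * m * (p * x)
    regroup′ = solve-∀

  8^≤τ : ∀ d k → 8 ^ k ≤ τ d k
  8^≤τ d k = m≤m*n (8 ^ k) (lucasPad d k) {{>-nonZero (positive d k)}}
    where
    positive : ∀ d k → 1 ≤ lucasPad d k
    positive zero    k       = s≤s z≤n
    positive (suc d) zero    = s≤s z≤n
    positive (suc d) (suc k) = m≤n⇒m≤o+n (lucasPad d (suc k)) (positive (suc d) k)

  -- For n = d + 2k the exponent n + k is d + 3k.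
  α-pad : ∀ d k → α (pad d k) k ≡ 2 ^ d * τ d k
  α-pad d k = trans (cong₂ _*_ (power d k) (lucas-pad d k)) (*-assoc (2 ^ d) (8 ^ k) (lucasPad d k))
    where
    power : ∀ d k → 2 ^ (pad d k + k) ≡ 2 ^ d * 8 ^ k
    power d zero    = trans (cong (2 ^_) (+-identityʳ d)) (sym (*-identityʳ _))
    power d (suc k) = trans (cong (λ m → 2 * (2 * 2 ^ m)) (+-suc (pad d k) k))
        (trans (cong (λ x → 2 * (2 * (2 * x))) (power d k)) (ring (2 ^ d) (8 ^ k)))
      where
      ring : ∀ x y → 2 * (2 * (2 * (x * y))) ≡ x * (8 * y)
      ring = solve-∀

  β-pad : ∀ d k → β (pad d k) k ≡ τ d k
  β-pad d k = cong (8 ^ k *_) (lucas-pad d k)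

  β-pad-suc : ∀ e k → β (pad (suc e) k) (suc k) ≡ τ-next e k
  β-pad-suc zero    k = trans (cong (8 ^ suc k *_) (lucas-above (pad 1 k) (suc k)
    (s≤s (≤-reflexive (trans (pad-+ 1 k) (sym (+-suc k k))))))) (*-zeroʳ (8 ^ suc k))
  β-pad-suc (suc e) k = trans (cong (λ n → β n (suc k)) (trans (pad-suc (suc e) k) (cong suc (pad-suc e k))))
      (β-pad e (suc k))

  w-pad : ∀ e k i → w (pad e k) (k + i) ≡ + (4 ^ k) ℤ.* w e i
  w-pad e zero    i = sym (ℤ.*-identityˡ (w e i))
  w-pad e (suc k) i = trans (cong (λ x → + 4 ℤ.* x) (w-pad e k i))
      (trans (sym (ℤ.*-assoc (+ 4) (+ (4 ^ k)) (w e i))) (cong (ℤ._* w e i) (sym (ℤ.pos-* 4 (4 ^ k)))))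

  unit : ℕ → ℕ
  unit zero    = 1
  unit (suc k) = 0

  one-unit : ∀ k → one k ≡ + unit k
  one-unit zero    = refl
  one-unit (suc k) = refl

  -- The coefficient of x in `w e`, except for `e` = 1, where it is - 6. That case is treated apart
  -- so that the others stay in the natural numbers.
  ω : ℕ → ℕ
  ω 2 = 8
  ω 3 = 8
  ω _ = 0

  w-ω : ∀ e → e ≢ 1 → w e 1 ≡ + ω e
  w-ω 0 h = refl
  w-ω 1 h = contradiction refl h
  w-ω 2 h = refl
  w-ω 3 h = refl
  w-ω (suc (suc (suc (suc e)))) h = refl

  -- `G` is a variable of which only the coefficient formula is known; `g₅` takes its place at the
  -- very end, so its enumeration is never unfolded here.
  module _ (G : ℕ → ℕ → ℕ)
    (G-suc : ∀ m k → + G (suc m) (suc k) ≡ + α (suc m) k ℤ.+ + β (suc m) (suc k) ℤ.- + β (suc m) k ℤ.+ one k ℤ.+ w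
        m (suc k)) where

    G-pad : ∀ e k → + G (pad (suc e) k) (suc k) ≡
      + (2 ^ suc e * τ (suc e) k) ℤ.+ + τ-next e k ℤ.- + τ (suc e) k ℤ.+ one k ℤ.+ + (4 ^ k) ℤ.* w e 1
    G-pad e k = begin
      + G (pad (suc e) k) (suc k)   ≡⟨ cong (λ n → + G n (suc k)) (pad-suc e k) ⟩
      + G (suc (pad e k)) (suc k)   ≡⟨ G-suc (pad e k) k ⟩
      + α (suc (pad e k)) k ℤ.+ + β (suc (pad e k)) (suc k) ℤ.- + β (suc (pad e k)) k ℤ.+ one k ℤ.+ w (pad e k) (suc k)
        ≡⟨ cong₂ (λ n x → + α n k ℤ.+ + β n (suc k) ℤ.- + β n k ℤ.+ one k ℤ.+ x) (sym (pad-suc e k))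
                 (trans (cong (w (pad e k)) (sym (+-comm k 1))) (w-pad e k 1)) ⟩
      + α n k ℤ.+ + β n (suc k) ℤ.- + β n k ℤ.+ one k ℤ.+ + (4 ^ k) ℤ.* w e 1
        ≡⟨ cong (λ x → x ℤ.+ one k ℤ.+ + (4 ^ k) ℤ.* w e 1)
             (cong₂ ℤ._-_ (cong₂ (λ x y → + x ℤ.+ + y) (α-pad (suc e) k) (β-pad-suc e k)) (cong +_ (β-pad (suc e) k))) ⟩
      + (2 ^ suc e * τ (suc e) k) ℤ.+ + τ-next e k ℤ.- + τ (suc e) k ℤ.+ one k ℤ.+ + (4 ^ k) ℤ.* w e 1 ∎
      where
      open ≡-Reasoning
      n = pad (suc e) k

    -- The subtracted `τ (suc e) k` stands on the left, so that neighbouring genera can be compared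
    -- without subtraction.
    G-equation : ∀ e k → e ≢ 1 → G (pad (suc e) k) (suc k) + τ (suc e) k ≡
      2 ^ suc e * τ (suc e) k + τ-next e k + unit k + 4 ^ k * ω e
    G-equation e k e≢1 = ℤ.+-injective (begin
      + (G (pad (suc e) k) (suc k)) ℤ.+ t           ≡⟨ cong (ℤ._+ t) (G-pad e k) ⟩
      c ℤ.+ b ℤ.- t ℤ.+ one k ℤ.+ + (4 ^ k) ℤ.* w e 1 ℤ.+ t
        ≡⟨ cong₂ (λ x y → c ℤ.+ b ℤ.- t ℤ.+ x ℤ.+ y ℤ.+ t) (one-unit k)
             (trans (cong (λ x → + (4 ^ k) ℤ.* x) (w-ω e e≢1)) (sym (ℤ.pos-* (4 ^ k) (ω e)))) ⟩
      c ℤ.+ b ℤ.- t ℤ.+ + unit k ℤ.+ + (4 ^ k * ω e) ℤ.+ t ≡⟨ ring c b t (+ unit k) (+ (4 ^ k * ω e)) ⟩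
      c ℤ.+ b ℤ.+ + unit k ℤ.+ + (4 ^ k * ω e) ∎)
      where
      open ≡-Reasoning
      c = + (2 ^ suc e * τ (suc e) k)
      b = + τ-next e k
      t = + τ (suc e) k
      ring : ∀ c b t x y → c ℤ.+ b ℤ.- t ℤ.+ x ℤ.+ y ℤ.+ t ≡ c ℤ.+ b ℤ.+ x ℤ.+ y
      ring = ℤ.solve-∀

    G-equation-1 : ∀ k → G (pad 2 k) (suc k) + τ 2 k + 6 * 4 ^ k ≡ 4 * τ 2 k + τ-next 1 k + unit k
    G-equation-1 k = ℤ.+-injective (begin
      + (G (pad 2 k) (suc k)) ℤ.+ t ℤ.+ + (6 * 4 ^ k)  ≡⟨ cong₂ (λ x y → x ℤ.+ t ℤ.+ y) (G-pad 1 k)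
          (ℤ.pos-* 6 (4 ^ k)) ⟩
      c ℤ.+ b ℤ.- t ℤ.+ one k ℤ.+ p ℤ.* w 1 1 ℤ.+ t ℤ.+ + 6 ℤ.* p  ≡⟨ ring c b t (one k) p ⟩
      c ℤ.+ b ℤ.+ one k                                    ≡⟨ cong (λ x → c ℤ.+ b ℤ.+ x) (one-unit k) ⟩
      c ℤ.+ b ℤ.+ + unit k                                 ∎)
      where
      open ≡-Reasoning
      c = + (4 * τ 2 k)
      b = + τ-next 1 k
      t = + τ 2 k
      p = + (4 ^ k)
      ring : ∀ c b t x p → c ℤ.+ b ℤ.- t ℤ.+ x ℤ.+ p ℤ.* (ℤ.- (+ 6)) ℤ.+ t ℤ.+ + 6 ℤ.* p ≡ c ℤ.+ b ℤ.+ x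
      ring = ℤ.solve-∀

-- Comparison of weighted consecutive coefficients

module Inequalities where

  open PairCounting using (one)
  open ClosedForms using (w)
  open LucasNumbers
  open LucasRatios
  open import Data.Integer.Base using (+_)
  open import Data.Nat.Base using (ℕ; zero; suc; _+_; _*_; _∸_; _^_; _≤_; _<_; z≤n; s≤s)
  open import Data.Nat.Properties
  open import Data.Nat.Tactic.RingSolver using (solve-∀)

  open ≤-Reasoning

  difference : ∀ {m n} → m ≤ n → ∃[ x ] n ≡ m + x
  difference {m} {n} m≤n = n ∸ m , sym (m+[n∸m]≡n m≤n)

  -- With e = 3 + f this is the bound 2e + 5 ≤ `q` that `up-strict` and `down-far` ask for; it would
  -- fail for e = 2.
  linear<exponential : ∀ f → 2 * (3 + f) + 5 ≤ 2 ^ suc (3 + f)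
  linear<exponential zero    = from-yes (11 ≤? 16)
  linear<exponential (suc f) = begin
    2 * (3 + suc f) + 5          ≤⟨ m≤m+n _ (2 * (3 + f) + 3) ⟩
    2 * (3 + suc f) + 5 + (2 * (3 + f) + 3) ≡⟨ ring f ⟩
    2 * (2 * (3 + f) + 5)        ≤⟨ *-monoʳ-≤ 2 (linear<exponential f) ⟩
    2 * 2 ^ suc (3 + f)          ∎
    where
    ring : ∀ f → 2 * (3 + suc f) + 5 + (2 * (3 + f) + 3) ≡ 2 * (2 * (3 + f) + 5)
    ring = solve-∀

  -- Below T₀, T₁, T₂ are consecutive values of τ along k and q = 2 ^ (1 + e).
  module _ (e k q T₀ T₁ : ℕ) (ratio : (k + (2 + e)) * suc k * T₁ ≡ 8 * ((3 + e) * (2 + e)) * T₀) where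

    up-strict : k ≤ suc e → 2 * e + 5 ≤ q → 1 ≤ T₀ → 4 * q * T₀ + 2 * T₁ < q * T₁
    up-strict k≤ q≥ 1≤T₀ with difference q≥
    ... | x , refl = *-cancelˡ-< (2 * e + 3) _ _ (begin-strict
      (2 * e + 3) * (4 * q * T₀ + 2 * T₁)
        -- The coefficient is what remains of 8(3 + e)(q - 2) - 4q(2e + 3) = 12q - 16e - 48 at q =
        -- 2e + 5 + x.
        <⟨ m<m+n _ (*-mono-≤ {1} {8 * e + 12 + 12 * x} (m≤n⇒m≤n+o (12 * x) (m≤n⇒m≤o+n (8 * e) (s≤s z≤n))) 1≤T₀) ⟩
      (2 * e + 3) * (4 * q * T₀ + 2 * T₁) + (8 * e + 12 + 12 * x) * T₀
        ≡⟨ slack e x T₀ T₁ ⟩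
      (2 * e + 3 + x) * (8 * (3 + e) * T₀) + 2 * (2 * e + 3) * T₁
        ≤⟨ +-monoˡ-≤ _ (*-monoʳ-≤ (2 * e + 3 + x) bound) ⟩
      (2 * e + 3 + x) * ((2 * e + 3) * T₁) + 2 * (2 * e + 3) * T₁
        ≡⟨ collect e x T₁ ⟩
      (2 * e + 3) * (q * T₁) ∎)
      where
      bound : 8 * (3 + e) * T₀ ≤ (2 * e + 3) * T₁
      bound = *-cancelˡ-≤ (2 + e) (begin
        (2 + e) * (8 * (3 + e) * T₀)          ≡⟨ regroup e T₀ ⟩
        8 * ((3 + e) * (2 + e)) * T₀          ≡⟨ ratio ⟨
        (k + (2 + e)) * suc k * T₁            ≤⟨ *-monoˡ-≤ T₁ (*-mono-≤ (+-monoˡ-≤ (2 + e) k≤) (s≤s k≤)) ⟩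
        (suc e + (2 + e)) * (2 + e) * T₁      ≡⟨ regroup′ e T₁ ⟩
        (2 + e) * ((2 * e + 3) * T₁)          ∎)
        where
        regroup : ∀ e t → (2 + e) * (8 * (3 + e) * t) ≡ 8 * ((3 + e) * (2 + e)) * t
        regroup = solve-∀
        regroup′ : ∀ e t → (suc e + (2 + e)) * (2 + e) * t ≡ (2 + e) * ((2 * e + 3) * t)
        regroup′ = solve-∀
      slack : ∀ e x s t → (2 * e + 3) * (4 * (2 * e + 5 + x) * s + 2 * t) + (8 * e + 12 + 12 * x) * s ≡
                          (2 * e + 3 + x) * (8 * (3 + e) * s) + 2 * (2 * e + 3) * t
      slack = solve-∀
      collect : ∀ e x t → (2 * e + 3 + x) * ((2 * e + 3) * t) + 2 * (2 * e + 3) * t ≡ (2 * e + 3) *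
          ((2 * e + 5 + x) * t)
      collect = solve-∀

    down-far : 3 + e ≤ k → 2 * e + 5 ≤ q → 1 ≤ T₀ → (q + 2) * T₁ + T₀ < 4 * q * T₀
    down-far k≥ q≥ 1≤T₀ with difference q≥
    ... | x , refl = *-cancelˡ-< ((2 * e + 5) * (e + 4)) _ _ (begin-strict
      (2 * e + 5) * (e + 4) * ((q + 2) * T₁ + T₀)
        ≡⟨ expand e x T₀ T₁ ⟩
      (q + 2) * ((2 * e + 5) * (e + 4) * T₁) + (2 * e + 5) * (e + 4) * T₀
        ≤⟨ +-monoˡ-≤ _ (*-monoʳ-≤ (q + 2) bound) ⟩
      (q + 2) * (8 * ((3 + e) * (2 + e)) * T₀) + (2 * e + 5) * (e + 4) * T₀
        <⟨ m<m+n _ (*-mono-≤ {1} {6 * e * e + 31 * e + 44 + (12 * e + 32) * x}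
             (m≤n⇒m≤n+o ((12 * e + 32) * x) (m≤n⇒m≤o+n (6 * e * e + 31 * e) (s≤s z≤n))) 1≤T₀) ⟩
      (q + 2) * (8 * ((3 + e) * (2 + e)) * T₀) + (2 * e + 5) * (e + 4) * T₀ +
          (6 * e * e + 31 * e + 44 + (12 * e + 32) * x) * T₀
        ≡⟨ slack e x T₀ ⟩
      (2 * e + 5) * (e + 4) * (4 * q * T₀) ∎)
      where
      bound : (2 * e + 5) * (e + 4) * T₁ ≤ 8 * ((3 + e) * (2 + e)) * T₀
      bound = begin
        (2 * e + 5) * (e + 4) * T₁             ≡⟨ regroup e T₁ ⟩
        (3 + e + (2 + e)) * suc (3 + e) * T₁   ≤⟨ *-monoˡ-≤ T₁ (*-mono-≤ (+-monoˡ-≤ (2 + e) k≥) (s≤s k≥)) ⟩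
        (k + (2 + e)) * suc k * T₁             ≡⟨ ratio ⟩
        8 * ((3 + e) * (2 + e)) * T₀           ∎
        where
        regroup : ∀ e t → (2 * e + 5) * (e + 4) * t ≡ (3 + e + (2 + e)) * suc (3 + e) * t
        regroup = solve-∀
      expand : ∀ e x s t → (2 * e + 5) * (e + 4) * ((2 * e + 5 + x + 2) * t + s) ≡
                           (2 * e + 5 + x + 2) * ((2 * e + 5) * (e + 4) * t) + (2 * e + 5) * (e + 4) * s
      expand = solve-∀
      slack : ∀ e x s → (2 * e + 5 + x + 2) * (8 * ((3 + e) * (2 + e)) * s) + (2 * e + 5) * (e + 4) * s +
                          (6 * e * e + 31 * e + 44 + (12 * e + 32) * x) * s ≡
                        (2 * e + 5) * (e + 4) * (4 * (2 * e + 5 + x) * s)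
      slack = solve-∀

  -- The comparison is an equality at T₁ when n = 3k + 1, and is decided by T₂.
  up-equal : ∀ f q T₀ T₁ T₂ → let e = 5 + f ; k = 2 + e in
    (k + (2 + e)) * suc k * T₁ ≡ 8 * ((3 + e) * (2 + e)) * T₀ →
    (suc k + e) * suc (suc k) * T₂ ≡ 8 * (suc e * e) * T₁ →
    4 * q * T₀ + 2 * T₁ ≤ q * T₁ + T₂
  up-equal f q T₀ T₁ T₂ ratio₀ ratio₁ = +-mono-≤ (≤-reflexive (trans (swap q T₀) (cong (q *_) (sym T₁≡4T₀)))) 2T₁≤T₂
    where
    e = 5 + f
    k = 2 + e
    swap : ∀ q t → 4 * q * t ≡ q * (4 * t)
    swap = solve-∀
    T₁≡4T₀ : T₁ ≡ 4 * T₀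
    T₁≡4T₀ = *-cancelˡ-≡ T₁ (4 * T₀) ((k + (2 + e)) * suc k) (trans ratio₀ (ring f T₀))
      where
      ring : ∀ f t → 8 * ((3 + (5 + f)) * (2 + (5 + f))) * t ≡ (2 + (5 + f) + (2 + (5 + f))) * suc (2 + (5 + f)) *
          (4 * t)
      ring = solve-∀
    -- The coefficients differ by 8e(e + 1) - 2(2e + 3)(e + 4) = 4e² - 14e - 24, which is positive
    -- from e = 5 on; hence e = 5 + f.
    2T₁≤T₂ : 2 * T₁ ≤ T₂
    2T₁≤T₂ = *-cancelˡ-≤ ((suc k + e) * suc (suc k)) (begin
      (suc k + e) * suc (suc k) * (2 * T₁)                            ≤⟨ m≤m+n _ ((4 * f * f + 26 * f + 6) * T₁) ⟩
      (suc k + e) * suc (suc k) * (2 * T₁) + (4 * f * f + 26 * f + 6) * T₁ ≡⟨ ring f T₁ ⟩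
      8 * (suc e * e) * T₁                                            ≡⟨ ratio₁ ⟨
      (suc k + e) * suc (suc k) * T₂                                  ∎)
      where
      ring : ∀ f t → (suc (2 + (5 + f)) + (5 + f)) * suc (suc (2 + (5 + f))) * (2 * t) + (4 * f * f + 26 * f + 6) * t ≡
                     8 * (suc (5 + f) * (5 + f)) * t
      ring = solve-∀

  -- `G₀` is known up to `T₀` and `G₁` up to `T₁`, so both are added before comparing. The factor 2
  -- * (2 * q) is what 2 ^ (3 + e) reduces to.
  up-combine : ∀ {G₀ G₁ T₀ T₁ T₂ q o} →
    G₀ + T₀ ≡ 2 * (2 * q) * T₀ + T₁ + o → G₁ + T₁ ≡ q * T₁ + T₂ →
    4 * q * T₀ + 2 * T₁ + o < q * T₁ + T₂ + T₀ → G₀ < G₁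
  up-combine {G₀} {G₁} {T₀} {T₁} {T₂} {q} {o} e₀ e₁ h = +-cancelʳ-< (T₀ + T₁) G₀ G₁ (begin-strict
    G₀ + (T₀ + T₁)                        ≡⟨ +-assoc G₀ T₀ T₁ ⟨
    G₀ + T₀ + T₁                          ≡⟨ cong (_+ T₁) e₀ ⟩
    2 * (2 * q) * T₀ + T₁ + o + T₁        ≡⟨ ring q T₀ T₁ o ⟩
    4 * q * T₀ + 2 * T₁ + o               <⟨ h ⟩
    q * T₁ + T₂ + T₀                      ≡⟨ cong (_+ T₀) e₁ ⟨
    G₁ + T₁ + T₀                          ≡⟨ ring′ G₁ T₀ T₁ ⟩
    G₁ + (T₀ + T₁)                        ∎)
    where
    ring : ∀ q s t o → 2 * (2 * q) * s + t + o + t ≡ 4 * q * s + 2 * t + o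
    ring = solve-∀
    ring′ : ∀ g s t → g + t + s ≡ g + (s + t)
    ring′ = solve-∀

  down-combine : ∀ {G₀ G₁ T₀ T₁ T₂ q o} →
    2 * (2 * q) * T₀ + T₁ ≤ G₀ + T₀ → G₁ + T₁ ≤ q * T₁ + T₂ + o →
    q * T₁ + T₂ + o + T₀ < 4 * q * T₀ + 2 * T₁ → G₁ < G₀
  down-combine {G₀} {G₁} {T₀} {T₁} {T₂} {q} {o} e₀ e₁ h = +-cancelʳ-< (T₀ + T₁) G₁ G₀ (begin-strict
    G₁ + (T₀ + T₁)                        ≡⟨ ring′ G₁ T₀ T₁ ⟨
    G₁ + T₁ + T₀                          ≤⟨ +-monoˡ-≤ T₀ e₁ ⟩
    q * T₁ + T₂ + o + T₀                  <⟨ h ⟩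
    4 * q * T₀ + 2 * T₁                   ≡⟨ ring q T₀ T₁ ⟨
    2 * (2 * q) * T₀ + T₁ + T₁            ≤⟨ +-monoˡ-≤ T₁ e₀ ⟩
    G₀ + T₀ + T₁                          ≡⟨ +-assoc G₀ T₀ T₁ ⟩
    G₀ + (T₀ + T₁)                        ∎)
    where
    ring : ∀ q s t → 2 * (2 * q) * s + t + t ≡ 4 * q * s + 2 * t
    ring = solve-∀
    ring′ : ∀ g s t → g + t + s ≡ g + (s + t)
    ring′ = solve-∀

-- Rise, fall, positivity and vanishing of the distribution

module PeakSteps where

  open PairCounting using (one)
  open ClosedForms using (w)
  open LucasNumbers
  open LucasRatios
  open Inequalities
  open import Data.Integer.Base as ℤ using (ℤ; +_)
  import Data.Integer.Properties as ℤ
  import Data.Integer.Tactic.RingSolver as ℤ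
  open import Data.Nat.Base using (ℕ; zero; suc; _+_; _*_; _^_; _≤_; _<_; z≤n; s≤s; NonZero; >-nonZero)
  open import Data.Nat.Properties
  open import Data.Nat.Tactic.RingSolver using (solve-∀)

  open ≤-Reasoning

  ratio-≤ : ∀ d x c s t .{{_ : NonZero d}} → d * t ≡ x * s → x ≤ d * c → t ≤ c * s
  ratio-≤ d x c s t e x≤ = *-cancelˡ-≤ d (begin
    d * t        ≡⟨ e ⟩
    x * s        ≤⟨ *-monoˡ-≤ s x≤ ⟩
    d * c * s    ≡⟨ *-assoc d c s ⟩
    d * (c * s)  ∎)

  1≤τ : ∀ d k → 1 ≤ τ d k
  1≤τ d k = ≤-trans (m^n>0 8 k) (8^≤τ d k)

  -- 2^k reaches 32 at k = 5. This bounds the contribution of `w` to `falling`, which is at most 8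
  -- times 4^(k + 1).
  32*4^k≤8^k : ∀ j → 32 * 4 ^ (5 + j) ≤ 8 ^ (5 + j)
  32*4^k≤8^k zero    = from-yes (32 * 4 ^ 5 ≤? 8 ^ 5)
  32*4^k≤8^k (suc j) = begin
    32 * (4 * 4 ^ (5 + j))  ≡⟨ ring (4 ^ (5 + j)) ⟩
    4 * (32 * 4 ^ (5 + j))  ≤⟨ *-mono-≤ (from-yes (4 ≤? 8)) (32*4^k≤8^k j) ⟩
    8 * 8 ^ (5 + j)         ∎
    where
    ring : ∀ x → 32 * (4 * x) ≡ 4 * (32 * x)
    ring = solve-∀

  ω≤8 : ∀ e → ω e ≤ 8
  ω≤8 0 = z≤n
  ω≤8 1 = z≤n
  ω≤8 2 = ≤-refl
  ω≤8 3 = ≤-refl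
  ω≤8 (suc (suc (suc (suc e)))) = z≤n

  unit≤1 : ∀ k → unit k ≤ 1
  unit≤1 zero    = ≤-refl
  unit≤1 (suc k) = z≤n

  module _ (G : ℕ → ℕ → ℕ)
    (G-suc : ∀ m k → + G (suc m) (suc k) ≡ + α (suc m) k ℤ.+ + β (suc m) (suc k) ℤ.- + β (suc m) k ℤ.+ one k ℤ.+ w
        m (suc k)) where

    private
      pad-shift : ∀ e k → pad (3 + e) k ≡ pad (suc e) (suc k)
      pad-shift e k = trans (pad-suc (2 + e) k) (cong suc (pad-suc (suc e) k))

    G-lower : ∀ e k → e ≢ 1 → 2 ^ suc e * τ (suc e) k + τ-next e k ≤ G (pad (suc e) k) (suc k) + τ (suc e) k
    G-lower e k e≢1 = begin
      2 ^ suc e * τ (suc e) k + τ-next e k                          ≤⟨ m≤m+n _ (unit k + 4 ^ k * ω e) ⟩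
      2 ^ suc e * τ (suc e) k + τ-next e k + (unit k + 4 ^ k * ω e) ≡⟨ +-assoc
          (2 ^ suc e * τ (suc e) k + τ-next e k) (unit k) (4 ^ k * ω e) ⟨
      2 ^ suc e * τ (suc e) k + τ-next e k + unit k + 4 ^ k * ω e   ≡⟨ G-equation G G-suc e k e≢1 ⟨
      G (pad (suc e) k) (suc k) + τ (suc e) k                       ∎

    -- For `e` = 1 the term coming from `w` is negative while `ω 1` is 0, so the equation weakens to
    -- an upper bound.
    G-upper : ∀ e k → G (pad (suc e) k) (suc k) + τ (suc e) k ≤
                      2 ^ suc e * τ (suc e) k + τ-next e k + unit k + 4 ^ k * ω e
    G-upper e k with e ≟ 1
    ... | no e≢1  = ≤-reflexive (G-equation G G-suc e k e≢1)
    ... | yes refl = begin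
      G (pad 2 k) (suc k) + τ 2 k                     ≤⟨ m≤m+n _ (6 * 4 ^ k) ⟩
      G (pad 2 k) (suc k) + τ 2 k + 6 * 4 ^ k         ≡⟨ G-equation-1 G G-suc k ⟩
      4 * τ 2 k + τ-next 1 k + unit k                 ≤⟨ m≤m+n _ (4 ^ k * 0) ⟩
      4 * τ 2 k + τ-next 1 k + unit k + 4 ^ k * 0     ∎

    -- The bound on `k` is 3k + 1 ≤ n. Below it the leading terms decide, and at equality `up-equal`
    -- does; `w` contributes nothing for these `e`.
    rising : ∀ f k → let n = pad (8 + f) k in k ≤ 7 + f → G n (suc k) < G n (suc (suc k))
    rising f k k≤ = up-combine {q = 2 ^ suc e} {o = unit k} eq₀ eq₁ (compare (m≤n⇒m<n∨m≡n k≤))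
      where
      e = 5 + f
      T₀ = τ (3 + e) k
      T₁ = τ (suc e) (suc k)
      T₂ = τ-next e (suc k)
      eq₀ : G (pad (3 + e) k) (suc k) + T₀ ≡ 2 ^ (3 + e) * T₀ + T₁ + unit k
      eq₀ = trans (G-equation G G-suc (2 + e) k λ ()) (trans
          (cong (λ x → 2 ^ (3 + e) * T₀ + T₁ + unit k + x) (*-zeroʳ (4 ^ k))) (+-identityʳ _))
      eq₁ : G (pad (3 + e) k) (suc (suc k)) + T₁ ≡ 2 ^ suc e * T₁ + T₂
      eq₁ = trans (cong (λ n → G n (suc (suc k)) + T₁) (pad-shift e k)) (trans (G-equation G G-suc e (suc k) λ ())
        (trans (cong (λ x → 2 ^ suc e * T₁ + T₂ + 0 + x) (*-zeroʳ (4 ^ suc k)))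
            (trans (+-identityʳ _) (+-identityʳ _))))
      compare : _ → 4 * 2 ^ suc e * T₀ + 2 * T₁ + unit k < 2 ^ suc e * T₁ + T₂ + T₀
      compare (inj₁ (s≤s k≤)) = begin-strict
        4 * 2 ^ suc e * T₀ + 2 * T₁ + unit k
          <⟨ +-mono-<-≤ (up-strict e k (2 ^ suc e) T₀ T₁ (τ-ratio (2 + e) k) k≤ (linear<exponential (2 + f))
              (1≤τ (3 + e) k))
                        (≤-trans (unit≤1 k) (1≤τ (3 + e) k)) ⟩
        2 ^ suc e * T₁ + T₀                   ≤⟨ +-monoˡ-≤ T₀ (m≤m+n (2 ^ suc e * T₁) T₂) ⟩
        2 ^ suc e * T₁ + T₂ + T₀              ∎
      -- Here n = 3k + 1, `unit k` is 0, and strictness comes from `T₀` alone.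
      compare (inj₂ refl) = +-mono-≤-< (up-equal f (2 ^ suc e) T₀ T₁ T₂ (τ-ratio (2 + e) k) (τ-ratio e (suc k)))
          (1≤τ (3 + e) k)

    -- 3 + `e` ≤ `k` means n ≤ 3k. For `e` ≥ 4 the leading terms decide and `ω e` is 0. For `e` ≤ 3,
    -- at the last genera, `q` may be too small for `down-far` and `w` may contribute, but there n ≥
    -- 50 makes `k` so large that the ratios are at most 2.
    falling : ∀ e k → let n = pad (3 + e) k in 3 + e ≤ k → 50 ≤ n → G n (suc (suc k)) < G n (suc k)
    falling e k k≥ n≥ = down-combine {T₂ = T₂} {q = q} {o = o} (G-lower (2 + e) k λ ()) upper (compare (3 <? e))
      where
      q = 2 ^ suc e
      T₀ = τ (3 + e) k
      T₁ = τ (suc e) (suc k)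
      T₂ = τ-next e (suc k)
      o = 4 ^ suc k * ω e
      upper : G (pad (3 + e) k) (suc (suc k)) + T₁ ≤ q * T₁ + T₂ + o
      upper = subst₂ _≤_ (cong (λ n → G n (suc (suc k)) + T₁) (sym (pad-shift e k)))
          (cong (_+ o) (+-identityʳ (q * T₁ + T₂))) (G-upper e (suc k))
      far : ∀ f → e ≡ 4 + f → q * T₁ + T₂ + o + T₀ < 4 * q * T₀ + 2 * T₁
      far f refl = begin-strict
        q * T₁ + T₂ + 4 ^ suc k * 0 + T₀  ≡⟨ cong (λ x → q * T₁ + T₂ + x + T₀) (*-zeroʳ (4 ^ suc k)) ⟩
        q * T₁ + T₂ + 0 + T₀              ≤⟨ +-monoˡ-≤ T₀ (+-monoˡ-≤ 0 (+-monoʳ-≤ (q * T₁) T₂≤4T₁)) ⟩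
        q * T₁ + 4 * T₁ + 0 + T₀          ≡⟨ ring q T₀ T₁ ⟩
        (q + 2) * T₁ + T₀ + 2 * T₁        <⟨ +-monoˡ-< (2 * T₁)
            (down-far e k q T₀ T₁ (τ-ratio (2 + e) k) k≥ (linear<exponential (suc f)) (1≤τ (3 + e) k)) ⟩
        4 * q * T₀ + 2 * T₁               ∎
        where
        ring : ∀ q s t → q * t + 4 * t + 0 + s ≡ (q + 2) * t + s + 2 * t
        ring = solve-∀
        T₂≤4T₁ : T₂ ≤ 4 * T₁
        T₂≤4T₁ = ratio-≤ ((suc k + e) * suc (suc k)) (8 * (suc e * e)) 4 T₁ T₂ (τ-ratio e (suc k)) (begin
          8 * (suc e * e)                              ≡⟨ ring′ e ⟩
          (suc e + suc e) * e * 4                      ≤⟨ *-monoˡ-≤ 4 (*-mono-≤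
                                                            (≤-trans (≤-reflexive (+-suc (suc e) e))
                                                                (+-monoˡ-≤ e (s≤s (≤-trans (n≤1+n (suc e))
                                                                    (≤-trans (n≤1+n (2 + e)) k≥)))))
                                                            (≤-trans (m≤n+m e 3) (≤-trans k≥ (m≤n+m k 2)))) ⟩
          (suc k + e) * suc (suc k) * 4                ∎)
          where
          ring′ : ∀ e → 8 * (suc e * e) ≡ (suc e + suc e) * e * 4
          ring′ = solve-∀
      near : e ≤ 3 → q * T₁ + T₂ + o + T₀ < 4 * q * T₀ + 2 * T₁
      near e≤3 = begin-strict
        q * T₁ + T₂ + o + T₀                  ≤⟨ +-monoˡ-≤ T₀ (+-mono-≤ (+-mono-≤ (*-monoʳ-≤ q T₁≤2T₀) T₂≤2T₁) o≤T₀) ⟩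
        q * (2 * T₀) + 2 * T₁ + T₀ + T₀       <⟨ m<m+n (q * (2 * T₀) + 2 * T₁ + T₀ + T₀) (1≤τ (3 + e) k) ⟩
        q * (2 * T₀) + 2 * T₁ + T₀ + T₀ + T₀  ≤⟨ m≤m+n _ T₀ ⟩
        q * (2 * T₀) + 2 * T₁ + T₀ + T₀ + T₀ + T₀ ≡⟨ ring q T₀ T₁ ⟩
        q * (2 * T₀) + 2 * (2 * T₀) + 2 * T₁  ≤⟨ +-monoˡ-≤ (2 * T₁)
            (+-monoʳ-≤ (q * (2 * T₀)) (*-monoˡ-≤ (2 * T₀) (*-monoʳ-≤ 2 (m^n>0 2 e)))) ⟩
        q * (2 * T₀) + q * (2 * T₀) + 2 * T₁  ≡⟨ ring′ q T₀ T₁ ⟩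
        4 * q * T₀ + 2 * T₁                   ∎
        where
        ring : ∀ q s t → q * (2 * s) + 2 * t + s + s + s + s ≡ q * (2 * s) + 2 * (2 * s) + 2 * t
        ring = solve-∀
        ring′ : ∀ q s t → q * (2 * s) + q * (2 * s) + 2 * t ≡ 4 * q * s + 2 * t
        ring′ = solve-∀
        -- From 50 ≤ n = 3 + e + 2k and e ≤ 3.
        22≤k : 22 ≤ k
        22≤k = ≮⇒≥ λ k<22 → <⇒≱ (s≤s (≤-trans (≤-reflexive (pad-+ (3 + e) k))
          (+-mono-≤ (+-monoʳ-≤ 3 e≤3) (+-mono-≤ (≤-pred k<22) (≤-pred k<22))))) (≤-trans (from-yes (49 ≤? 50)) n≥)
        -- For k ≥ 22 the left factors in `τ-ratio` multiply to at least 24 times 23 = 552, and for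
        -- e ≤ 3 the right ones to at most 8 times 6 times 5 = 240.
        large : ∀ x → 552 ≤ x → ∀ {y} → y ≤ 240 → y ≤ x * 2
        large x x≥ y≤ = ≤-trans y≤ (≤-trans (from-yes (240 ≤? 552)) (≤-trans x≥ (m≤m*n x 2)))
        T₁≤2T₀ : T₁ ≤ 2 * T₀
        T₁≤2T₀ = ratio-≤ ((k + (2 + e)) * suc k) (8 * ((3 + e) * (2 + e))) 2 T₀ T₁
            {{m*n≢0 (k + (2 + e)) (suc k) {{k+2+e≢0}}}} (τ-ratio (2 + e) k)
          (large _ (*-mono-≤ {24} {k + (2 + e)} {23} {suc k} (+-mono-≤ 22≤k (m≤m+n 2 e)) (s≤s 22≤k))
              (*-monoʳ-≤ 8 (*-mono-≤ (+-monoʳ-≤ 3 e≤3) (+-monoʳ-≤ 2 e≤3))))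
          where
          k+2+e≢0 : NonZero (k + (2 + e))
          k+2+e≢0 = >-nonZero (≤-trans (s≤s z≤n) (m≤n+m (2 + e) k))
        T₂≤2T₁ : T₂ ≤ 2 * T₁
        T₂≤2T₁ = ratio-≤ ((suc k + e) * suc (suc k)) (8 * (suc e * e)) 2 T₁ T₂ (τ-ratio e (suc k))
          (large _ (*-mono-≤ {23} {suc k + e} {24} {suc (suc k)} (≤-trans (s≤s 22≤k) (m≤m+n (suc k) e))
              (s≤s (s≤s 22≤k)))
                   (≤-trans (*-monoʳ-≤ 8 (*-mono-≤ (s≤s e≤3) e≤3)) (from-yes (96 ≤? 240))))
        o≤T₀ : o ≤ T₀
        o≤T₀ with difference (≤-trans (from-yes (5 ≤? 22)) 22≤k)
        ... | j , refl = begin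
          4 ^ suc k * ω e    ≤⟨ *-monoʳ-≤ (4 ^ suc k) (ω≤8 e) ⟩
          4 ^ suc k * 8      ≡⟨ ring″ (4 ^ k) ⟩
          32 * 4 ^ k         ≤⟨ 32*4^k≤8^k j ⟩
          8 ^ k              ≤⟨ 8^≤τ (3 + e) k ⟩
          T₀                 ∎
          where
          ring″ : ∀ x → 4 * x * 8 ≡ 32 * x
          ring″ = solve-∀
      compare : _ → q * T₁ + T₂ + o + T₀ < 4 * q * T₀ + 2 * T₁
      compare (yes e≥4) = let f , e≡ = difference e≥4 in far f e≡
      compare (no e≱4)  = near (≮⇒≥ e≱4)

    positive : ∀ e k → e ≢ 1 → 1 ≤ G (pad (suc e) k) (suc k)
    positive e k e≢1 = +-cancelʳ-≤ (τ (suc e) k) 1 _ (begin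
      1 + τ (suc e) k                            ≤⟨ +-monoˡ-≤ (τ (suc e) k) (1≤τ (suc e) k) ⟩
      τ (suc e) k + τ (suc e) k                  ≡⟨ cong (λ x → τ (suc e) k + x) (+-identityʳ (τ (suc e) k)) ⟨
      2 * τ (suc e) k                            ≤⟨ *-monoˡ-≤ (τ (suc e) k) (*-monoʳ-≤ 2 (m^n>0 2 e)) ⟩
      2 ^ suc e * τ (suc e) k                    ≤⟨ m≤m+n _ (τ-next e k) ⟩
      2 ^ suc e * τ (suc e) k + τ-next e k       ≤⟨ G-lower e k e≢1 ⟩
      G (pad (suc e) k) (suc k) + τ (suc e) k    ∎)

    -- For `e` = 1 the negative term 6 times 4^k is outweighed by 2`τ`, since `τ` is at least 8^k,
    -- as soon as 2^k ≥ 3; hence k = 2 + j.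
    positive-1 : ∀ j → let k = 2 + j in 1 ≤ G (pad 2 k) (suc k)
    positive-1 j = +-cancelʳ-≤ (τ 2 k + 6 * 4 ^ k) 1 _ (begin
      1 + (τ 2 k + 6 * 4 ^ k)                        ≡⟨ +-assoc 1 (τ 2 k) _ ⟨
      suc (τ 2 k) + 6 * 4 ^ k                        ≤⟨ +-mono-≤ (+-monoˡ-≤ (τ 2 k) (1≤τ 2 k))
          (≤-trans (bound j) (*-monoʳ-≤ 2 (8^≤τ 2 k))) ⟩
      τ 2 k + τ 2 k + 2 * τ 2 k                      ≡⟨ ring (τ 2 k) ⟩
      4 * τ 2 k                                      ≤⟨ m≤m+n _ (τ-next 1 k) ⟩
      4 * τ 2 k + τ-next 1 k                         ≤⟨ m≤m+n _ (unit k) ⟩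
      4 * τ 2 k + τ-next 1 k + unit k                ≡⟨ G-equation-1 G G-suc k ⟨
      G (pad 2 k) (suc k) + τ 2 k + 6 * 4 ^ k        ≡⟨ +-assoc (G (pad 2 k) (suc k)) (τ 2 k) _ ⟩
      G (pad 2 k) (suc k) + (τ 2 k + 6 * 4 ^ k)      ∎)
      where
      k = 2 + j
      ring : ∀ t → t + t + 2 * t ≡ 4 * t
      ring = solve-∀
      bound : ∀ j → 6 * 4 ^ (2 + j) ≤ 2 * 8 ^ (2 + j)
      bound zero    = from-yes (6 * 4 ^ 2 ≤? 2 * 8 ^ 2)
      bound (suc j) = begin
        6 * (4 * 4 ^ (2 + j))  ≡⟨ ring′ (4 ^ (2 + j)) ⟩
        4 * (6 * 4 ^ (2 + j))  ≤⟨ *-mono-≤ (from-yes (4 ≤? 8)) (bound j) ⟩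
        8 * (2 * 8 ^ (2 + j))  ≡⟨ ring″ (8 ^ (2 + j)) ⟩
        2 * (8 * 8 ^ (2 + j))  ∎
        where
        ring′ : ∀ x → 6 * (4 * x) ≡ 4 * (6 * x)
        ring′ = solve-∀
        ring″ : ∀ x → 8 * (2 * x) ≡ 2 * (8 * x)
        ring″ = solve-∀

    w-above : ∀ m i → suc m < i + i → w m i ≡ + 0
    w-above 0             (suc i)             h = refl
    w-above 1             1                   (s≤s (s≤s ()))
    w-above 1             (suc (suc i))       h = refl
    w-above (suc (suc m)) (suc i)             h = cong (+ 4 ℤ.*_)
      (w-above m i (≤-pred (≤-pred (subst (suc (suc (suc (suc m))) ≤_) (cong suc (+-suc i i)) h))))

    -- For n < 2k all terms vanish. For n = 2k the coefficients of `α` and `β` are both 2 times 8^k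
    -- and cancel, which is why even n stops at genus n/2.
    G-above : ∀ m k → suc m ≤ k + k → G (suc m) (suc k) ≡ 0
    G-above m (suc k) n≤ = ℤ.+-injective (trans (G-suc m (suc k)) (trans
      (cong₂ (λ x y → + α (suc m) (suc k) ℤ.+ + x ℤ.- + β (suc m) (suc k) ℤ.+ + 0 ℤ.+ y) β-next
             (w-above m (suc (suc k)) (s≤s (≤-trans n≤ (≤-trans (n≤1+n _)
                 (≤-reflexive (sym (+-suc (suc k) (suc k)))))))))
      (trans (cong (λ x → + x ℤ.+ + 0 ℤ.- + β (suc m) (suc k) ℤ.+ + 0 ℤ.+ + 0) (αβ (m≤n⇒m<n∨m≡n n≤)))
          (ring (+ β (suc m) (suc k))))))
      where
      ring : ∀ x → x ℤ.+ + 0 ℤ.- x ℤ.+ + 0 ℤ.+ + 0 ≡ + 0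
      ring = ℤ.solve-∀
      β-next : β (suc m) (suc (suc k)) ≡ 0
      β-next = trans (cong (8 ^ suc (suc k) *_) (lucas-above (suc m) (suc (suc k))
        (s≤s (≤-trans n≤ (≤-trans (n≤1+n _) (≤-reflexive (sym (+-suc (suc k) (suc k))))))))) (*-zeroʳ (8 ^ suc (suc k)))
      αβ : _ → α (suc m) (suc k) ≡ β (suc m) (suc k)
      αβ (inj₁ n<) rewrite lucas-above (suc m) (suc k) n< = trans (*-zeroʳ (2 ^ (suc m + suc k)))
          (sym (*-zeroʳ (8 ^ suc k)))
      αβ (inj₂ n≡) = subst (λ n → α n (suc k) ≡ β n (suc k)) (sym (trans n≡ (sym (pad-+ 0 (suc k)))))
        (trans (α-pad 0 (suc k)) (trans (*-identityˡ (τ 0 (suc k))) (sym (β-pad 0 (suc k)))))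

-- Location of the peak

module PeakShape where

  open LadderGenus
  open PairCounting using (one)
  open ClosedForms using (w)
  open LucasNumbers
  open SmallCases
  open LucasRatios
  open Inequalities
  open PeakSteps
  open import Data.Integer.Base as ℤ using (ℤ; +_)
  import Data.Integer.Properties as ℤ
  open import Data.Nat.Base using (ℕ; zero; suc; _+_; _*_; _≤_; _<_; s≤s; NonZero; _≤ᵇ_)
  open import Data.Nat.DivMod using (_/_; _%_; /-monoˡ-≤; m*n/n≡m; m/n*n≤m; m≡m%n+[m/n]*n; m%n<n)
  open import Data.Nat.Properties
  open import Data.Nat.Tactic.RingSolver using (solve-∀)

  open ≤-Reasoning

  *≤⇒≤/ : ∀ m n d .{{_ : NonZero d}} → m * d ≤ n → m ≤ n / d
  *≤⇒≤/ m n d h = subst (_≤ n / d) (m*n/n≡m m d) (/-monoˡ-≤ d h)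

  ≤/⇒*≤ : ∀ m n d .{{_ : NonZero d}} → m ≤ n / d → m * d ≤ n
  ≤/⇒*≤ m n d h = ≤-trans (*-monoˡ-≤ d h) (m/n*n≤m n d)

  /≤⇒<* : ∀ m n d .{{_ : NonZero d}} → n / d ≤ m → n < suc m * d
  /≤⇒<* m n d h = ≰⇒> λ h′ → <⇒≱ (s≤s h) (*≤⇒≤/ (suc m) n d h′)

  ≤ᵇ-false : ∀ {m n} → n < m → (m ≤ᵇ n) ≡ false
  ≤ᵇ-false {m} {n} n<m with m ≤ᵇ n | ≤ᵇ⇒≤ m n
  ... | true  | h = contradiction (h _) (<⇒≱ n<m)
  ... | false | _ = refl

  p₅-large : ∀ {n} → 17 ≤ n → p₅ n ≡ (n + 2) / 3 + 1
  p₅-large {n} n≥ rewrite ≤ᵇ-false {n} {5} (≤-trans (m≤m+n 6 11) n≥) | ≤ᵇ-false {n} {16} n≥ = refl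

  q₅-large : ∀ {n} → 3 ≤ n → q₅ n ≡ 1
  q₅-large {n} n≥ rewrite ≤ᵇ-false {n} {2} n≥ = refl

  module _ (G : ℕ → ℕ → ℕ)
    (G-zero : ∀ m → + G (suc m) 0 ≡ w m 0)
    (G-suc : ∀ m k → + G (suc m) (suc k) ≡ + α (suc m) k ℤ.+ + β (suc m) (suc k) ℤ.- + β (suc m) k ℤ.+ one k ℤ.+ w
        m (suc k)) where

    private
      as-pad : ∀ {n} d k → d + (k + k) ≤ n → ∃[ f ] n ≡ pad (d + f) k
      as-pad d k h with difference h
      ... | f , refl = f , trans (ring d f k) (sym (pad-+ (d + f) k))
        where
        ring : ∀ d f k → d + (k + k) + f ≡ d + f + (k + k)
        ring = solve-∀

    rising-large : ∀ {n i} → 50 ≤ n → i < (n + 2) / 3 + 1 → 1 ≤ i → G n i < G n (suc i)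
    rising-large {n} {suc k} n≥ i< _ with as-pad {n} 8 k 8+2k≤n
      where
      3k+3≤n+2 : suc k * 3 ≤ n + 2
      3k+3≤n+2 = ≤/⇒*≤ (suc k) (n + 2) 3 (≤-pred (subst (suc (suc k) ≤_) (+-comm _ 1) i<))
      -- Otherwise n ≤ 7 + 2k, and together with 3k + 1 ≤ n this gives k ≤ 6 and n ≤ 19.
      8+2k≤n : 8 + (k + k) ≤ n
      8+2k≤n = ≮⇒≥ λ n< → <⇒≱ (from-yes (19 <? 50)) (≤-trans n≥ (≤-trans (≤-pred n<) (+-monoʳ-≤ 7
        (let k≤6 = +-cancelʳ-≤ (k + k + 3) k 6 (begin
               k + (k + k + 3)    ≡⟨ ring k ⟩
               suc k * 3          ≤⟨ 3k+3≤n+2 ⟩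
               n + 2              ≤⟨ +-monoˡ-≤ 2 (≤-pred n<) ⟩
               7 + (k + k) + 2    ≡⟨ ring′ k ⟩
               6 + (k + k + 3)    ∎) in +-mono-≤ k≤6 k≤6))))
        where
        ring : ∀ k → k + (k + k + 3) ≡ suc k * 3
        ring = solve-∀
        ring′ : ∀ k → 7 + (k + k) + 2 ≡ 6 + (k + k + 3)
        ring′ = solve-∀
    ... | f , refl = rising G G-suc f k (+-cancelʳ-≤ (k + k + 3) k (7 + f) (begin
      k + (k + k + 3)            ≡⟨ ring k ⟩
      suc k * 3                  ≤⟨ ≤/⇒*≤ (suc k) (pad (8 + f) k + 2) 3
          (≤-pred (subst (suc (suc k) ≤_) (+-comm _ 1) i<)) ⟩
      pad (8 + f) k + 2          ≡⟨ cong (_+ 2) (pad-+ (8 + f) k) ⟩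
      8 + f + (k + k) + 2        ≡⟨ ring′ f k ⟩
      7 + f + (k + k + 3)        ∎))
      where
      ring : ∀ k → k + (k + k + 3) ≡ suc k * 3
      ring = solve-∀
      ring′ : ∀ f k → 8 + f + (k + k) + 2 ≡ 7 + f + (k + k + 3)
      ring′ = solve-∀

    -- For i = k + 1 the bounds on i say n + 2 < 3k + 3, which is the hypothesis of `falling`, and 3
    -- + 2k ≤ n, which lets n be written as a `pad`.
    falling-large : ∀ {n i} → 50 ≤ n → i < r₅ n → (n + 2) / 3 + 1 ≤ i → G n (suc i) < G n i
    falling-large {n} {zero}  n≥ i< p≤ = contradiction (≤-trans (m≤n+m 1 ((n + 2) / 3)) p≤) λ ()
    falling-large {n} {suc k} n≥ i< p≤ with as-pad {n} 3 k (+-cancelʳ-≤ 1 _ _ (begin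
      3 + (k + k) + 1          ≡⟨ ring k ⟩
      suc (suc k) * 2          ≤⟨ ≤/⇒*≤ (suc (suc k)) (n + 1) 2 i< ⟩
      n + 1                    ∎))
      where
      ring : ∀ k → 3 + (k + k) + 1 ≡ suc (suc k) * 2
      ring = solve-∀
    ... | e , refl = falling G G-suc e k (+-cancelʳ-≤ (k + k + 3) (3 + e) k (begin
      3 + e + (k + k + 3)      ≡⟨ ring e k ⟩
      suc (3 + e + (k + k) + 2) ≡⟨ cong (λ m → suc (m + 2)) (pad-+ (3 + e) k) ⟨
      suc (pad (3 + e) k + 2)  ≤⟨ /≤⇒<* k (pad (3 + e) k + 2) 3
          (+-cancelʳ-≤ 1 _ _ (subst ((pad (3 + e) k + 2) / 3 + 1 ≤_) (+-comm 1 k) p≤)) ⟩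
      suc k * 3                ≡⟨ ring′ k ⟩
      k + (k + k + 3)          ∎)) n≥
      where
      ring : ∀ e k → 3 + e + (k + k + 3) ≡ suc (3 + e + (k + k) + 2)
      ring = solve-∀
      ring′ : ∀ k → suc k * 3 ≡ k + (k + k + 3)
      ring′ = solve-∀

    positive-min : ∀ {n} → 50 ≤ n → 1 ≤ G n 1
    positive-min {suc m} n≥ = positive G G-suc m 0 λ { refl → <⇒≱ (from-yes (2 <? 50)) n≥ }

    -- The last genus k + 1 belongs either to n = 2k + 1, where `e` = 0, or to n = 2k + 2, where `e`
    -- = 1 and `positive-1` asks for k ≥ 2; the remaining clauses contradict n ≥ 50.
    positive-max : ∀ {n} → 50 ≤ n → 1 ≤ G n (r₅ n)
    positive-max {n} n≥ with (n + 1) / 2 | (n + 1) % 2 | m≡m%n+[m/n]*n (n + 1) 2 | m%n<n (n + 1) 2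
    ... | 0     | 0 | e | _ = contradiction (trans (+-comm 1 n) e) λ ()
    ... | 0     | 1 | e | _ = contradiction (≤-trans (s≤s n≥) (≤-reflexive (trans (+-comm 1 n) e)))
        (<⇒≱ (from-yes (1 <? 51)))
    ... | suc k | 0 | e | _ = subst (λ n → 1 ≤ G n (suc k))
        (sym (trans (+-cancelʳ-≡ 1 n (1 + (k + k)) (trans e (ring k))) (sym (pad-+ 1 k)))) (positive G G-suc 0 k λ ())
      where
      ring : ∀ k → 0 + suc k * 2 ≡ 1 + (k + k) + 1
      ring = solve-∀
    ... | suc 0 | 1 | e | _ = contradiction (≤-trans (s≤s n≥) (≤-reflexive (trans (+-comm 1 n) e)))
        (<⇒≱ (from-yes (3 <? 51)))
    ... | suc 1 | 1 | e | _ = contradiction (≤-trans (s≤s n≥) (≤-reflexive (trans (+-comm 1 n) e)))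
        (<⇒≱ (from-yes (5 <? 51)))
    ... | suc (suc (suc j)) | 1 | e | _ = subst (λ n → 1 ≤ G n (3 + j))
        (sym (trans (+-cancelʳ-≡ 1 n (2 + (2 + j + (2 + j))) (trans e (ring j))) (sym (pad-+ 2 (2 + j)))))
            (positive-1 G G-suc j)
      where
      ring : ∀ j → 1 + (3 + j) * 2 ≡ 2 + (2 + j + (2 + j)) + 1
      ring = solve-∀
    ... | _ | suc (suc _) | _ | s≤s (s≤s ())

    shape-large : ∀ {n} → 50 ≤ n → Shape (λ i → + G n i) 1 (r₅ n) ((n + 2) / 3 + 1)
    shape-large {n} n≥ = (m≤n+m 1 _ , p≤r) , (ℤ.+<+ (positive-min n≥) , ℤ.+<+ (positive-max n≥)) ,
                         (λ i< q≤ → ℤ.+<+ (rising-large n≥ i< q≤)) , (λ i< p≤ → ℤ.+<+ (falling-large n≥ i< p≤))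
      where
      p≤r : (n + 2) / 3 + 1 ≤ r₅ n
      p≤r = *≤⇒≤/ _ (n + 1) 2 (*-cancelˡ-≤ 3 (begin
        3 * (((n + 2) / 3 + 1) * 2)  ≡⟨ ring ((n + 2) / 3) ⟩
        2 * ((n + 2) / 3 * 3) + 6    ≤⟨ +-monoˡ-≤ 6 (*-monoʳ-≤ 2 (m/n*n≤m (n + 2) 3)) ⟩
        2 * (n + 2) + 6              ≡⟨ ring′ n ⟩
        7 + (2 * n + 3)              ≤⟨ +-monoˡ-≤ (2 * n + 3) (≤-trans (from-yes (7 ≤? 50)) n≥) ⟩
        n + (2 * n + 3)              ≡⟨ ring″ n ⟩
        3 * (n + 1)                  ∎))
        where
        ring : ∀ t → 3 * ((t + 1) * 2) ≡ 2 * (t * 3) + 6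
        ring = solve-∀
        ring′ : ∀ n → 2 * (n + 2) + 6 ≡ 7 + (2 * n + 3)
        ring′ = solve-∀
        ring″ : ∀ n → n + (2 * n + 3) ≡ 3 * (n + 1)
        ring″ = solve-∀

    shape-medium : ∀ {m} → m < 49 → 1 ≤ m → Shape (λ i → + G (suc m) i) (q₅ (suc m)) (r₅ (suc m)) (p₅ (suc m))
    shape-medium {m} m<49 1≤m = shape-resp {q = q₅ (suc m)} {r₅ (suc m)} {p₅ (suc m)}
        (λ i → sym (G-distribution i)) (shape-small m<49 1≤m)
      where
      G-distribution : ∀ i → + G (suc m) i ≡ distribution m (lucas (suc m)) i
      G-distribution zero    = G-zero m
      G-distribution (suc k) = G-suc m k

    shape-from-50 : ∀ {n} → 50 ≤ n → Shape (λ i → + G n i) (q₅ n) (r₅ n) (p₅ n)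
    shape-from-50 {n} n≥ = subst₂ (λ q p → Shape (λ i → + G n i) q (r₅ n) p)
        (sym (q₅-large (≤-trans (m≤m+n 3 47) n≥))) (sym (p₅-large (≤-trans (m≤m+n 17 33) n≥))) (shape-large n≥)

    shape : ∀ n → 2 ≤ n → Shape (λ i → + G n i) (q₅ n) (r₅ n) (p₅ n)
    shape (suc m) (s≤s 1≤m) = [ (λ m<49 → shape-medium m<49 1≤m) , (λ 49≤m → shape-from-50 (s≤s 49≤m)) ]′
        (<-≤-connex m 49)

    zero-below : ∀ n → 2 ≤ n → ∀ {i} → i < q₅ n → G n i ≡ 0
    zero-below 1 (s≤s ())
    zero-below 2 _ ()
    zero-below (suc (suc (suc m))) _ {zero} _ = ℤ.+-injective (G-zero (suc (suc m)))
    zero-below (suc (suc (suc m))) _ {suc _} (s≤s ())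

    zero-above : ∀ n → 2 ≤ n → ∀ {i} → r₅ n < i → G n i ≡ 0
    zero-above (suc m) _ {suc k} (s≤s r≤k) = G-above G G-suc m k (+-cancelʳ-≤ 2 _ _ (begin
      suc m + 2        ≡⟨ ring m ⟩
      suc (suc m + 1)  ≤⟨ /≤⇒<* k (suc m + 1) 2 r≤k ⟩
      suc k * 2        ≡⟨ ring′ k ⟩
      k + k + 2        ∎))
      where
      ring : ∀ m → suc m + 2 ≡ suc (suc m + 1)
      ring = solve-∀
      ring′ : ∀ k → suc k * 2 ≡ k + k + 2
      ring′ = solve-∀

-- Genus range and unimodality

module GenusRange where

  open LadderGenus
  open PairCounting using (one)
  open ClosedForms using (w)
  open LucasNumbers
  open SmallCases
  open LucasRatios
  open Inequalities
  open PeakSteps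
  open PeakShape
  open import Data.Integer.Base as ℤ using (ℤ; +_)
  import Data.Integer.Properties as ℤ
  open import Data.List.Membership.Propositional.Properties
    using (∈-filter⁺; ∈-cartesianProduct⁺; ∈-++⁺ˡ; ∈-++⁺ʳ; ∈-map⁺)
  open import Data.Nat.Base using (ℕ; suc; _+_; _≤_)
  open import Data.Nat.Properties

  isPeak : ∀ {s q r p} → Shape (λ i → + s i) q r p → IsPeak s q r p
  isPeak {s} ((q≤p , p≤r) , _ , up , down) = record
    { q≤l        = q≤p
    ; l≤m        = ≤-refl
    ; m≤r        = p≤r
    ; ascending  = λ i q≤i i< → <⇒≤ (ℤ.drop‿+<+ (up (<-trans (n<1+n i) i<) q≤i))
    ; jump       = λ { i q≤i refl → ℤ.drop‿+<+ (up ≤-refl q≤i) }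
    ; plateau    = λ i p≤i i≤p → cong s (≤-antisym i≤p p≤i)
    ; drop       = λ p<r → ℤ.drop‿+<+ (down p<r ≤-refl)
    ; descending = λ i p<i i<r → <⇒≤ (ℤ.drop‿+<+ (down i<r (<⇒≤ p<i)))
    }

  subsets-complete : ∀ {n} (K : Subset n) → K ∈ subsets n
  subsets-complete []          = here refl
  subsets-complete (false ∷ K) = ∈-++⁺ˡ (∈-map⁺ (false ∷_) (subsets-complete K))
  subsets-complete {suc n} (true ∷ K) = ∈-++⁺ʳ (map (false ∷_) (subsets n)) (∈-map⁺ (true ∷_) (subsets-complete K))

  module _ {A : Set} {P : Pred A 0ℓ} (P? : Decidable P) where

    filter-nonempty : ∀ xs → 1 ≤ length (filter P? xs) → ∃[ x ] P x
    filter-nonempty (x ∷ xs) h with P? x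
    ... | yes p = x , p
    ... | no _  = filter-nonempty xs h

    filter-empty : ∀ {xs x} → length (filter P? xs) ≡ 0 → x ∈ xs → ¬ P x
    filter-empty {xs} e x∈ p with filter P? xs | ∈-filter⁺ P? x∈ p
    filter-empty () x∈ p | _ ∷ _ | _

  module _ (n : ℕ) where

    private
      genus-is? : ∀ i → Decidable (λ (KT : Subset n × Subset n) → HasGenus (ladder (proj₁ KT) (proj₂ KT)) i)
      genus-is? i KT = hasGenus? (ladder (proj₁ KT) (proj₂ KT)) i

    genus-exists : ∀ i → 1 ≤ g₅ n i → ∃₂ λ (K T : Subset n) → HasGenus (ladder K T) i
    genus-exists i h = let (K , T) , p = filter-nonempty (genus-is? i) (cartesianProduct (subsets n) (subsets n)) h in K , T , p

    genus-nonzero : ∀ (K T : Subset n) i → HasGenus (ladder K T) i → g₅ n i ≢ 0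
    genus-nonzero K T i p e = filter-empty (genus-is? i) e
        (∈-cartesianProduct⁺ (subsets-complete K) (subsets-complete T)) p

  module _ (n : ℕ) (2≤n : 2 ≤ n) where

    private
      S : Shape (λ i → + g₅ n i) (q₅ n) (r₅ n) (p₅ n)
      S = shape g₅ g₅-zero g₅-suc n 2≤n

    minGenus : IsMinGenus n (q₅ n)
    minGenus = genus-exists n (q₅ n) (ℤ.drop‿+<+ (proj₁ (proj₁ (proj₂ S)))) ,
      λ K T i p → ≮⇒≥ λ i<q → genus-nonzero n K T i p (zero-below g₅ g₅-zero g₅-suc n 2≤n i<q)

    maxGenus : IsMaxGenus n (r₅ n)
    maxGenus = genus-exists n (r₅ n) (ℤ.drop‿+<+ (proj₂ (proj₁ (proj₂ S)))) ,
      λ K T i p → ≮⇒≥ λ r<i → genus-nonzero n K T i p (zero-above g₅ g₅-zero g₅-suc n 2≤n r<i)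

    peak : IsPeak (g₅ n) (q₅ n) (r₅ n) (p₅ n)
    peak = isPeak S

open SmallCases using (q₅; r₅)
open GenusRange

theorem3p16 : ∀ (n : ℕ) → 2 ≤ n →
    ∃₂ λ q r → IsMinGenus n q × IsMaxGenus n r ×
    Unimodal (g₅ n) q r × IsPeak (g₅ n) q r (p₅ n)
theorem3p16 n 2≤n = q₅ n , r₅ n , minGenus n 2≤n , maxGenus n 2≤n , (p₅ n , p₅ n , peak n 2≤n) , peak n 2≤n
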